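{- Let $p,q\ge 3$ and $n\ge p+q-1$ be integers. Let $G\in \mathscr{B}_n^{p,q}$ with $G\neq P_n^{p,q}$ (up to isomorphism). Then $D_R(G)<D_R(P_n^{p,q})$.
   Context: All graphs are finite, simple and connected. For vertices $u,v$ of a graph $G$, the resistance distance $r(u,v)$ is the effective resistance between $u$ and $v$ in the electrical network obtained from $G$ by replacing every edge by a unit resistor. The degree resistance distance of $G$ is $D_R(G)=\sum_{\{u,v\}\subseteq V(G)}[d(u)+d(v)]\,r(u,v)$, where $d(u)$ is the degree of $u$ and the sum runs over unordered pairs of distinct vertices. A bicyclic graph is a connected graph with $|E(G)|=|V(G)|+1$. $\mathscr{B}_n^{p,q}$ denotes the set of $n$-vertex bicyclic graphs having exactly two cycles, of lengths $p$ and $q$; equivalently, graphs consisting of two cycles $C_p=v_1v_2\cdots v_pv_1$ and $C_q=u_1u_2\cdots u_qu_1$ joined by a path $v_1w_1\cdots w_{m-1}u_1$ of length $m\ge 0$ (when $m=0$, $v_1=u_1$ and the cycles share exactly this vertex), together with trees rooted at each vertex of the cycles and of the path. $P_n^{p,q}$ is the graph consisting of two vertex-disjoint cycles $C_p$ and $C_q$ and a path of length $n-p-q+1$ joining a vertex of $C_p$ to a vertex of $C_q$ (if $n-p-q+1=0$, the two cycles share exactly one vertex and there are no other vertices). -}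

module Defs where

open import Data.Bool using (Bool; true; false; if_then_else_; _∨_; _∧_)
open import Data.Nat as ℕ using (ℕ; zero; suc; _≤_; _≡ᵇ_; _∸_)
open import Data.Nat.DivMod using (_mod_)
open import Data.Fin using (Fin; toℕ)
open import Data.List using (List; map; foldr; allFin)
open import Data.Rational as ℚ using (ℚ; 0ℚ; 1ℚ; _+_; _*_; _-_; _<_)
open import Data.Product using (Σ; ∃; _×_; _,_)
open import Data.Sum using (_⊎_)
open import Data.Empty using (⊥)
import Data.Integer
open import Relation.Nullary using (¬_)
open import Relation.Nullary.Decidable using (⌊_⌋)
open import Relation.Binary.PropositionalEquality using (_≡_)
open import Function.Definitions using (Injective; Bijective)

Graph : ℕ → Set
Graph n = Fin n → Fin n → Bool

IsSimple : ∀ {n} → Graph n → Set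
IsSimple {n} G = (∀ u v → G u v ≡ G v u) × (∀ u → G u u ≡ false)

data Reach {n} (G : Graph n) : Fin n → Fin n → Set where
  here : ∀ {u} → Reach G u u
  step : ∀ {u w v} → G u w ≡ true → Reach G w v → Reach G u v

Connected : ∀ {n} → Graph n → Set
Connected {n} G = ∀ (u v : Fin n) → Reach G u v

sumℕ : ∀ {n} → (Fin n → ℕ) → ℕ
sumℕ {n} f = foldr ℕ._+_ 0 (map f (allFin n))

sumℚ : ∀ {n} → (Fin n → ℚ) → ℚ
sumℚ {n} f = foldr _+_ 0ℚ (map f (allFin n))

b2ℕ : Bool → ℕ
b2ℕ true = 1
b2ℕ false = 0

deg : ∀ {n} → Graph n → Fin n → ℕ
deg G u = sumℕ (λ v → b2ℕ (G u v))

edgeCount : ∀ {n} → Graph n → ℕ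
edgeCount G = sumℕ (λ u → sumℕ (λ v → b2ℕ (⌊ toℕ u ℕ.<? toℕ v ⌋ ∧ G u v)))

next : ∀ {k} → Fin k → Fin k
next {suc j} i = suc (toℕ i) mod suc j

IsCycle : ∀ {n} → Graph n → (k : ℕ) → (Fin k → Fin n) → Set
IsCycle G zero c = ⊥
IsCycle G (suc j) c = (3 ≤ suc j) × Injective _≡_ _≡_ c × (∀ i → G (c i) (c (next i)) ≡ true)

CycEdge : ∀ {n k} → (Fin k → Fin n) → Fin n → Fin n → Set
CycEdge c a b = ∃ λ i → (c i ≡ a × c (next i) ≡ b) ⊎ (c i ≡ b × c (next i) ≡ a)

SameCycle : ∀ {n k l} → (Fin k → Fin n) → (Fin l → Fin n) → Set
SameCycle c d = ∀ a b → (CycEdge c a b → CycEdge d a b) × (CycEdge d a b → CycEdge c a b)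

ExactlyTwoCycles : ∀ {n} → Graph n → ℕ → ℕ → Set
ExactlyTwoCycles {n} G p q =
  Σ (Fin p → Fin n) λ c₁ → Σ (Fin q → Fin n) λ c₂ →
    IsCycle G p c₁ × IsCycle G q c₂ × ¬ SameCycle c₁ c₂ ×
    (∀ k (c : Fin k → Fin n) → IsCycle G k c → SameCycle c c₁ ⊎ SameCycle c c₂)

InB : (n p q : ℕ) → Graph n → Set
InB n p q G = IsSimple G × Connected G × (edgeCount G ≡ suc n) × ExactlyTwoCycles G p q

-- The graph P_n^{p,q}: path 0 - 1 - ... - (n-1), plus edges {0,p-1} and {n-q,n-1}.
-- C_p = 0..p-1, C_q = n-q..n-1, joined by the path p-1 .. n-q of length n-p-q+1.
infix 4 _==_
_==_ : ℕ → ℕ → Bool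
_==_ = _≡ᵇ_

Pℕ : (n p q : ℕ) → ℕ → ℕ → Bool
Pℕ n p q i j = (j == suc i) ∨ (i == suc j)
             ∨ ((i == 0) ∧ (j == p ∸ 1)) ∨ ((j == 0) ∧ (i == p ∸ 1))
             ∨ ((i == n ∸ q) ∧ (j == n ∸ 1)) ∨ ((j == n ∸ q) ∧ (i == n ∸ 1))

Pgraph : (n p q : ℕ) → Graph n
Pgraph n p q u v = Pℕ n p q (toℕ u) (toℕ v)

Iso : ∀ {n} → Graph n → Graph n → Set
Iso {n} G H = Σ (Fin n → Fin n) λ f → Bijective _≡_ _≡_ f × (∀ u v → G u v ≡ H (f u) (f v))

fromℕℚ : ℕ → ℚ
fromℕℚ k = Data.Integer.+ k ℚ./ 1

lap : ∀ {n} → Graph n → (Fin n → ℚ) → Fin n → ℚ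
lap G x u = sumℚ (λ v → if G u v then x u - x v else 0ℚ)

indic : ∀ {n} → Fin n → Fin n → ℚ
indic u w = if ⌊ u Data.Fin.≟ w ⌋ then 1ℚ else 0ℚ

-- r is the effective resistance function of G: for all u,v, injecting a unit
-- current at u and extracting it at v gives a potential x (Kirchhoff + Ohm:
-- L x = e_u - e_v) with potential difference x u - x v = r u v.
IsResistance : ∀ {n} → Graph n → (Fin n → Fin n → ℚ) → Set
IsResistance G r = ∀ u v → Σ _ λ x →
  (∀ w → lap G x w ≡ indic u w - indic v w) × (r u v ≡ x u - x v)

DR : ∀ {n} → Graph n → (Fin n → Fin n → ℚ) → ℚ
DR G r = sumℚ (λ u → sumℚ (λ v →
  if ⌊ toℕ u ℕ.<? toℕ v ⌋ then fromℕℚ (deg G u ℕ.+ deg G v) * r u v else 0ℚ))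

-- Write R(v) for the sum of r(v,u) and S(v) for the sum of d(u) r(v,u) over u, and Φ = S + 2R. Gluing a cycle or a pendant
-- edge at a vertex w changes D_R, R, S by explicit formulas; P_n^{p,q} arises from C_q by attaching a path and then C_p.
-- Attaching a leaf at w to a bicyclic graph on k vertices raises D_R by Φ(w) + 3(k+1), and Φ(w) stays below the value
-- which would make this equal to D_R(P_{k+1}) - D_R(P_k): on the core P_{k'} by computation, and later because Φ grows
-- fastest at the new leaf. Hence every leaf attached to the core strictly loses against P.
-- A graph with exactly two cycles is such a core with leaves attached: if the cycles shared an edge or two vertices,
-- a third cycle could be closed; a path joining them then gives a copy of P_{k'} with k'+1 edges, and adding the other
-- vertices one by one, each with at least one edge, exhausts the n+1 edges, so each is a leaf when it is added.
module Submission where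

open import Defs
open import Data.Nat as ℕ using (ℕ; zero; suc)
import Data.Nat.Properties as ℕₚ
open import Data.Nat.Divisibility using (∣1⇒≡1)
open import Data.Nat.Coprimality using (Coprime)
import Data.Integer as ℤ
import Data.Integer.Properties as ℤₚ
open import Data.Bool using (Bool; true; false; if_then_else_; _∨_; _∧_)
open import Data.Fin using (Fin; zero; suc; toℕ; fromℕ; inject₁; punchOut; splitAt; _↑ˡ_; _↑ʳ_; _≟_)
open import Data.Fin.Induction using (<-weakInduction)
open import Data.Fin.Relation.Unary.Top using (view; ‵fromℕ; ‵inject₁)
open import Data.Nat.DivMod using (_%_; m<n⇒m%n≡m; n%n≡0)
open import Relation.Binary.Construct.Closure.ReflexiveTransitive using (Star; ε; _◅_; _◅◅_; reverse; fold)
open import Function.Definitions using (Injective)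
import Data.Fin.Properties as Finₚ
open import Data.List using (allFin; foldr; map)
open import Data.List.Properties using (map-tabulate)
open import Data.Product using (Σ; _×_; _,_; proj₁; proj₂)
open import Data.Sum using (_⊎_; inj₁; inj₂; [_,_]′)
open import Data.Empty using (⊥-elim)
open import Data.Rational as ℚ using (ℚ; 0ℚ; 1ℚ; ½; _+_; _*_; _-_; -_; _≤_; _<_; mkℚ)
import Data.Rational.Properties as ℚₚ
open import Data.Rational.Solver using (module +-*-Solver)
open +-*-Solver using (solve; _:+_; _:*_; _:-_; :-_; _:=_; con)
open import Relation.Nullary using (¬_; Dec; yes; no; _×-dec_; _⊎-dec_)
open import Relation.Nullary.Decidable using (⌊_⌋)
open import Relation.Binary.PropositionalEquality using (_≡_; _≢_; refl; sym; trans; cong; cong₂; subst; subst₂; module ≡-Reasoning)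
open import Function using (_∘_; id)
open import Relation.Binary.Definitions using (tri<; tri≈; tri>)
import Algebra.Properties.CommutativeMonoid.Sum ℚₚ.+-0-commutativeMonoid as CMSum
import Algebra.Properties.Semiring.Sum as SemiringSum
open import Algebra.Bundles using (CommutativeRing)
import Data.Fin.Permutation as Perm
import Data.Nat.Solver

open ≡-Reasoning

-- Graphs are replaced by symmetric rational matrices, so that degrees, resistances and edge counts
-- all become linear sums. No Laplacian is ever inverted: a network is assembled by gluing, each
-- gluing exhibits the potentials, and self-adjointness of the Laplacian shows that every function
-- satisfying `IsResistance` agrees with the assembled one. The obstacle is that a leaf may go to
-- any vertex of trees of any shape. The invariant therefore depends only on the number `s` of
-- bridges: one strict bound `Φ v < U s` at all vertices. At the newest leaf `Φ` and `U` grow by the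
-- same amount, so the strictness has to come from the core. There the maximal resistance p/4 in a
-- cycle of length p reduces it to a polynomial in p - 3, q - 3 and `s` with positive coefficients.
-- On the graph side chords are not excluded by hand. Inequalities between single entries are
-- summed, and equality of the totals, which the edge count supplies, forces equality of the
-- entries.

coprime-1 : ∀ k → Coprime k 1
coprime-1 k (_ , d∣1) = ∣1⇒≡1 d∣1

-- Division normalises by a gcd that is stuck on a variable numerator; in the explicit form sums and
-- comparisons compute.
fromℕℚ-mk : ∀ k → fromℕℚ k ≡ mkℚ (ℤ.+ k) 0 (coprime-1 k)
fromℕℚ-mk k = ℚₚ.normalize-coprime (coprime-1 k)

fromℕℚ-+ : ∀ a b → fromℕℚ (a ℕ.+ b) ≡ fromℕℚ a + fromℕℚ b
fromℕℚ-+ a b = trans eq (sym (cong₂ _+_ (fromℕℚ-mk a) (fromℕℚ-mk b)))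
  where
  eq : fromℕℚ (a ℕ.+ b) ≡ mkℚ (ℤ.+ a) 0 (coprime-1 a) + mkℚ (ℤ.+ b) 0 (coprime-1 b)
  eq = cong (λ z → z ℚ./ 1) (sym (cong₂ ℤ._+_ (ℤₚ.*-identityʳ (ℤ.+ a)) (ℤₚ.*-identityʳ (ℤ.+ b))))

fromℕℚ-suc : ∀ a → fromℕℚ (suc a) ≡ 1ℚ + fromℕℚ a
fromℕℚ-suc a = fromℕℚ-+ 1 a

fromℕℚ-mono : ∀ {a b} → a ℕ.≤ b → fromℕℚ a ≤ fromℕℚ b
fromℕℚ-mono {a} {b} le rewrite fromℕℚ-mk a | fromℕℚ-mk b =
  ℚ.*≤* (ℤₚ.*-monoʳ-≤-nonNeg (ℤ.+ 1) (ℤ.+≤+ le))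

-- Finite sums over ℚ and the Kronecker delta

foldr-tabulate : ∀ {A : Set} {n} (op : A → A → A) (e : A) (f : Fin (suc n) → A) →
  foldr op e (map f (allFin (suc n))) ≡ op (f zero) (foldr op e (map (f ∘ suc) (allFin n)))
foldr-tabulate op e f = cong (λ l → op (f zero) (foldr op e l))
  (trans (map-tabulate suc f) (sym (map-tabulate id (f ∘ suc))))

sumℕ-suc : ∀ {n} (f : Fin (suc n) → ℕ) → sumℕ f ≡ f zero ℕ.+ sumℕ (f ∘ suc)
sumℕ-suc f = foldr-tabulate ℕ._+_ 0 f

-- A sum stays an atom: ring normalisation does not unfold it, and its summand can be inferred from
-- it.
opaque
  ∑ : ∀ {n} → (Fin n → ℚ) → ℚ
  ∑ = CMSum.sum

  ∑-[] : (f : Fin 0 → ℚ) → ∑ f ≡ 0ℚ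
  ∑-[] f = refl

  ∑-suc : ∀ {n} (f : Fin (suc n) → ℚ) → ∑ f ≡ f zero + ∑ (f ∘ suc)
  ∑-suc f = refl

  ∑-cong : ∀ {n} {f g : Fin n → ℚ} → (∀ i → f i ≡ g i) → ∑ f ≡ ∑ g
  ∑-cong = CMSum.sum-cong-≗

  ∑-+ : ∀ {n} (f g : Fin n → ℚ) → ∑ (λ i → f i + g i) ≡ ∑ f + ∑ g
  ∑-+ = CMSum.∑-distrib-+

  ∑-comm : ∀ {m n} (f : Fin m → Fin n → ℚ) → ∑ (λ i → ∑ (f i)) ≡ ∑ (λ j → ∑ (λ i → f i j))
  ∑-comm = CMSum.∑-comm

  ∑-permute : ∀ {m n} (f : Fin n → ℚ) (π : Perm.Permutation m n) → ∑ f ≡ ∑ (λ i → f (π Perm.⟨$⟩ʳ i))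
  ∑-permute = CMSum.sum-permute

  ∑-* : ∀ {n} (c : ℚ) (f : Fin n → ℚ) → ∑ (λ i → c * f i) ≡ c * ∑ f
  ∑-* c f = sym (SemiringSum.*-distribˡ-sum (CommutativeRing.semiring ℚₚ.+-*-commutativeRing) c f)

sumℚ≡∑ : ∀ {n} (f : Fin n → ℚ) → sumℚ f ≡ ∑ f
sumℚ≡∑ {zero} f = sym (∑-[] f)
sumℚ≡∑ {suc n} f = trans (foldr-tabulate _+_ 0ℚ f) (trans (cong (f zero +_) (sumℚ≡∑ (f ∘ suc))) (sym (∑-suc f)))

∑-neg : ∀ {n} (f : Fin n → ℚ) → ∑ (λ i → - f i) ≡ - ∑ f
∑-neg f = begin
  ∑ (λ i → - f i)          ≡⟨ ∑-cong (λ i → solve 1 (λ x → :- x := con (- 1ℚ) :* x) refl (f i)) ⟩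
  ∑ (λ i → - 1ℚ * f i)     ≡⟨ ∑-* (- 1ℚ) f ⟩
  - 1ℚ * ∑ f               ≡⟨ solve 1 (λ x → con (- 1ℚ) :* x := :- x) refl (∑ f) ⟩
  - ∑ f                    ∎

∑-- : ∀ {n} (f g : Fin n → ℚ) → ∑ (λ i → f i - g i) ≡ ∑ f - ∑ g
∑-- f g = trans (∑-+ f (λ i → - g i)) (cong (∑ f +_) (∑-neg g))

∑-const : ∀ {n} (c : ℚ) → ∑ {n} (λ _ → c) ≡ fromℕℚ n * c
∑-const {zero} c = trans (∑-[] _) (sym (ℚₚ.*-zeroˡ c))
∑-const {suc n} c = begin
  ∑ {suc n} (λ _ → c)        ≡⟨ ∑-suc _ ⟩
  c + ∑ {n} (λ _ → c)        ≡⟨ cong (c +_) (∑-const {n} c) ⟩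
  c + fromℕℚ n * c           ≡⟨ solve 2 (λ c n → c :+ n :* c := (con 1ℚ :+ n) :* c) refl c (fromℕℚ n) ⟩
  (1ℚ + fromℕℚ n) * c        ≡⟨ cong (_* c) (sym (fromℕℚ-suc n)) ⟩
  fromℕℚ (suc n) * c         ∎

∑-0 : ∀ {n} {f : Fin n → ℚ} → (∀ i → f i ≡ 0ℚ) → ∑ f ≡ 0ℚ
∑-0 {n} h = trans (∑-cong h) (trans (∑-const {n} 0ℚ) (ℚₚ.*-zeroʳ (fromℕℚ n)))

indic-refl : ∀ {n} (u : Fin n) → indic u u ≡ 1ℚ
indic-refl u with u ≟ u
... | yes _ = refl
... | no ne = ⊥-elim (ne refl)

indic-≢ : ∀ {n} {u w : Fin n} → u ≢ w → indic u w ≡ 0ℚ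
indic-≢ {u = u} {w} ne with u ≟ w
... | yes e = ⊥-elim (ne e)
... | no _ = refl

indic-injective : ∀ {m n} (f : Fin m → Fin n) → (∀ {x y} → f x ≡ f y → x ≡ y) →
  ∀ u w → indic (f u) (f w) ≡ indic u w
indic-injective f inj u w with u ≟ w
... | yes refl = indic-refl (f u)
... | no ne = indic-≢ (ne ∘ inj)

indic-sym : ∀ {n} (u w : Fin n) → indic u w ≡ indic w u
indic-sym u w with u ≟ w
... | yes refl = sym (indic-refl u)
... | no ne = sym (indic-≢ (ne ∘ sym))

∑-indic : ∀ {n} (f : Fin n → ℚ) (u : Fin n) → ∑ (λ w → f w * indic u w) ≡ f u
∑-indic f zero = begin
  ∑ (λ w → f w * indic zero w) ≡⟨ ∑-suc _ ⟩
  f zero * 1ℚ + ∑ (λ w → f (suc w) * indic zero (suc w))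
    ≡⟨ cong₂ _+_ (ℚₚ.*-identityʳ (f zero)) (∑-0 (λ w → ℚₚ.*-zeroʳ (f (suc w)))) ⟩
  f zero + 0ℚ ≡⟨ ℚₚ.+-identityʳ _ ⟩
  f zero ∎
∑-indic f (suc u) = begin
  ∑ (λ w → f w * indic (suc u) w) ≡⟨ ∑-suc _ ⟩
  f zero * 0ℚ + ∑ (λ w → f (suc w) * indic (suc u) (suc w))
    ≡⟨ cong₂ _+_ (ℚₚ.*-zeroʳ (f zero)) (∑-cong (λ w → cong (f (suc w) *_) (indic-injective suc Finₚ.suc-injective u w))) ⟩
  0ℚ + ∑ (λ w → f (suc w) * indic u w) ≡⟨ ℚₚ.+-identityˡ _ ⟩
  ∑ (λ w → f (suc w) * indic u w) ≡⟨ ∑-indic (f ∘ suc) u ⟩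
  f (suc u) ∎

∑-split : ∀ m {k} (F : Fin m ⊎ Fin k → ℚ) →
  ∑ (λ a → F (splitAt m a)) ≡ ∑ (F ∘ inj₁) + ∑ (F ∘ inj₂)
∑-split zero F = trans (sym (ℚₚ.+-identityˡ _)) (cong (_+ ∑ (F ∘ inj₂)) (sym (∑-[] (F ∘ inj₁))))
∑-split (suc m) F = begin
  ∑ (λ a → F (splitAt (suc m) a)) ≡⟨ ∑-suc _ ⟩
  F (inj₁ zero) + ∑ (λ a → F (Data.Sum.map₁ suc (splitAt m a)))
    ≡⟨ cong (F (inj₁ zero) +_) (∑-split m (F ∘ Data.Sum.map₁ suc)) ⟩
  F (inj₁ zero) + (∑ (F ∘ inj₁ ∘ suc) + ∑ (F ∘ inj₂))
    ≡⟨ sym (ℚₚ.+-assoc (F (inj₁ zero)) _ _) ⟩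
  F (inj₁ zero) + ∑ (F ∘ inj₁ ∘ suc) + ∑ (F ∘ inj₂)
    ≡⟨ cong (_+ ∑ (F ∘ inj₂)) (sym (∑-suc (F ∘ inj₁))) ⟩
  ∑ (F ∘ inj₁) + ∑ (F ∘ inj₂) ∎

-- Weighted networks, Laplacian and effective resistance

Mat : ℕ → Set
Mat n = Fin n → Fin n → ℚ

Symm : ∀ {n} → Mat n → Set
Symm A = ∀ u v → A u v ≡ A v u

lapM : ∀ {n} → Mat n → (Fin n → ℚ) → Fin n → ℚ
lapM A x u = ∑ (λ v → A u v * (x u - x v))

ResM : ∀ {n} → Mat n → Mat n → Set
ResM A r = ∀ u v → Σ _ λ x →
  (∀ w → lapM A x w ≡ indic u w - indic v w) × (r u v ≡ x u - x v)

degM : ∀ {n} → Mat n → Fin n → ℚ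
degM A u = ∑ (A u)

Rsum : ∀ {n} → Mat n → Fin n → ℚ
Rsum r u = ∑ (r u)

Ssum : ∀ {n} → Mat n → Mat n → Fin n → ℚ
Ssum A r u = ∑ (λ v → degM A v * r u v)

Tsum : ∀ {n} → Mat n → ℚ
Tsum A = ∑ (degM A)

-- This is D_R summed over ordered pairs: for symmetric `r` the pairs (u, v) and (v, u) together
-- contribute (d(u) + d(v)) r(u, v).
Dsum : ∀ {n} → Mat n → Mat n → ℚ
Dsum A r = ∑ (λ u → degM A u * Rsum r u)

pairing : ∀ {n} (f : Fin n → ℚ) u v → ∑ (λ w → f w * (indic u w - indic v w)) ≡ f u - f v
pairing f u v = begin
  ∑ (λ w → f w * (indic u w - indic v w))
    ≡⟨ ∑-cong (λ w → solve 3 (λ f a b → f :* (a :- b) := f :* a :- f :* b) refl (f w) (indic u w) (indic v w)) ⟩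
  ∑ (λ w → f w * indic u w - f w * indic v w) ≡⟨ ∑-- _ _ ⟩
  ∑ (λ w → f w * indic u w) - ∑ (λ w → f w * indic v w) ≡⟨ cong₂ _-_ (∑-indic f u) (∑-indic f v) ⟩
  f u - f v ∎

lap-expand : ∀ {n} (A : Mat n) (x y : Fin n → ℚ) →
  ∑ (λ w → y w * lapM A x w) ≡
  ∑ (λ w → ∑ (λ v → A w v * (y w * x w))) - ∑ (λ w → ∑ (λ v → A w v * (y w * x v)))
lap-expand A x y = trans (∑-cong (λ w → trans (sym (∑-* (y w) _)) (trans (∑-cong (λ v →
    solve 4 (λ y a b c → y :* (a :* (b :- c)) := a :* (y :* b) :- a :* (y :* c)) refl (y w) (A w v) (x w) (x v))) (∑-- _ _))))
  (∑-- _ _)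

-- Both double sums of `lap-expand` are symmetric in `x` and `y`, the first term by term, the second
-- after an exchange of the summation indices.
lap-selfadjoint : ∀ {n} (A : Mat n) → Symm A → (x y : Fin n → ℚ) →
  ∑ (λ w → y w * lapM A x w) ≡ ∑ (λ w → x w * lapM A y w)
lap-selfadjoint A symA x y = begin
  ∑ (λ w → y w * lapM A x w) ≡⟨ lap-expand A x y ⟩
  ∑ (λ w → ∑ (λ v → A w v * (y w * x w))) - ∑ (λ w → ∑ (λ v → A w v * (y w * x v)))
    ≡⟨ cong₂ _-_ (∑-cong (λ w → ∑-cong (λ v → cong (A w v *_) (ℚₚ.*-comm (y w) (x w)))))
         (trans (∑-comm (λ w v → A w v * (y w * x v)))
           (∑-cong (λ w → ∑-cong (λ v → cong₂ _*_ (symA v w) (ℚₚ.*-comm (y v) (x w)))))) ⟩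
  ∑ (λ w → ∑ (λ v → A w v * (x w * y w))) - ∑ (λ w → ∑ (λ v → A w v * (x w * y v)))
    ≡⟨ sym (lap-expand A y x) ⟩
  ∑ (λ w → x w * lapM A y w) ∎

-- Reciprocity instead of the kernel of the Laplacian: each potential is paired with the current of
-- the other, and the two pairings agree.
res-unique : ∀ {n} {A r r' : Mat n} → Symm A → ResM A r → ResM A r' → ∀ u v → r u v ≡ r' u v
res-unique {A = A} {r} {r'} symA R R' u v with R u v | R' u v
... | x , lx , ex | y , ly , ey = begin
  r u v ≡⟨ ex ⟩
  x u - x v ≡⟨ sym (pairing x u v) ⟩
  ∑ (λ w → x w * (indic u w - indic v w)) ≡⟨ ∑-cong (λ w → cong (x w *_) (sym (ly w))) ⟩
  ∑ (λ w → x w * lapM A y w) ≡⟨ lap-selfadjoint A symA y x ⟩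
  ∑ (λ w → y w * lapM A x w) ≡⟨ ∑-cong (λ w → cong (y w *_) (lx w)) ⟩
  ∑ (λ w → y w * (indic u w - indic v w)) ≡⟨ pairing y u v ⟩
  y u - y v ≡⟨ sym ey ⟩
  r' u v ∎

lap-neg : ∀ {n} (A : Mat n) x w → lapM A (λ v → - x v) w ≡ - lapM A x w
lap-neg A x w = trans (∑-cong (λ v → solve 3 (λ a b c → a :* (:- b :- :- c) := :- (a :* (b :- c))) refl (A w v) (x w) (x v)))
  (∑-neg _)

-- Reversing the current negates the potential, so the transpose of `r` is a resistance function
-- too, and uniqueness applies.
res-sym : ∀ {n} {A r : Mat n} → Symm A → ResM A r → Symm r
res-sym {A = A} {r} symA R = res-unique symA R R⁻
  where
  R⁻ : ResM A (λ u v → r v u)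
  R⁻ u v with R v u
  ... | x , lx , ex = (λ w → - x w) ,
    (λ w → trans (lap-neg A x w) (trans (cong -_ (lx w))
      (solve 2 (λ a b → :- (a :- b) := b :- a) refl (indic v w) (indic u w)))) ,
    trans ex (solve 2 (λ a b → a :- b := :- b :- :- a) refl (x v) (x u))

res-diag : ∀ {n} {A r : Mat n} → ResM A r → ∀ u → r u u ≡ 0ℚ
res-diag R u with R u u
... | x , _ , e = trans e (ℚₚ.+-inverseʳ (x u))

-- Gluing a block at a vertex

-- A network with ground: B joins the m new vertices among themselves, b joins them to the ground, and c is the
-- Green function grounded there. All m + 1 vertices have the same degree d and the same sum σ of resistances.
record Block (m : ℕ) : Set where
  no-eta-equality
  field
    B : Mat m
    b : Fin m → ℚ
    c : Mat m
    d σ : ℚ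
    B-sym : Symm B
    green : ∀ i l → ∑ (λ l' → B l l' * (c i l - c i l')) + b l * c i l ≡ indic i l
    ground : ∀ i → ∑ (λ l → b l * c i l) ≡ 1ℚ
    B-deg : ∀ i → ∑ (B i) + b i ≡ d
    b-deg : ∑ b ≡ d
    c-sym : Symm c
    σ-ground : ∑ (λ i → c i i) ≡ σ
    σ-new : ∀ i → ∑ (λ j → c i i + c j j - (c i j + c i j)) + c i i ≡ σ

∑-scale : ∀ {n} (f : Fin n → ℚ) (c : ℚ) → ∑ (λ i → f i * c) ≡ ∑ f * c
∑-scale f c = trans (∑-cong (λ i → ℚₚ.*-comm (f i) c)) (trans (∑-* c f) (ℚₚ.*-comm c (∑ f)))

∑-shift : ∀ {n} (f : Fin n → ℚ) (c : ℚ) → ∑ (λ i → c + f i) ≡ fromℕℚ n * c + ∑ f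
∑-shift f c = trans (∑-+ (λ _ → c) f) (cong (_+ ∑ f) (∑-const c))

module Glue {m k : ℕ} (blk : Block m) (A : Mat k) (w : Fin k) where
  open Block blk

  V : Set
  V = Fin m ⊎ Fin k

  adj : V → V → ℚ
  adj (inj₁ i) (inj₁ j) = B i j
  adj (inj₁ i) (inj₂ u) = b i * indic w u
  adj (inj₂ u) (inj₁ i) = b i * indic w u
  adj (inj₂ u) (inj₂ v) = A u v

  π : V → Fin k
  π (inj₁ _) = w
  π (inj₂ u) = u

  -- The potential of a unit current sent from a vertex through the block to the ground `w`. It is
  -- extended by 0 to the old network; from an old vertex no current enters the block.
  κ : V → V → ℚ
  κ (inj₁ i) (inj₁ j) = c i j
  κ (inj₁ i) (inj₂ _) = 0ℚ
  κ (inj₂ _) _ = 0ℚ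

  -- The part of the resistance that lies inside the block, obtained from the Green function by
  -- polarisation (`ρ-κ`).
  ρ : V → V → ℚ
  ρ (inj₁ i) (inj₁ j) = c i i + c j j - (c i j + c i j)
  ρ (inj₁ i) (inj₂ _) = c i i
  ρ (inj₂ _) (inj₁ j) = c j j
  ρ (inj₂ _) (inj₂ _) = 0ℚ

  glueA : Mat (m ℕ.+ k)
  glueA a a' = adj (splitAt m a) (splitAt m a')

  module _ (r : Mat k) where
    res : V → V → ℚ
    res a a' = r (π a) (π a') + ρ a a'

    glueR : Mat (m ℕ.+ k)
    glueR a a' = res (splitAt m a) (splitAt m a')

  δ : V → V → ℚ
  δ (inj₁ i) (inj₁ j) = indic i j
  δ (inj₁ _) (inj₂ _) = 0ℚ
  δ (inj₂ _) (inj₁ _) = 0ℚ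
  δ (inj₂ u) (inj₂ v) = indic u v

  indic-split : ∀ (a a' : Fin (m ℕ.+ k)) → indic a a' ≡ δ (splitAt m a) (splitAt m a')
  indic-split a a' with splitAt m a in ea | splitAt m a' in ea'
  ... | inj₁ i | inj₁ j rewrite sym (Finₚ.splitAt⁻¹-↑ˡ ea) | sym (Finₚ.splitAt⁻¹-↑ˡ ea') =
    indic-injective (_↑ˡ k) (Finₚ.↑ˡ-injective k _ _) i j
  ... | inj₁ i | inj₂ v = indic-≢ λ { refl → case-⊥ (trans (sym ea) ea') }
    where case-⊥ : inj₁ i ≢ inj₂ v
          case-⊥ ()
  ... | inj₂ u | inj₁ j = indic-≢ λ { refl → case-⊥ (trans (sym ea) ea') }
    where case-⊥ : inj₂ u ≢ inj₁ j
          case-⊥ ()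
  ... | inj₂ u | inj₂ v rewrite sym (Finₚ.splitAt⁻¹-↑ʳ ea) | sym (Finₚ.splitAt⁻¹-↑ʳ ea') =
    indic-injective (m ↑ʳ_) (Finₚ.↑ʳ-injective m _ _) u v

  lapV : (V → ℚ) → V → ℚ
  lapV x a = ∑ (λ i → adj a (inj₁ i) * (x a - x (inj₁ i))) + ∑ (λ u → adj a (inj₂ u) * (x a - x (inj₂ u)))

  lap-split : ∀ (x : V → ℚ) a → lapM glueA (x ∘ splitAt m) a ≡ lapV x (splitAt m a)
  lap-split x a = ∑-split m (λ a' → adj (splitAt m a) a' * (x (splitAt m a) - x a'))

  lapV-+ : ∀ (x y : V → ℚ) a → lapV (λ v → x v + y v) a ≡ lapV x a + lapV y a
  lapV-+ x y a = trans
    (cong₂ _+_ (trans (∑-cong (λ i → split (adj a (inj₁ i)) (x a) (y a) (x (inj₁ i)) (y (inj₁ i)))) (∑-+ _ _))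
               (trans (∑-cong (λ u → split (adj a (inj₂ u)) (x a) (y a) (x (inj₂ u)) (y (inj₂ u)))) (∑-+ _ _)))
    (solve 4 (λ p q r s → p :+ q :+ (r :+ s) := p :+ r :+ (q :+ s)) refl
      (∑ (λ i → adj a (inj₁ i) * (x a - x (inj₁ i)))) (∑ (λ i → adj a (inj₁ i) * (y a - y (inj₁ i))))
      (∑ (λ u → adj a (inj₂ u) * (x a - x (inj₂ u)))) (∑ (λ u → adj a (inj₂ u) * (y a - y (inj₂ u)))))
    where
    split : ∀ α p q r s → α * (p + q - (r + s)) ≡ α * (p - r) + α * (q - s)
    split = solve 5 (λ α p q r s → α :* (p :+ q :- (r :+ s)) := α :* (p :- r) :+ α :* (q :- s)) refl

  lapV-neg : ∀ (x : V → ℚ) a → lapV (λ v → - x v) a ≡ - lapV x a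
  lapV-neg x a = trans
    (cong₂ _+_ (trans (∑-cong (λ i → neg (adj a (inj₁ i)) (x a) (x (inj₁ i)))) (∑-neg _))
               (trans (∑-cong (λ u → neg (adj a (inj₂ u)) (x a) (x (inj₂ u)))) (∑-neg _)))
    (sym (ℚₚ.neg-distrib-+ (∑ (λ i → adj a (inj₁ i) * (x a - x (inj₁ i)))) (∑ (λ u → adj a (inj₂ u) * (x a - x (inj₂ u))))))
    where
    neg : ∀ α p q → α * (- p - - q) ≡ - (α * (p - q))
    neg = solve 3 (λ α p q → α :* (:- p :- :- q) := :- (α :* (p :- q))) refl

  zero-diff : ∀ α p → α * (p - p) ≡ 0ℚ
  zero-diff = solve 2 (λ α p → α :* (p :- p) := con 0ℚ) refl

  ∑-indic-zero : ∀ β (f : Fin k → ℚ) → f w ≡ 0ℚ → ∑ (λ u → β * indic w u * f u) ≡ 0ℚ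
  ∑-indic-zero β f e = begin
    ∑ (λ u → β * indic w u * f u)
      ≡⟨ ∑-cong (λ u → solve 3 (λ β i f → β :* i :* f := β :* (f :* i)) refl β (indic w u) (f u)) ⟩
    ∑ (λ u → β * (f u * indic w u)) ≡⟨ ∑-* β _ ⟩
    β * ∑ (λ u → f u * indic w u) ≡⟨ cong (β *_) (trans (∑-indic f w) e) ⟩
    β * 0ℚ ≡⟨ ℚₚ.*-zeroʳ β ⟩
    0ℚ ∎

  indic-*-diff : ∀ β (f : Fin k → ℚ) u → β * indic w u * (f u - f w) ≡ 0ℚ
  indic-*-diff β f u with w ≟ u
  ... | yes refl = zero-diff (β * 1ℚ) (f w)
  ... | no _ = solve 2 (λ β x → β :* con 0ℚ :* x := con 0ℚ) refl β (f u - f w)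

  lapV-π : ∀ (x : Fin k → ℚ) a → lapV (x ∘ π) a ≡ [ (λ _ → 0ℚ) , lapM A x ]′ a
  lapV-π x (inj₁ i) = trans
    (cong₂ _+_ (∑-0 (λ j → zero-diff (B i j) (x w)))
               (∑-indic-zero (b i) (λ u → x w - x u) (ℚₚ.+-inverseʳ (x w))))
    (ℚₚ.+-identityˡ 0ℚ)
  lapV-π x (inj₂ u) = trans
    (cong (_+ lapM A x u) (∑-0 (λ i → indic-*-diff (b i) x u)))
    (ℚₚ.+-identityˡ _)

  lapV-κ : ∀ a v → lapV (κ a) v ≡ δ a v - δ (inj₂ (π a)) v
  lapV-κ (inj₁ i) (inj₁ l) = trans
    (cong (∑ (λ l' → B l l' * (c i l - c i l')) +_)
      (trans (∑-cong (λ u → solve 3 (λ β i f → β :* i :* (f :- con 0ℚ) := β :* f :* i) refl (b l) (indic w u) (c i l)))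
        (∑-indic (λ _ → b l * c i l) w)))
    (trans (green i l) (sym (ℚₚ.+-identityʳ _)))
  lapV-κ (inj₁ i) (inj₂ u) = begin
    ∑ (λ l → b l * indic w u * (0ℚ - c i l)) + ∑ (λ u' → A u u' * (0ℚ - 0ℚ))
      ≡⟨ cong₂ _+_
           (trans (∑-cong (λ l → solve 3 (λ β i f → β :* i :* (con 0ℚ :- f) := :- i :* (β :* f)) refl (b l) (indic w u) (c i l)))
             (∑-* (- indic w u) _))
           (∑-0 (λ u' → ℚₚ.*-zeroʳ (A u u'))) ⟩
    - indic w u * ∑ (λ l → b l * c i l) + 0ℚ ≡⟨ cong (λ z → - indic w u * z + 0ℚ) (ground i) ⟩
    - indic w u * 1ℚ + 0ℚ ≡⟨ solve 1 (λ x → :- x :* con 1ℚ :+ con 0ℚ := con 0ℚ :- x) refl (indic w u) ⟩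
    0ℚ - indic w u ∎
  lapV-κ (inj₂ u) v = trans
    (cong₂ _+_ (∑-0 (λ i → zero-diff (adj v (inj₁ i)) 0ℚ)) (∑-0 (λ u' → zero-diff (adj v (inj₂ u')) 0ℚ)))
    (sym (ℚₚ.+-inverseʳ (δ (inj₂ u) v)))

  ρ-κ : ∀ a a' → ρ a a' ≡ (κ a a - κ a' a) - (κ a a' - κ a' a')
  ρ-κ (inj₁ i) (inj₁ j) = trans
    (cong (λ z → c i i + c j j - (c i j + z)) (c-sym i j))
    (solve 4 (λ p q r s → p :+ q :- (r :+ s) := p :- s :- (r :- q)) refl (c i i) (c j j) (c i j) (c j i))
  ρ-κ (inj₁ i) (inj₂ u) = solve 1 (λ x → x := x :- con 0ℚ :- (con 0ℚ :- con 0ℚ)) refl (c i i)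
  ρ-κ (inj₂ u) (inj₁ j) = solve 1 (λ x → x := con 0ℚ :- con 0ℚ :- (con 0ℚ :- x)) refl (c j j)
  ρ-κ (inj₂ u) (inj₂ v) = refl

  -- Superposition at the cut vertex: the current runs from `a` to its projection `π`, through the
  -- old network between the two projections, and from there to `a'`. The point charges at the
  -- projections cancel.
  glue-res : ∀ {r} → ResM A r → ResM glueA (glueR r)
  glue-res {r} Rr a a' with Rr (π (splitAt m a)) (π (splitAt m a'))
  ... | x , lx , ex = y ∘ splitAt m , lap-y , val
    where
    s s' : V
    s = splitAt m a
    s' = splitAt m a'
    y : V → ℚ
    y v = x (π v) + (κ s v + - κ s' v)
    kirchhoff : ∀ v → lapV y v ≡ δ s v - δ s' v
    kirchhoff v = begin
      lapV y v ≡⟨ lapV-+ (x ∘ π) (λ v → κ s v + - κ s' v) v ⟩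
      lapV (x ∘ π) v + lapV (λ v → κ s v + - κ s' v) v
        ≡⟨ cong₂ _+_ (lapV-π x v) (trans (lapV-+ (κ s) (λ v → - κ s' v) v)
             (cong₂ _+_ (lapV-κ s v) (trans (lapV-neg (κ s') v) (cong -_ (lapV-κ s' v))))) ⟩
      [ (λ _ → 0ℚ) , lapM A x ]′ v + (δ s v - δ (inj₂ (π s)) v + - (δ s' v - δ (inj₂ (π s')) v))
        ≡⟨ cong (_+ (δ s v - δ (inj₂ (π s)) v + - (δ s' v - δ (inj₂ (π s')) v))) (ground-part v) ⟩
      δ (inj₂ (π s)) v - δ (inj₂ (π s')) v + (δ s v - δ (inj₂ (π s)) v + - (δ s' v - δ (inj₂ (π s')) v))
        ≡⟨ solve 4 (λ p q r t → p :- q :+ (r :- p :+ :- (t :- q)) := r :- t) refl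
             (δ (inj₂ (π s)) v) (δ (inj₂ (π s')) v) (δ s v) (δ s' v) ⟩
      δ s v - δ s' v ∎
      where
      ground-part : ∀ v → [ (λ _ → 0ℚ) , lapM A x ]′ v ≡ δ (inj₂ (π s)) v - δ (inj₂ (π s')) v
      ground-part (inj₁ _) = refl
      ground-part (inj₂ u) = lx u
    lap-y : ∀ z → lapM glueA (y ∘ splitAt m) z ≡ indic a z - indic a' z
    lap-y z = trans (lap-split y z) (trans (kirchhoff (splitAt m z))
      (sym (cong₂ _-_ (indic-split a z) (indic-split a' z))))
    val : glueR r a a' ≡ y s - y s'
    val = trans (cong₂ _+_ ex (ρ-κ s s'))
      (solve 6 (λ p q r t u v → p :- q :+ (r :- t :- (u :- v)) := p :+ (r :+ :- t) :- (q :+ (u :+ :- v))) refl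
        (x (π s)) (x (π s')) (κ s s) (κ s' s) (κ s s') (κ s' s'))

  glue-sym : Symm A → Symm glueA
  glue-sym symA a a' = adj-sym (splitAt m a) (splitAt m a')
    where
    adj-sym : ∀ p q → adj p q ≡ adj q p
    adj-sym (inj₁ i) (inj₁ j) = B-sym i j
    adj-sym (inj₁ i) (inj₂ u) = refl
    adj-sym (inj₂ u) (inj₁ i) = refl
    adj-sym (inj₂ u) (inj₂ v) = symA u v

  M K : ℚ
  M = fromℕℚ m
  K = fromℕℚ k

  degV : V → ℚ
  degV (inj₁ i) = d
  degV (inj₂ u) = degM A u + d * indic w u

  glue-deg : ∀ a → degM glueA a ≡ degV (splitAt m a)
  glue-deg a = trans (∑-split m (adj (splitAt m a))) (degV-sum (splitAt m a))
    where
    degV-sum : ∀ v → ∑ (adj v ∘ inj₁) + ∑ (adj v ∘ inj₂) ≡ degV v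
    degV-sum (inj₁ i) = trans (cong (∑ (B i) +_) (∑-indic (λ _ → b i) w)) (B-deg i)
    degV-sum (inj₂ u) = trans (cong (_+ degM A u) (trans (∑-scale b (indic w u)) (cong (_* indic w u) b-deg)))
      (ℚₚ.+-comm (d * indic w u) (degM A u))

  ∑-bump : ∀ (f : Fin k → ℚ) → ∑ (λ u → (degM A u + d * indic w u) * f u) ≡ ∑ (λ u → degM A u * f u) + d * f w
  ∑-bump f = begin
    ∑ (λ u → (degM A u + d * indic w u) * f u)
      ≡⟨ ∑-cong (λ u → solve 4 (λ a d i f → (a :+ d :* i) :* f := a :* f :+ d :* (f :* i)) refl (degM A u) d (indic w u) (f u)) ⟩
    ∑ (λ u → degM A u * f u + d * (f u * indic w u)) ≡⟨ ∑-+ _ _ ⟩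
    ∑ (λ u → degM A u * f u) + ∑ (λ u → d * (f u * indic w u))
      ≡⟨ cong (∑ (λ u → degM A u * f u) +_) (trans (∑-* d _) (cong (d *_) (∑-indic f w))) ⟩
    ∑ (λ u → degM A u * f u) + d * f w ∎

  glue-T : Tsum glueA ≡ Tsum A + d * (M + 1ℚ)
  glue-T = begin
    Tsum glueA ≡⟨ trans (∑-cong glue-deg) (∑-split m degV) ⟩
    ∑ {m} (λ _ → d) + ∑ (λ u → degM A u + d * indic w u)
      ≡⟨ cong₂ _+_ (∑-const {m} d) (trans (∑-+ _ _) (cong (Tsum A +_) (∑-indic (λ _ → d) w))) ⟩
    M * d + (Tsum A + d) ≡⟨ solve 3 (λ M d T → M :* d :+ (T :+ d) := T :+ d :* (M :+ con 1ℚ)) refl M d (Tsum A) ⟩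
    Tsum A + d * (M + 1ℚ) ∎

  module _ {r : Mat k} (r-sym : Symm r) (r-diag : ∀ u → r u u ≡ 0ℚ) where

    ∑-ρ-new : ∀ i → ∑ (λ j → r w w + ρ (inj₁ i) (inj₁ j)) ≡ σ - c i i
    ∑-ρ-new i = begin
      ∑ (λ j → r w w + ρ (inj₁ i) (inj₁ j))
        ≡⟨ ∑-cong (λ j → trans (cong (_+ ρ (inj₁ i) (inj₁ j)) (r-diag w)) (ℚₚ.+-identityˡ _)) ⟩
      ∑ (λ j → ρ (inj₁ i) (inj₁ j))
        ≡⟨ solve 2 (λ s x → s := s :+ x :- x) refl (∑ (λ j → ρ (inj₁ i) (inj₁ j))) (c i i) ⟩
      ∑ (λ j → ρ (inj₁ i) (inj₁ j)) + c i i - c i i ≡⟨ cong (_- c i i) (σ-new i) ⟩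
      σ - c i i ∎

    RV SV : V → ℚ
    RV (inj₁ i) = σ - c i i + (Rsum r w + K * c i i)
    RV (inj₂ u) = M * r u w + σ + Rsum r u
    SV (inj₁ i) = d * σ + Tsum A * c i i + Ssum A r w
    SV (inj₂ u) = Ssum A r u + d * σ + d * (M + 1ℚ) * r u w

    glue-R : ∀ a → Rsum (glueR r) a ≡ RV (splitAt m a)
    glue-R a = trans (∑-split m (res r (splitAt m a))) (lem (splitAt m a))
      where
      lem : ∀ v → ∑ (res r v ∘ inj₁) + ∑ (res r v ∘ inj₂) ≡ RV v
      lem (inj₁ i) = cong₂ _+_ (∑-ρ-new i)
        (trans (∑-+ (r w) (λ _ → c i i)) (cong (Rsum r w +_) (∑-const (c i i))))
      lem (inj₂ u) = cong₂ _+_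
        (trans (∑-shift (λ j → c j j) (r u w)) (cong (M * r u w +_) σ-ground))
        (∑-cong (λ v → ℚₚ.+-identityʳ (r u v)))

    glue-S : ∀ a → Ssum glueA (glueR r) a ≡ SV (splitAt m a)
    glue-S a = trans (∑-cong (λ v → cong (_* glueR r a v) (glue-deg v)))
      (trans (∑-split m (λ v → degV v * res r (splitAt m a) v)) (lem (splitAt m a)))
      where
      lem : ∀ v → ∑ (λ j → d * res r v (inj₁ j)) + ∑ (λ u → (degM A u + d * indic w u) * res r v (inj₂ u)) ≡ SV v
      lem (inj₁ i) = begin
        ∑ (λ j → d * (r w w + ρ (inj₁ i) (inj₁ j))) + ∑ (λ u → (degM A u + d * indic w u) * (r w u + c i i))
          ≡⟨ cong₂ _+_ (trans (∑-* d _) (cong (d *_) (∑-ρ-new i))) (∑-bump (λ u → r w u + c i i)) ⟩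
        d * (σ - c i i) + (∑ (λ u → degM A u * (r w u + c i i)) + d * (r w w + c i i))
          ≡⟨ cong₂ (λ p q → d * (σ - c i i) + (p + d * (q + c i i)))
               (trans (∑-cong (λ u → ℚₚ.*-distribˡ-+ (degM A u) (r w u) (c i i)))
                 (trans (∑-+ _ _) (cong (Ssum A r w +_) (∑-scale (degM A) (c i i)))))
               (r-diag w) ⟩
        d * (σ - c i i) + (Ssum A r w + Tsum A * c i i + d * (0ℚ + c i i))
          ≡⟨ solve 5 (λ d σ c S T → d :* (σ :- c) :+ (S :+ T :* c :+ d :* (con 0ℚ :+ c)) := d :* σ :+ T :* c :+ S) refl
               d σ (c i i) (Ssum A r w) (Tsum A) ⟩
        SV (inj₁ i) ∎
      lem (inj₂ u) = begin
        ∑ (λ j → d * (r u w + c j j)) + ∑ (λ v → (degM A v + d * indic w v) * (r u v + 0ℚ))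
          ≡⟨ cong₂ _+_ (trans (∑-* d _) (cong (d *_) (trans (∑-shift (λ j → c j j) (r u w)) (cong (M * r u w +_) σ-ground))))
               (trans (∑-cong (λ v → cong ((degM A v + d * indic w v) *_) (ℚₚ.+-identityʳ (r u v)))) (∑-bump (r u))) ⟩
        d * (M * r u w + σ) + (Ssum A r u + d * r u w)
          ≡⟨ solve 5 (λ d M x σ S → d :* (M :* x :+ σ) :+ (S :+ d :* x) := S :+ d :* σ :+ d :* (M :+ con 1ℚ) :* x) refl
               d M (r u w) σ (Ssum A r u) ⟩
        SV (inj₂ u) ∎

    -- All current between new and old vertices passes through `w`, so the old network enters only
    -- through `S` and `R` at `w`, its total degree and its order.
    glue-D : Dsum glueA (glueR r) ≡
      Dsum A r + M * Ssum A r w + d * (M + 1ℚ) * Rsum r w + σ * (Tsum A + d * (M + K))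
    glue-D = begin
      Dsum glueA (glueR r) ≡⟨ ∑-cong (λ a → cong₂ _*_ (glue-deg a) (glue-R a)) ⟩
      ∑ (λ a → degV (splitAt m a) * RV (splitAt m a)) ≡⟨ ∑-split m (λ v → degV v * RV v) ⟩
      ∑ (λ i → d * RV (inj₁ i)) + ∑ (λ u → (degM A u + d * indic w u) * RV (inj₂ u))
        ≡⟨ cong₂ _+_ new old ⟩
      d * (M * (σ + Rsum r w) + (K - 1ℚ) * σ) + (M * Ssum A r w + Tsum A * σ + Dsum A r + d * (M * 0ℚ + σ + Rsum r w))
        ≡⟨ solve 8 (λ d M σ R K S T D → d :* (M :* (σ :+ R) :+ (K :- con 1ℚ) :* σ) :+ (M :* S :+ T :* σ :+ D :+ d :* (M :* con 0ℚ :+ σ :+ R))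
             := D :+ M :* S :+ d :* (M :+ con 1ℚ) :* R :+ σ :* (T :+ d :* (M :+ K))) refl
             d M σ (Rsum r w) K (Ssum A r w) (Tsum A) (Dsum A r) ⟩
      Dsum A r + M * Ssum A r w + d * (M + 1ℚ) * Rsum r w + σ * (Tsum A + d * (M + K)) ∎
      where
      new : ∑ (λ i → d * RV (inj₁ i)) ≡ d * (M * (σ + Rsum r w) + (K - 1ℚ) * σ)
      new = trans (∑-* d _) (cong (d *_) (begin
        ∑ (λ i → σ - c i i + (Rsum r w + K * c i i))
          ≡⟨ ∑-cong (λ i → solve 4 (λ σ c R K → σ :- c :+ (R :+ K :* c) := σ :+ R :+ (K :- con 1ℚ) :* c) refl σ (c i i) (Rsum r w) K) ⟩
        ∑ (λ i → σ + Rsum r w + (K - 1ℚ) * c i i) ≡⟨ ∑-shift (λ i → (K - 1ℚ) * c i i) (σ + Rsum r w) ⟩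
        M * (σ + Rsum r w) + ∑ (λ i → (K - 1ℚ) * c i i)
          ≡⟨ cong (M * (σ + Rsum r w) +_) (trans (∑-* (K - 1ℚ) _) (cong ((K - 1ℚ) *_) σ-ground)) ⟩
        M * (σ + Rsum r w) + (K - 1ℚ) * σ ∎))
      old : ∑ (λ u → (degM A u + d * indic w u) * RV (inj₂ u)) ≡
        M * Ssum A r w + Tsum A * σ + Dsum A r + d * (M * 0ℚ + σ + Rsum r w)
      old = trans (∑-bump (RV ∘ inj₂)) (cong₂ _+_
        (begin
          ∑ (λ u → degM A u * (M * r u w + σ + Rsum r u))
            ≡⟨ ∑-cong (λ u → trans (cong (λ z → degM A u * (M * z + σ + Rsum r u)) (r-sym u w))
                 (solve 5 (λ a M x σ R → a :* (M :* x :+ σ :+ R) := M :* (a :* x) :+ a :* σ :+ a :* R) refl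
                   (degM A u) M (r w u) σ (Rsum r u))) ⟩
          ∑ (λ u → M * (degM A u * r w u) + degM A u * σ + degM A u * Rsum r u)
            ≡⟨ trans (∑-+ _ _) (cong (_+ Dsum A r) (trans (∑-+ _ _) (cong₂ _+_ (∑-* M _) (∑-scale (degM A) σ)))) ⟩
          M * Ssum A r w + Tsum A * σ + Dsum A r ∎)
        (cong (λ z → d * (M * z + σ + Rsum r w)) (r-diag w)))

-- Inequalities over ℚ, and the blocks of a leaf and of a cycle

≤-offset : ∀ {a b : ℚ} d → 0ℚ ≤ d → b ≡ a + d → a ≤ b
≤-offset {a} d 0≤d refl = ℚₚ.≤-trans (ℚₚ.≤-reflexive (sym (ℚₚ.+-identityʳ a))) (ℚₚ.+-monoʳ-≤ a 0≤d)

<-offset : ∀ {a b : ℚ} d → 0ℚ < d → b ≡ a + d → a < b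
<-offset {a} d 0<d refl = ℚₚ.≤-<-trans (ℚₚ.≤-reflexive (sym (ℚₚ.+-identityʳ a))) (ℚₚ.+-monoʳ-< a 0<d)

+-nonneg : ∀ {a b} → 0ℚ ≤ a → 0ℚ ≤ b → 0ℚ ≤ a + b
+-nonneg = ℚₚ.+-mono-≤

*-nonneg : ∀ {a b} → 0ℚ ≤ a → 0ℚ ≤ b → 0ℚ ≤ a * b
*-nonneg {a} {b} 0≤a 0≤b = ℚₚ.≤-trans (ℚₚ.≤-reflexive (sym (ℚₚ.*-zeroʳ a)))
  (ℚₚ.*-monoˡ-≤-nonNeg a {{ℚ.nonNegative 0≤a}} 0≤b)

square-nonneg : ∀ a → 0ℚ ≤ a * a
square-nonneg a with ℚₚ.≤-total 0ℚ a
... | inj₁ 0≤a = *-nonneg 0≤a 0≤a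
... | inj₂ a≤0 = ℚₚ.≤-trans (*-nonneg 0≤-a 0≤-a)
  (ℚₚ.≤-reflexive (solve 1 (λ a → :- a :* :- a := a :* a) refl a))
  where
  0≤-a : 0ℚ ≤ - a
  0≤-a = ℚₚ.neg-antimono-≤ a≤0

*-monoˡ-nonneg : ∀ c {a b} → 0ℚ ≤ c → a ≤ b → c * a ≤ c * b
*-monoˡ-nonneg c 0≤c = ℚₚ.*-monoˡ-≤-nonNeg c {{ℚ.nonNegative 0≤c}}

fromℕℚ-nonneg : ∀ a → 0ℚ ≤ fromℕℚ a
fromℕℚ-nonneg a = fromℕℚ-mono {0} {a} ℕ.z≤n

¼ 1/6 2ℚ 4ℚ : ℚ
¼ = ½ * ½
1/6 = ℤ.+ 1 ℚ./ 6
2ℚ = 1ℚ + 1ℚ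
4ℚ = 2ℚ + 2ℚ

∑-one : (f : Fin 1 → ℚ) → ∑ f ≡ f zero
∑-one f = trans (∑-suc f) (trans (cong (f zero +_) (∑-[] (f ∘ suc))) (ℚₚ.+-identityʳ (f zero)))

leafBlock : Block 1
leafBlock = record
  { B = λ _ _ → 0ℚ ; b = λ _ → 1ℚ ; c = λ _ _ → 1ℚ ; d = 1ℚ ; σ = 1ℚ
  ; B-sym = λ _ _ → refl
  ; green = λ { zero zero → cong (_+ 1ℚ) (∑-one (λ _ → 0ℚ)) }
  ; ground = λ _ → ∑-one (λ _ → 1ℚ)
  ; B-deg = λ _ → cong (_+ 1ℚ) (∑-one (λ _ → 0ℚ))
  ; b-deg = ∑-one (λ _ → 1ℚ)
  ; c-sym = λ _ _ → refl
  ; σ-ground = ∑-one (λ _ → 1ℚ)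
  ; σ-new = λ _ → cong (_+ 1ℚ) (∑-one (λ _ → 0ℚ))
  }

∑-snoc : ∀ n (f : ℕ → ℚ) → ∑ {suc n} (f ∘ toℕ) ≡ ∑ {n} (f ∘ toℕ) + f n
∑-snoc zero f = trans (∑-one _) (trans (sym (ℚₚ.+-identityˡ _)) (cong (_+ f 0) (sym (∑-[] _))))
∑-snoc (suc n) f = begin
  ∑ {suc (suc n)} (f ∘ toℕ) ≡⟨ ∑-suc _ ⟩
  f 0 + ∑ {suc n} (f ∘ suc ∘ toℕ) ≡⟨ cong (f 0 +_) (∑-snoc n (f ∘ suc)) ⟩
  f 0 + (∑ {n} (f ∘ suc ∘ toℕ) + f (suc n)) ≡⟨ sym (ℚₚ.+-assoc (f 0) _ _) ⟩
  f 0 + ∑ {n} (f ∘ suc ∘ toℕ) + f (suc n) ≡⟨ cong (_+ f (suc n)) (sym (∑-suc _)) ⟩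
  ∑ {suc n} (f ∘ toℕ) + f (suc n) ∎

-- The new vertices of a cycle block sit at positions 1 to m of the cycle; the ground takes both
-- position 0 and position m + 1.
pos : ℕ → ℚ
pos l = fromℕℚ (suc l)

∑-pos : ∀ n → ∑ {n} (pos ∘ toℕ) ≡ ½ * (fromℕℚ n * (fromℕℚ n + 1ℚ))
∑-pos zero = ∑-[] _
∑-pos (suc n) = begin
  ∑ {suc n} (pos ∘ toℕ) ≡⟨ ∑-snoc n pos ⟩
  ∑ {n} (pos ∘ toℕ) + pos n ≡⟨ cong₂ _+_ (∑-pos n) (fromℕℚ-suc n) ⟩
  ½ * (fromℕℚ n * (fromℕℚ n + 1ℚ)) + (1ℚ + fromℕℚ n)
    ≡⟨ solve 1 (λ n → con ½ :* (n :* (n :+ con 1ℚ)) :+ (con 1ℚ :+ n) := con ½ :* ((con 1ℚ :+ n) :* (con 1ℚ :+ n :+ con 1ℚ))) refl (fromℕℚ n) ⟩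
  ½ * ((1ℚ + fromℕℚ n) * (1ℚ + fromℕℚ n + 1ℚ)) ≡⟨ cong (λ z → ½ * (z * (z + 1ℚ))) (sym (fromℕℚ-suc n)) ⟩
  ½ * (fromℕℚ (suc n) * (fromℕℚ (suc n) + 1ℚ)) ∎

∑-pos² : ∀ n → ∑ {n} (λ i → pos (toℕ i) * pos (toℕ i)) ≡ 1/6 * (fromℕℚ n * (fromℕℚ n + 1ℚ) * (2ℚ * fromℕℚ n + 1ℚ))
∑-pos² zero = ∑-[] _
∑-pos² (suc n) = begin
  ∑ {suc n} (λ i → pos (toℕ i) * pos (toℕ i)) ≡⟨ ∑-snoc n (λ l → pos l * pos l) ⟩
  ∑ {n} (λ i → pos (toℕ i) * pos (toℕ i)) + pos n * pos n ≡⟨ cong₂ _+_ (∑-pos² n) (cong (λ z → z * z) (fromℕℚ-suc n)) ⟩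
  1/6 * (fromℕℚ n * (fromℕℚ n + 1ℚ) * (2ℚ * fromℕℚ n + 1ℚ)) + (1ℚ + fromℕℚ n) * (1ℚ + fromℕℚ n)
    ≡⟨ solve 1 (λ n → con 1/6 :* (n :* (n :+ con 1ℚ) :* (con 2ℚ :* n :+ con 1ℚ)) :+ (con 1ℚ :+ n) :* (con 1ℚ :+ n)
         := con 1/6 :* ((con 1ℚ :+ n) :* (con 1ℚ :+ n :+ con 1ℚ) :* (con 2ℚ :* (con 1ℚ :+ n) :+ con 1ℚ))) refl (fromℕℚ n) ⟩
  1/6 * ((1ℚ + fromℕℚ n) * (1ℚ + fromℕℚ n + 1ℚ) * (2ℚ * (1ℚ + fromℕℚ n) + 1ℚ))
    ≡⟨ cong (λ z → 1/6 * (z * (z + 1ℚ) * (2ℚ * z + 1ℚ))) (sym (fromℕℚ-suc n)) ⟩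
  1/6 * (fromℕℚ (suc n) * (fromℕℚ (suc n) + 1ℚ) * (2ℚ * fromℕℚ (suc n) + 1ℚ)) ∎

∑-min : ∀ a n → a ℕ.≤ n → ∑ {n} (λ j → fromℕℚ (a ℕ.⊓ suc (toℕ j))) ≡ fromℕℚ a * fromℕℚ n - ½ * (fromℕℚ a * (fromℕℚ a - 1ℚ))
∑-min zero n _ = trans (∑-0 (λ _ → refl)) (solve 1 (λ n → con 0ℚ := con 0ℚ :* n :- con ½ :* (con 0ℚ :* (con 0ℚ :- con 1ℚ))) refl (fromℕℚ n))
∑-min (suc a) (suc n) (ℕ.s≤s a≤n) = begin
  ∑ {suc n} (λ j → fromℕℚ (suc (a ℕ.⊓ toℕ j))) ≡⟨ ∑-suc _ ⟩
  fromℕℚ (suc (a ℕ.⊓ 0)) + ∑ {n} (λ j → fromℕℚ (suc (a ℕ.⊓ suc (toℕ j))))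
    ≡⟨ cong₂ _+_ (cong (fromℕℚ ∘ suc) (ℕₚ.⊓-zeroʳ a)) (∑-cong {n} (λ j → fromℕℚ-suc (a ℕ.⊓ suc (toℕ j)))) ⟩
  1ℚ + ∑ {n} (λ j → 1ℚ + fromℕℚ (a ℕ.⊓ suc (toℕ j))) ≡⟨ cong (1ℚ +_) (trans (∑-shift _ 1ℚ) (cong (fromℕℚ n * 1ℚ +_) (∑-min a n a≤n))) ⟩
  1ℚ + (fromℕℚ n * 1ℚ + (fromℕℚ a * fromℕℚ n - ½ * (fromℕℚ a * (fromℕℚ a - 1ℚ))))
    ≡⟨ solve 2 (λ n a → con 1ℚ :+ (n :* con 1ℚ :+ (a :* n :- con ½ :* (a :* (a :- con 1ℚ))))
         := (con 1ℚ :+ a) :* (con 1ℚ :+ n) :- con ½ :* ((con 1ℚ :+ a) :* (con 1ℚ :+ a :- con 1ℚ))) refl (fromℕℚ n) (fromℕℚ a) ⟩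
  (1ℚ + fromℕℚ a) * (1ℚ + fromℕℚ n) - ½ * ((1ℚ + fromℕℚ a) * (1ℚ + fromℕℚ a - 1ℚ))
    ≡⟨ sym (cong₂ (λ x y → x * y - ½ * (x * (x - 1ℚ))) (fromℕℚ-suc a) (fromℕℚ-suc n)) ⟩
  fromℕℚ (suc a) * fromℕℚ (suc n) - ½ * (fromℕℚ (suc a) * (fromℕℚ (suc a) - 1ℚ)) ∎

eq : ℕ → ℕ → ℚ
eq a b = if a ℕ.≡ᵇ b then 1ℚ else 0ℚ

eq-refl : ∀ a → eq a a ≡ 1ℚ
eq-refl zero = refl
eq-refl (suc a) = eq-refl a

eq-< : ∀ {a b} → a ℕ.< b → eq a b ≡ 0ℚ
eq-< {zero} (ℕ.s≤s _) = refl
eq-< {suc a} (ℕ.s≤s a<b) = eq-< a<b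

eq-> : ∀ {a b} → b ℕ.< a → eq a b ≡ 0ℚ
eq-> {suc a} {zero} _ = refl
eq-> {suc a} {suc b} (ℕ.s≤s b<a) = eq-> b<a

eq-sym : ∀ a b → eq a b ≡ eq b a
eq-sym zero zero = refl
eq-sym zero (suc b) = refl
eq-sym (suc a) zero = refl
eq-sym (suc a) (suc b) = eq-sym a b

eq-toℕ : ∀ {n} (i j : Fin n) → eq (toℕ i) (toℕ j) ≡ indic i j
eq-toℕ i j with i ≟ j
... | yes refl = eq-refl (toℕ i)
... | no i≢j with ℕₚ.<-cmp (toℕ i) (toℕ j)
... | tri< lt _ _ = eq-< lt
... | tri≈ _ e _ = ⊥-elim (i≢j (Finₚ.toℕ-injective e))
... | tri> _ _ gt = eq-> gt

∑-pick : ∀ {n t} → t ℕ.< n → (g : ℕ → ℚ) → ∑ {n} (λ i → eq (toℕ i) t * g (toℕ i)) ≡ g t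
∑-pick {n} {t} t<n g = begin
  ∑ (λ i → eq (toℕ i) t * g (toℕ i))
    ≡⟨ ∑-cong (λ i → trans (cong₂ _*_ (trans (eq-sym (toℕ i) t) (trans (cong (λ z → eq z (toℕ i)) (sym (Finₚ.toℕ-fromℕ< t<n))) (eq-toℕ t' i))) refl) (ℚₚ.*-comm (indic t' i) (g (toℕ i)))) ⟩
  ∑ (λ i → g (toℕ i) * indic t' i) ≡⟨ ∑-indic (g ∘ toℕ) t' ⟩
  g (toℕ t') ≡⟨ cong g (Finₚ.toℕ-fromℕ< t<n) ⟩
  g t ∎
  where
  t' : Fin n
  t' = Data.Fin.fromℕ< t<n

-- The term outside the sum, here and in `∑-pick-down`, stands for the ground: it is the neighbour
-- that an end of the row of new vertices lacks.
∑-pick-up : ∀ {n l} → l ℕ.< n → (g : ℕ → ℚ) → ∑ {n} (λ i → eq (toℕ i) (suc l) * g (toℕ i)) + eq (suc l) n * g n ≡ g (suc l)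
∑-pick-up {n} {l} l<n g with ℕₚ.m≤n⇒m<n∨m≡n l<n
... | inj₁ sl<n = trans (cong₂ _+_ (∑-pick sl<n g) (trans (cong (_* g n) (eq-< sl<n)) (ℚₚ.*-zeroˡ (g n)))) (ℚₚ.+-identityʳ _)
... | inj₂ refl = trans (cong₂ _+_
    (∑-0 (λ i → trans (cong (_* g (toℕ i)) (eq-< (Finₚ.toℕ<n i))) (ℚₚ.*-zeroˡ (g (toℕ i)))))
    (trans (cong (_* g (suc l)) (eq-refl l)) (ℚₚ.*-identityˡ (g (suc l)))))
  (ℚₚ.+-identityˡ _)

∑-pick-down : ∀ {n l} → l ℕ.< n → (g : ℕ → ℚ) → ∑ {n} (λ i → eq l (suc (toℕ i)) * g (suc (toℕ i))) + eq l 0 * g 0 ≡ g l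
∑-pick-down {l = zero} _ g = trans (cong₂ _+_ (∑-0 (λ i → ℚₚ.*-zeroˡ (g (suc (toℕ i))))) (ℚₚ.*-identityˡ (g 0))) (ℚₚ.+-identityˡ _)
∑-pick-down {n} {suc l} l<n g = trans (cong₂ _+_
    (trans (∑-cong {n} (λ i → cong (_* g (suc (toℕ i))) (eq-sym l (toℕ i)))) (∑-pick (ℕₚ.<-trans (ℕₚ.n<1+n l) l<n) (g ∘ suc)))
    (ℚₚ.*-zeroˡ (g 0))) (ℚₚ.+-identityʳ _)

-- As a function of x, min(i + 1, x) is linear except for one kink at x = i + 1, where the slope
-- drops from 1 to 0.
min-second-difference : ∀ i l → let μ = λ x → fromℕℚ (suc i ℕ.⊓ x) in
  (μ (suc l) - μ (suc (suc l))) + (μ (suc l) - μ l) ≡ eq i l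
min-second-difference zero zero = refl
min-second-difference zero (suc l) = refl
min-second-difference (suc i) zero = cong (λ z → 1ℚ - fromℕℚ (2 ℕ.+ z) + (1ℚ - 0ℚ)) (ℕₚ.⊓-zeroʳ i)
min-second-difference (suc i) (suc l) = trans
  (cong₂ (λ x y → x - fromℕℚ (suc (suc i ℕ.⊓ suc (suc l))) + (x - y)) (fromℕℚ-suc (suc i ℕ.⊓ suc l)) (fromℕℚ-suc (suc i ℕ.⊓ l)))
  (trans (cong (λ y → 1ℚ + fromℕℚ (suc i ℕ.⊓ suc l) - y + (1ℚ + fromℕℚ (suc i ℕ.⊓ suc l) - (1ℚ + fromℕℚ (suc i ℕ.⊓ l)))) (fromℕℚ-suc (suc i ℕ.⊓ suc (suc l))))
    (trans (solve 3 (λ a b c → con 1ℚ :+ a :- (con 1ℚ :+ b) :+ (con 1ℚ :+ a :- (con 1ℚ :+ c)) := a :- b :+ (a :- c)) refl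
      (fromℕℚ (suc i ℕ.⊓ suc l)) (fromℕℚ (suc i ℕ.⊓ suc (suc l))) (fromℕℚ (suc i ℕ.⊓ l)))
      (min-second-difference i l)))

recip : ℕ → ℚ
recip m = ℚ.1/ (mkℚ (ℤ.+ suc m) 0 (coprime-1 (suc m)))

recip-inverse : ∀ m → recip m * (fromℕℚ m + 1ℚ) ≡ 1ℚ
recip-inverse m = trans (cong (recip m *_) (trans (ℚₚ.+-comm (fromℕℚ m) 1ℚ) (trans (sym (fromℕℚ-suc m)) (fromℕℚ-mk (suc m)))))
  (ℚₚ.*-inverseˡ (mkℚ (ℤ.+ suc m) 0 (coprime-1 (suc m))))

recip-nonneg : ∀ m → 0ℚ ≤ recip m
recip-nonneg m = ℚₚ.nonNegative⁻¹ (recip m)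

module Cycle (m : ℕ) (2≤m : 2 ℕ.≤ m) where
  M ip : ℚ
  M = fromℕℚ m
  ip = recip m

  -- The Green function of the path 0, ..., m + 1 with both ends grounded. Identifying the two ends
  -- gives the cycle; the subtracted linear term makes `h` vanish at m + 1 and does not affect
  -- second differences.
  h : ℕ → ℕ → ℚ
  h i x = fromℕℚ (suc i ℕ.⊓ x) - pos i * fromℕℚ x * ip

  h-0 : ∀ i → h i 0 ≡ 0ℚ
  h-0 i = solve 2 (λ a b → con 0ℚ :- a :* con 0ℚ :* b := con 0ℚ) refl (pos i) ip

  h-end : ∀ {i} → i ℕ.< m → h i (suc m) ≡ 0ℚ
  h-end {i} i<m = begin
    fromℕℚ (suc (i ℕ.⊓ m)) - pos i * fromℕℚ (suc m) * ip
      ≡⟨ cong₂ (λ x y → fromℕℚ (suc x) - pos i * y * ip) (ℕₚ.m≤n⇒m⊓n≡m (ℕₚ.<⇒≤ i<m)) (trans (fromℕℚ-suc m) (ℚₚ.+-comm 1ℚ M)) ⟩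
    pos i - pos i * (M + 1ℚ) * ip ≡⟨ solve 3 (λ a b c → a :- a :* b :* c := a :- a :* (c :* b)) refl (pos i) (M + 1ℚ) ip ⟩
    pos i - pos i * (ip * (M + 1ℚ)) ≡⟨ cong (λ z → pos i - pos i * z) (recip-inverse m) ⟩
    pos i - pos i * 1ℚ ≡⟨ solve 1 (λ a → a :- a :* con 1ℚ := con 0ℚ) refl (pos i) ⟩
    0ℚ ∎

  h-second-difference : ∀ i l → (h i (suc l) - h i (suc (suc l))) + (h i (suc l) - h i l) ≡ eq i l
  h-second-difference i l = begin
    h i (suc l) - h i (suc (suc l)) + (h i (suc l) - h i l)
      ≡⟨ cong₂ (λ x y → μ₁ - pos i * x * ip - (μ₂ - pos i * y * ip) + (μ₁ - pos i * x * ip - h i l)) (fromℕℚ-suc l)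
           (trans (fromℕℚ-suc (suc l)) (cong (1ℚ +_) (fromℕℚ-suc l))) ⟩
    μ₁ - pos i * (1ℚ + L) * ip - (μ₂ - pos i * (1ℚ + (1ℚ + L)) * ip) + (μ₁ - pos i * (1ℚ + L) * ip - (μ₀ - pos i * L * ip))
      ≡⟨ solve 6 (λ a b c p l q → a :- p :* (con 1ℚ :+ l) :* q :- (b :- p :* (con 1ℚ :+ (con 1ℚ :+ l)) :* q) :+ (a :- p :* (con 1ℚ :+ l) :* q :- (c :- p :* l :* q))
           := a :- b :+ (a :- c)) refl μ₁ μ₂ μ₀ (pos i) L ip ⟩
    μ₁ - μ₂ + (μ₁ - μ₀) ≡⟨ min-second-difference i l ⟩
    eq i l ∎
    where
    L μ₀ μ₁ μ₂ : ℚ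
    L = fromℕℚ l
    μ₀ = fromℕℚ (suc i ℕ.⊓ l)
    μ₁ = fromℕℚ (suc i ℕ.⊓ suc l)
    μ₂ = fromℕℚ (suc i ℕ.⊓ suc (suc l))

  B c : Mat m
  B i j = eq (toℕ j) (suc (toℕ i)) + eq (toℕ i) (suc (toℕ j))
  c i j = h (toℕ i) (suc (toℕ j))

  b : Fin m → ℚ
  b i = eq (toℕ i) 0 + eq (suc (toℕ i)) m

  pick : ∀ {l} → l ℕ.< m → (g : ℕ → ℚ) →
    ∑ {m} (λ j → (eq (toℕ j) (suc l) + eq l (suc (toℕ j))) * g (suc (toℕ j))) + (eq l 0 * g 0 + eq (suc l) m * g (suc m))
      ≡ g (suc (suc l)) + g l
  pick {l} l<m g = begin
    ∑ {m} (λ j → (eq (toℕ j) (suc l) + eq l (suc (toℕ j))) * g (suc (toℕ j))) + (x + y)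
      ≡⟨ cong (_+ (x + y)) (trans (∑-cong {m} (λ j → ℚₚ.*-distribʳ-+ (g (suc (toℕ j))) (eq (toℕ j) (suc l)) (eq l (suc (toℕ j))))) (∑-+ _ _)) ⟩
    s + t + (x + y) ≡⟨ solve 4 (λ s t x y → s :+ t :+ (x :+ y) := s :+ y :+ (t :+ x)) refl s t x y ⟩
    s + y + (t + x) ≡⟨ cong₂ _+_ (∑-pick-up l<m (g ∘ suc)) (∑-pick-down l<m g) ⟩
    g (suc (suc l)) + g l ∎
    where
    s t x y : ℚ
    s = ∑ {m} (λ j → eq (toℕ j) (suc l) * g (suc (toℕ j)))
    t = ∑ {m} (λ j → eq l (suc (toℕ j)) * g (suc (toℕ j)))
    x = eq l 0 * g 0
    y = eq (suc l) m * g (suc m)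

  c-green : ∀ i l → ∑ (λ l' → B l l' * (c i l - c i l')) + b l * c i l ≡ indic i l
  c-green i l = begin
    ∑ (λ l' → B l l' * (c i l - c i l')) + b l * c i l
      -- The ground has potential 0, which is the value of `h` at both end positions, so `b`
      -- supplies the differences to the ground in the same form as the others.
      ≡⟨ cong (∑ (λ l' → B l l' * g (suc (toℕ l'))) +_) (trans (ℚₚ.*-distribʳ-+ (c i l) (eq y 0) (eq (suc y) m))
           (cong₂ (λ p q → eq y 0 * p + eq (suc y) m * q)
             (trans (solve 1 (λ a → a := a :- con 0ℚ) refl (c i l)) (cong (_-_ (c i l)) (sym (h-0 x))))
             (trans (solve 1 (λ a → a := a :- con 0ℚ) refl (c i l)) (cong (_-_ (c i l)) (sym (h-end (Finₚ.toℕ<n i))))))) ⟩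
    ∑ (λ l' → B l l' * g (suc (toℕ l'))) + (eq y 0 * g 0 + eq (suc y) m * g (suc m)) ≡⟨ pick (Finₚ.toℕ<n l) g ⟩
    g (suc (suc y)) + g y ≡⟨ h-second-difference x y ⟩
    eq x y ≡⟨ eq-toℕ i l ⟩
    indic i l ∎
    where
    x y : ℕ
    x = toℕ i
    y = toℕ l
    g : ℕ → ℚ
    g z = h x (suc y) - h x z

  0<m : 0 ℕ.< m
  0<m = ℕₚ.≤-trans (ℕ.s≤s ℕ.z≤n) 2≤m

  ∑-b : (g : ℕ → ℚ) → ∑ {m} (λ l → b l * g (suc (toℕ l))) ≡ g 1 + g m
  ∑-b g = trans (∑-cong {m} (λ l → ℚₚ.*-distribʳ-+ (g (suc (toℕ l))) (eq (toℕ l) 0) (eq (suc (toℕ l)) m)))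
    (trans (∑-+ _ _) (cong₂ _+_ (∑-pick 0<m (g ∘ suc)) (last m 0<m)))
    where
    last : ∀ n → 0 ℕ.< n → ∑ {n} (λ l → eq (suc (toℕ l)) n * g (suc (toℕ l))) ≡ g n
    last (suc n) _ = ∑-pick (ℕₚ.n<1+n n) (g ∘ suc)

  c-ground : ∀ i → ∑ (λ l → b l * c i l) ≡ 1ℚ
  c-ground i = begin
    ∑ (λ l → b l * c i l) ≡⟨ ∑-b (h (toℕ i)) ⟩
    h (toℕ i) 1 + (fromℕℚ (suc (toℕ i) ℕ.⊓ m) - x * M * ip)
      ≡⟨ cong₂ (λ p q → fromℕℚ (suc p) - x * 1ℚ * ip + (fromℕℚ q - x * M * ip)) (ℕₚ.⊓-zeroʳ (toℕ i)) (ℕₚ.m≤n⇒m⊓n≡m (Finₚ.toℕ<n i)) ⟩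
    1ℚ - x * 1ℚ * ip + (x - x * M * ip) ≡⟨ solve 3 (λ x M p → con 1ℚ :- x :* con 1ℚ :* p :+ (x :- x :* M :* p) := con 1ℚ :+ x :- x :* (p :* (M :+ con 1ℚ))) refl x M ip ⟩
    1ℚ + x - x * (ip * (M + 1ℚ)) ≡⟨ cong (λ z → 1ℚ + x - x * z) (recip-inverse m) ⟩
    1ℚ + x - x * 1ℚ ≡⟨ solve 1 (λ x → con 1ℚ :+ x :- x :* con 1ℚ := con 1ℚ) refl x ⟩
    1ℚ ∎
    where
    x : ℚ
    x = pos (toℕ i)

  -- This is (N² - 1)/6 with N = m + 1, the sum of k(N - k)/N over all k from 1 to m.
  σ : ℚ
  σ = 1/6 * (M * (M + 2ℚ))

  c-diag : ∀ i → c i i ≡ pos (toℕ i) - pos (toℕ i) * pos (toℕ i) * ip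
  c-diag i = cong (λ z → fromℕℚ z - pos (toℕ i) * pos (toℕ i) * ip) (ℕₚ.⊓-idem (suc (toℕ i)))

  c-σ-ground : ∑ (λ i → c i i) ≡ σ
  c-σ-ground = begin
    ∑ (λ i → c i i) ≡⟨ trans (∑-cong c-diag) (trans (∑-- _ _) (cong₂ _-_ (∑-pos m) (trans (∑-scale _ ip) (cong (_* ip) (∑-pos² m))))) ⟩
    ½ * (M * (M + 1ℚ)) - 1/6 * (M * (M + 1ℚ) * (2ℚ * M + 1ℚ)) * ip
      ≡⟨ solve 2 (λ M p → con ½ :* (M :* (M :+ con 1ℚ)) :- con 1/6 :* (M :* (M :+ con 1ℚ) :* (con 2ℚ :* M :+ con 1ℚ)) :* p
           := con ½ :* (M :* (M :+ con 1ℚ)) :- con 1/6 :* (M :* (con 2ℚ :* M :+ con 1ℚ)) :* (p :* (M :+ con 1ℚ))) refl M ip ⟩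
    ½ * (M * (M + 1ℚ)) - 1/6 * (M * (2ℚ * M + 1ℚ)) * (ip * (M + 1ℚ))
      ≡⟨ cong (λ z → ½ * (M * (M + 1ℚ)) - 1/6 * (M * (2ℚ * M + 1ℚ)) * z) (recip-inverse m) ⟩
    ½ * (M * (M + 1ℚ)) - 1/6 * (M * (2ℚ * M + 1ℚ)) * 1ℚ
      ≡⟨ solve 1 (λ M → con ½ :* (M :* (M :+ con 1ℚ)) :- con 1/6 :* (M :* (con 2ℚ :* M :+ con 1ℚ)) :* con 1ℚ := con 1/6 :* (M :* (M :+ con 2ℚ))) refl M ⟩
    σ ∎

  -- The symmetry of the cycle enters here: by this proportionality the terms that depend on `i`
  -- cancel in `c-σ-new`, so all vertices get the same `σ`.
  ∑-c : ∀ i → 2ℚ * ∑ (c i) ≡ (M + 1ℚ) * c i i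
  ∑-c i = begin
    2ℚ * ∑ (c i) ≡⟨ cong (2ℚ *_) (trans (∑-- _ _) (cong₂ _-_ (∑-min (suc (toℕ i)) m (Finₚ.toℕ<n i))
        (trans (∑-scale _ ip) (cong (_* ip) (trans (∑-* x _) (cong (x *_) (∑-pos m))))))) ⟩
    2ℚ * (x * M - ½ * (x * (x - 1ℚ)) - x * (½ * (M * (M + 1ℚ))) * ip)
      ≡⟨ solve 3 (λ x M p → con 2ℚ :* (x :* M :- con ½ :* (x :* (x :- con 1ℚ)) :- x :* (con ½ :* (M :* (M :+ con 1ℚ))) :* p)
           := con 2ℚ :* (x :* M) :- x :* (x :- con 1ℚ) :- x :* M :* (p :* (M :+ con 1ℚ))) refl x M ip ⟩
    2ℚ * (x * M) - x * (x - 1ℚ) - x * M * (ip * (M + 1ℚ)) ≡⟨ cong (λ z → 2ℚ * (x * M) - x * (x - 1ℚ) - x * M * z) (recip-inverse m) ⟩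
    2ℚ * (x * M) - x * (x - 1ℚ) - x * M * 1ℚ
      ≡⟨ solve 2 (λ x M → con 2ℚ :* (x :* M) :- x :* (x :- con 1ℚ) :- x :* M :* con 1ℚ := (M :+ con 1ℚ) :* x :- x :* x :* con 1ℚ) refl x M ⟩
    (M + 1ℚ) * x - x * x * 1ℚ ≡⟨ cong (λ z → (M + 1ℚ) * x - x * x * z) (sym (recip-inverse m)) ⟩
    (M + 1ℚ) * x - x * x * (ip * (M + 1ℚ))
      ≡⟨ solve 3 (λ x M p → (M :+ con 1ℚ) :* x :- x :* x :* (p :* (M :+ con 1ℚ)) := (M :+ con 1ℚ) :* (x :- x :* x :* p)) refl x M ip ⟩
    (M + 1ℚ) * (x - x * x * ip) ≡⟨ cong ((M + 1ℚ) *_) (sym (c-diag i)) ⟩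
    (M + 1ℚ) * c i i ∎
    where
    x : ℚ
    x = pos (toℕ i)

  c-σ-new : ∀ i → ∑ (λ j → c i i + c j j - (c i j + c i j)) + c i i ≡ σ
  c-σ-new i = begin
    ∑ (λ j → c i i + c j j - (c i j + c i j)) + c i i
      ≡⟨ cong (_+ c i i) (trans (∑-- _ _) (cong₂ _-_ (trans (∑-shift (λ j → c j j) (c i i)) (cong (M * c i i +_) c-σ-ground)) (∑-+ (c i) (c i)))) ⟩
    M * c i i + σ - (∑ (c i) + ∑ (c i)) + c i i
      ≡⟨ solve 4 (λ M x σ s → M :* x :+ σ :- (s :+ s) :+ x := (M :+ con 1ℚ) :* x :+ σ :- con 2ℚ :* s) refl M (c i i) σ (∑ (c i)) ⟩
    (M + 1ℚ) * c i i + σ - 2ℚ * ∑ (c i) ≡⟨ cong (λ z → (M + 1ℚ) * c i i + σ - z) (∑-c i) ⟩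
    (M + 1ℚ) * c i i + σ - (M + 1ℚ) * c i i ≡⟨ solve 2 (λ x σ → x :+ σ :- x := σ) refl ((M + 1ℚ) * c i i) σ ⟩
    σ ∎

  c-sym : Symm c
  c-sym i j = cong₂ (λ p q → fromℕℚ p - q) (ℕₚ.⊓-comm (suc (toℕ i)) (suc (toℕ j)))
    (solve 3 (λ x y p → x :* y :* p := y :* x :* p) refl (pos (toℕ i)) (pos (toℕ j)) ip)

  cycleBlock : Block m
  cycleBlock = record
    { B = B ; b = b ; c = c ; d = 2ℚ ; σ = σ
    ; B-sym = λ i j → ℚₚ.+-comm (eq (toℕ j) (suc (toℕ i))) (eq (toℕ i) (suc (toℕ j)))
    ; green = c-green
    ; ground = c-ground
    ; B-deg = λ i → trans (cong₂ _+_ (∑-cong (λ j → sym (ℚₚ.*-identityʳ (B i j))))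
                  (cong₂ _+_ (sym (ℚₚ.*-identityʳ (eq (toℕ i) 0))) (sym (ℚₚ.*-identityʳ (eq (suc (toℕ i)) m)))))
                (pick (Finₚ.toℕ<n i) (λ _ → 1ℚ))
    ; b-deg = trans (∑-cong (λ l → sym (ℚₚ.*-identityʳ (b l)))) (∑-b (λ _ → 1ℚ))
    ; c-sym = c-sym
    ; σ-ground = c-σ-ground
    ; σ-new = c-σ-new
    }

  -- With N = M + 1, the quantity t(N - t)/N falls short of N/4 by the square (N/2 - t)²/N.
  parabola-bound : ∀ t → t - t * t * ip ≤ ¼ * (M + 1ℚ)
  parabola-bound t = ≤-offset (ip * (e * e)) (*-nonneg (recip-nonneg m) (square-nonneg e)) (begin
    ¼ * (M + 1ℚ) ≡⟨ solve 2 (λ t P → con ¼ :* P := t :- t :* con 1ℚ :+ con ¼ :* P :* con 1ℚ) refl t (M + 1ℚ) ⟩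
    t - t * 1ℚ + ¼ * (M + 1ℚ) * 1ℚ ≡⟨ cong (λ z → t - t * z + ¼ * (M + 1ℚ) * z) (sym (recip-inverse m)) ⟩
    t - t * (ip * (M + 1ℚ)) + ¼ * (M + 1ℚ) * (ip * (M + 1ℚ))
      ≡⟨ solve 3 (λ t P p → t :- t :* (p :* P) :+ con ¼ :* P :* (p :* P) := t :- t :* t :* p :+ p :* ((con ½ :* P :- t) :* (con ½ :* P :- t))) refl t (M + 1ℚ) ip ⟩
    t - t * t * ip + ip * (e * e) ∎)
    where
    e : ℚ
    e = ½ * (M + 1ℚ) - t

  c-bound : ∀ i → c i i ≤ ¼ * (M + 1ℚ)
  c-bound i = ℚₚ.≤-trans (ℚₚ.≤-reflexive (c-diag i)) (parabola-bound (pos (toℕ i)))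

  -- The parallel connection of two arcs, of t and of M + 1 - t unit resistors.
  ρ-value : ∀ i j → suc (toℕ i) ℕ.≤ suc (toℕ j) → let t = pos (toℕ j) - pos (toℕ i) in
    c i i + c j j - (c i j + c i j) ≡ t - t * t * ip
  ρ-value i j i≤j = begin
    c i i + c j j - (c i j + c i j) ≡⟨ cong₂ (λ p q → p + q - (c i j + c i j)) (c-diag i) (c-diag j) ⟩
    x - x * x * ip + (y - y * y * ip) - (c i j + c i j) ≡⟨ cong (λ q → x - x * x * ip + (y - y * y * ip) - (q + q)) c-off ⟩
    x - x * x * ip + (y - y * y * ip) - (x - x * y * ip + (x - x * y * ip))
      ≡⟨ solve 3 (λ x y p → x :- x :* x :* p :+ (y :- y :* y :* p) :- (x :- x :* y :* p :+ (x :- x :* y :* p))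
           := y :- x :- (y :- x) :* (y :- x) :* p) refl x y ip ⟩
    y - x - (y - x) * (y - x) * ip ∎
    where
    x y : ℚ
    x = pos (toℕ i)
    y = pos (toℕ j)
    c-off : c i j ≡ x - x * y * ip
    c-off = cong (λ z → fromℕℚ z - x * y * ip) (ℕₚ.m≤n⇒m⊓n≡m i≤j)

  ρ-bound-≤ : ∀ i j → suc (toℕ i) ℕ.≤ suc (toℕ j) → c i i + c j j - (c i j + c i j) ≤ ¼ * (M + 1ℚ)
  ρ-bound-≤ i j i≤j = subst (_≤ ¼ * (M + 1ℚ)) (sym (ρ-value i j i≤j)) (parabola-bound (pos (toℕ j) - pos (toℕ i)))

  ρ-bound : ∀ i j → c i i + c j j - (c i j + c i j) ≤ ¼ * (M + 1ℚ)
  ρ-bound i j = [ ρ-bound-≤ i j , (λ j≤i → subst (_≤ ¼ * (M + 1ℚ)) swap (ρ-bound-≤ j i j≤i)) ]′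
    (ℕₚ.≤-total (suc (toℕ i)) (suc (toℕ j)))
    where
    swap : c j j + c i i - (c j i + c j i) ≡ c i i + c j j - (c i j + c i j)
    swap = cong₂ (λ p q → p - (q + q)) (ℚₚ.+-comm (c j j) (c i i)) (c-sym j i)

-- Lollipops and bicyclic networks

record Net (k : ℕ) : Set where
  no-eta-equality
  field
    A r : Mat k
    A-sym : Symm A
    is-res : ResM A r
  r-sym : Symm r
  r-sym = res-sym A-sym is-res
  r-diag : ∀ u → r u u ≡ 0ℚ
  r-diag = res-diag {A = A} is-res
  S R : Fin k → ℚ
  S = Ssum A r
  R = Rsum r
  T D : ℚ
  T = Tsum A
  D = Dsum A r

open Net using (r-sym; r-diag)

single : Net 1
single = record
  { A = λ _ _ → 0ℚ ; r = λ _ _ → 0ℚ ; A-sym = λ _ _ → refl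
  ; is-res = λ { zero zero → (λ _ → 0ℚ) , (λ { zero → ∑-one _ }) , refl } }

glueNet : ∀ {m k} → Block m → Net k → Fin k → Net (m ℕ.+ k)
glueNet blk N w = record
  { A = G.glueA ; r = G.glueR (Net.r N)
  ; A-sym = G.glue-sym (Net.A-sym N) ; is-res = G.glue-res (Net.is-res N) }
  where module G = Glue blk (Net.A N) w

on-split : ∀ m {k} {P : Fin m ⊎ Fin k → Set} →
  (∀ i → P (inj₁ i)) → (∀ u → P (inj₂ u)) → (a : Fin (m ℕ.+ k)) → P (splitAt m a)
on-split m l r a with splitAt m a
... | inj₁ i = l i
... | inj₂ u = r u

on-split₂ : ∀ m {k} {P : Fin m ⊎ Fin k → Fin m ⊎ Fin k → Set} →
  (∀ i j → P (inj₁ i) (inj₁ j)) → (∀ i v → P (inj₁ i) (inj₂ v)) →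
  (∀ u j → P (inj₂ u) (inj₁ j)) → (∀ u v → P (inj₂ u) (inj₂ v)) →
  (a a' : Fin (m ℕ.+ k)) → P (splitAt m a) (splitAt m a')
on-split₂ m ll lr rl rr a a' with splitAt m a | splitAt m a'
... | inj₁ i | inj₁ j = ll i j
... | inj₁ i | inj₂ v = lr i v
... | inj₂ u | inj₁ j = rl u j
... | inj₂ u | inj₂ v = rr u v

module GlueQuantities {m k} (blk : Block m) (N : Net k) (w : Fin k) where
  open Block blk using (c; d; σ)
  open Net N using (S; R; T; D; r)
  module G = Glue blk (Net.A N) w
  N' : Net (m ℕ.+ k)
  N' = glueNet blk N w
  M K : ℚ
  M = fromℕℚ m
  K = fromℕℚ k

  T-glue : Net.T N' ≡ T + d * (M + 1ℚ)
  T-glue = G.glue-T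
  D-glue : Net.D N' ≡ D + M * S w + d * (M + 1ℚ) * R w + σ * (T + d * (M + K))
  D-glue = G.glue-D (r-sym N) (r-diag N)
  RV SV : Fin m ⊎ Fin k → ℚ
  RV = G.RV (r-sym N) (r-diag N)
  SV = G.SV (r-sym N) (r-diag N)
  R-glue : ∀ a → Net.R N' a ≡ RV (splitAt m a)
  R-glue = G.glue-R (r-sym N) (r-diag N)
  S-glue : ∀ a → Net.S N' a ≡ SV (splitAt m a)
  S-glue = G.glue-S (r-sym N) (r-diag N)

Φ : ∀ {k} → Net k → Fin k → ℚ
Φ N v = Net.S N v + 2ℚ * Net.R N v

-- The cycle lengths are μ + 3 and ν + 3; `p'` and `q'` count the vertices that gluing such a cycle
-- adds, and `P`, `Q` are the lengths as rationals. In terms of `x` and `y`, which are nonnegative,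
-- the slack of every later estimate has nonnegative coefficients.
module Family (μ ν : ℕ) where
  p' q' : ℕ
  p' = suc (suc μ)
  q' = suc (suc ν)

  x y M N P Q : ℚ
  x = fromℕℚ μ
  y = fromℕℚ ν
  M = 2ℚ + x
  N = 2ℚ + y
  P = M + 1ℚ
  Q = N + 1ℚ

  0≤x : 0ℚ ≤ x
  0≤x = fromℕℚ-nonneg μ
  0≤y : 0ℚ ≤ y
  0≤y = fromℕℚ-nonneg ν

  M≡ : fromℕℚ p' ≡ M
  M≡ = fromℕℚ-+ 2 μ
  N≡ : fromℕℚ q' ≡ N
  N≡ = fromℕℚ-+ 2 ν

  2≤p' : 2 ℕ.≤ p'
  2≤p' = ℕ.s≤s (ℕ.s≤s ℕ.z≤n)
  2≤q' : 2 ℕ.≤ q'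
  2≤q' = ℕ.s≤s (ℕ.s≤s ℕ.z≤n)

  module Cp = Cycle p' 2≤p'
  module Cq = Cycle q' 2≤q'

  σp σq : ℚ
  σp = 1/6 * (M * (M + 2ℚ))
  σq = 1/6 * (N * (N + 2ℚ))

  -- `S` and `R` at the free end of C_q with a pendant path of s edges. In `RL` the Q cycle vertices
  -- give σq + Q s and the path gives 1 + ... + (s - 1). In `SL` the degrees double this, and the
  -- extra degree at the vertex where the path leaves the cycle adds s.
  SL RL : ℚ → ℚ
  SL s = 2ℚ * σq + 2ℚ * Q * s + s * s
  RL s = σq + Q * s + ½ * (s * (s - 1ℚ))

  -- Left as a recursion, following `D-leaf`: only differences of consecutive values matter, and in
  -- `DP-suc` the value `DL n` cancels as a variable.
  DL : ℕ → ℚ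
  DL zero = 2ℚ * Q * σq
  DL (suc n) = DL n + SL (fromℕℚ n) + 2ℚ * RL (fromℕℚ n) + 2ℚ * (Q + fromℕℚ n) + 1ℚ + (Q + fromℕℚ n)

  record Lollipop (n : ℕ) {k : ℕ} (net : Net k) (w : Fin k) : Set where
    s : ℚ
    s = fromℕℚ n
    field
      K-eq : fromℕℚ k ≡ Q + s
      T-eq : Net.T net ≡ 2ℚ * (Q + s)
      S-eq : Net.S net w ≡ SL s
      R-eq : Net.R net w ≡ RL s
      D-eq : Net.D net ≡ DL n
      -- The whole pendant path in series with the largest resistance in C_q.
      r-bound : ∀ u v → Net.r net u v ≤ s + ¼ * Q
      -- The summand 2 r(v, w) absorbs part of the (4p - 2) r(v, w) that gluing C_p at w adds to Φ v.
      Φ-bound : ∀ v → Φ net v + 2ℚ * Net.r net v w ≤ SL s + 2ℚ * RL s + ½ * Q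

  module _ where
    open GlueQuantities Cq.cycleBlock single zero using (T-glue; D-glue; RV; SV; R-glue; S-glue)

    cycleNet : Net (q' ℕ.+ 1)
    cycleNet = glueNet Cq.cycleBlock single zero

    private
      z-S : Net.S single zero ≡ 0ℚ
      z-S = trans (∑-one _) (ℚₚ.*-zeroʳ (degM (Net.A single) zero))
      z-R : Net.R single zero ≡ 0ℚ
      z-R = ∑-one _
      z-T : Net.T single ≡ 0ℚ
      z-T = trans (∑-one _) (∑-one _)
      z-D : Net.D single ≡ 0ℚ
      z-D = trans (∑-one _) (trans (cong (degM (Net.A single) zero *_) z-R) (ℚₚ.*-zeroʳ (degM (Net.A single) zero)))

    σq-eq : Cq.σ ≡ σq
    σq-eq = cong (λ z → 1/6 * (z * (z + 2ℚ))) N≡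

    cycle-R : ∀ v → RV v ≡ σq
    cycle-R (inj₁ i) = trans (cong₂ (λ z t → z - Cq.c i i + (t + 1ℚ * Cq.c i i)) σq-eq z-R)
      (solve 2 (λ σ c → σ :- c :+ (con 0ℚ :+ con 1ℚ :* c) := σ) refl σq (Cq.c i i))
    cycle-R (inj₂ zero) = trans (cong₂ (λ z t → fromℕℚ q' * 0ℚ + z + t) σq-eq z-R)
      (solve 2 (λ M σ → M :* con 0ℚ :+ σ :+ con 0ℚ := σ) refl (fromℕℚ q') σq)

    cycle-S : ∀ v → SV v ≡ 2ℚ * σq
    cycle-S (inj₁ i) = trans (cong (λ t → 2ℚ * Cq.σ + t * Cq.c i i + Net.S single zero) z-T)
      (trans (cong₂ (λ z t → 2ℚ * z + 0ℚ * Cq.c i i + t) σq-eq z-S)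
        (solve 2 (λ σ c → con 2ℚ :* σ :+ con 0ℚ :* c :+ con 0ℚ := con 2ℚ :* σ) refl σq (Cq.c i i)))
    cycle-S (inj₂ zero) = trans (cong₂ (λ z t → t + 2ℚ * z + 2ℚ * (fromℕℚ q' + 1ℚ) * 0ℚ) σq-eq z-S)
      (solve 2 (λ M σ → con 0ℚ :+ con 2ℚ :* σ :+ con 2ℚ :* (M :+ con 1ℚ) :* con 0ℚ := con 2ℚ :* σ) refl (fromℕℚ q') σq)

    cycle-r : ∀ u v → Net.r cycleNet u v ≤ ¼ * Q
    cycle-r = on-split₂ q' {P = λ a b → Glue.res Cq.cycleBlock (Net.A single) zero (Net.r single) a b ≤ ¼ * Q}
      (λ i j → drop (subst (λ z → ρ' i j ≤ ¼ * (z + 1ℚ)) N≡ (Cq.ρ-bound i j)))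
      (λ i v → drop (subst (λ z → Cq.c i i ≤ ¼ * (z + 1ℚ)) N≡ (Cq.c-bound i)))
      (λ u j → drop (subst (λ z → Cq.c j j ≤ ¼ * (z + 1ℚ)) N≡ (Cq.c-bound j)))
      (λ u v → *-nonneg (ℚₚ.nonNegative⁻¹ ¼) (+-nonneg (+-nonneg (ℚₚ.nonNegative⁻¹ 2ℚ) 0≤y) (ℚₚ.nonNegative⁻¹ 1ℚ)))
      where
      ρ' : ∀ i j → ℚ
      ρ' i j = Cq.c i i + Cq.c j j - (Cq.c i j + Cq.c i j)
      drop : ∀ {a b} → a ≤ b → 0ℚ + a ≤ b
      drop {a} = ℚₚ.≤-trans (ℚₚ.≤-reflexive (ℚₚ.+-identityˡ a))

    cycle-lollipop : Lollipop 0 cycleNet zero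
    cycle-lollipop = record
      { K-eq = trans (fromℕℚ-+ q' 1) (trans (cong (_+ 1ℚ) N≡) (sym (ℚₚ.+-identityʳ Q)))
      ; T-eq = trans T-glue (trans (cong₂ (λ a b → a + 2ℚ * (b + 1ℚ)) z-T N≡)
          (solve 1 (λ N → con 0ℚ :+ con 2ℚ :* (N :+ con 1ℚ) := con 2ℚ :* (N :+ con 1ℚ :+ con 0ℚ)) refl N))
      ; S-eq = trans (S-glue zero) (trans (cycle-S (splitAt q' {1} zero))
          (solve 2 (λ σ Q → con 2ℚ :* σ := con 2ℚ :* σ :+ con 2ℚ :* Q :* con 0ℚ :+ con 0ℚ :* con 0ℚ) refl σq Q))
      ; R-eq = trans (R-glue zero) (trans (cycle-R (splitAt q' {1} zero))
          (solve 2 (λ σ Q → σ := σ :+ Q :* con 0ℚ :+ con ½ :* (con 0ℚ :* (con 0ℚ :- con 1ℚ))) refl σq Q))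
      ; D-eq = trans D-glue (begin
          Net.D single + fromℕℚ q' * Net.S single zero + 2ℚ * (fromℕℚ q' + 1ℚ) * Net.R single zero + Cq.σ * (Net.T single + 2ℚ * (fromℕℚ q' + 1ℚ))
            ≡⟨ cong₂ (λ a b → a + fromℕℚ q' * b + 2ℚ * (fromℕℚ q' + 1ℚ) * Net.R single zero + Cq.σ * (Net.T single + 2ℚ * (fromℕℚ q' + 1ℚ))) z-D z-S ⟩
          0ℚ + fromℕℚ q' * 0ℚ + 2ℚ * (fromℕℚ q' + 1ℚ) * Net.R single zero + Cq.σ * (Net.T single + 2ℚ * (fromℕℚ q' + 1ℚ))
            ≡⟨ cong₂ (λ a b → 0ℚ + fromℕℚ q' * 0ℚ + 2ℚ * (fromℕℚ q' + 1ℚ) * a + Cq.σ * (b + 2ℚ * (fromℕℚ q' + 1ℚ))) z-R z-T ⟩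
          0ℚ + fromℕℚ q' * 0ℚ + 2ℚ * (fromℕℚ q' + 1ℚ) * 0ℚ + Cq.σ * (0ℚ + 2ℚ * (fromℕℚ q' + 1ℚ))
            ≡⟨ cong₂ (λ a b → 0ℚ + a * 0ℚ + 2ℚ * (a + 1ℚ) * 0ℚ + b * (0ℚ + 2ℚ * (a + 1ℚ))) N≡ σq-eq ⟩
          0ℚ + N * 0ℚ + 2ℚ * (N + 1ℚ) * 0ℚ + σq * (0ℚ + 2ℚ * (N + 1ℚ))
            ≡⟨ solve 2 (λ N σ → con 0ℚ :+ N :* con 0ℚ :+ con 2ℚ :* (N :+ con 1ℚ) :* con 0ℚ :+ σ :* (con 0ℚ :+ con 2ℚ :* (N :+ con 1ℚ))
                 := con 2ℚ :* (N :+ con 1ℚ) :* σ) refl N σq ⟩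
          2ℚ * Q * σq ∎)
      ; r-bound = λ u v → ℚₚ.≤-trans (cycle-r u v) (ℚₚ.≤-reflexive (sym (ℚₚ.+-identityˡ (¼ * Q))))
      ; Φ-bound = λ v → ℚₚ.≤-trans
          (ℚₚ.+-mono-≤ (ℚₚ.≤-reflexive (cong₂ (λ a b → a + 2ℚ * b) (trans (S-glue v) (cycle-S (splitAt q' v))) (trans (R-glue v) (cycle-R (splitAt q' v)))))
            (*-monoˡ-nonneg 2ℚ (ℚₚ.nonNegative⁻¹ 2ℚ) (cycle-r v zero)))
          (ℚₚ.≤-reflexive (solve 2 (λ σ Q → con 2ℚ :* σ :+ con 2ℚ :* σ :+ con 2ℚ :* (con ¼ :* Q)
             := con 2ℚ :* σ :+ con 2ℚ :* Q :* con 0ℚ :+ con 0ℚ :* con 0ℚ :+ con 2ℚ :* (σ :+ Q :* con 0ℚ :+ con ½ :* (con 0ℚ :* (con 0ℚ :- con 1ℚ))) :+ con ½ :* Q) refl σq Q))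
      }

  leafNet : ∀ {k} → Net k → Fin k → Net (suc k)
  leafNet = glueNet leafBlock

  module Leaf {k} (net : Net k) (w : Fin k) where
    open Net net using (S; R; T; D; r)
    open GlueQuantities leafBlock net w using (T-glue; D-glue; S-glue; R-glue)
    net' : Net (suc k)
    net' = leafNet net w
    K : ℚ
    K = fromℕℚ k

    T-leaf : Net.T net' ≡ T + 2ℚ
    T-leaf = T-glue
    D-leaf : Net.D net' ≡ D + Φ net w + T + 1ℚ + K
    D-leaf = trans D-glue (solve 5 (λ D S R T K → D :+ con 1ℚ :* S :+ con 1ℚ :* (con 1ℚ :+ con 1ℚ) :* R :+ con 1ℚ :* (T :+ con 1ℚ :* (con 1ℚ :+ K))
      := D :+ (S :+ con 2ℚ :* R) :+ T :+ con 1ℚ :+ K) refl D (S w) (R w) T K)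
    S-new : Net.S net' zero ≡ S w + T + 1ℚ
    S-new = trans (S-glue zero) (solve 2 (λ S T → con 1ℚ :* con 1ℚ :+ T :* con 1ℚ :+ S := S :+ T :+ con 1ℚ) refl (S w) T)
    R-new : Net.R net' zero ≡ R w + K
    R-new = trans (R-glue zero) (solve 2 (λ R K → con 1ℚ :- con 1ℚ :+ (R :+ K :* con 1ℚ) := R :+ K) refl (R w) K)
    Φ-new : Φ net' zero ≡ Φ net w + (T + 2ℚ * K + 1ℚ)
    Φ-new = trans (cong₂ (λ a b → a + 2ℚ * b) S-new R-new)
      (solve 4 (λ S R T K → S :+ T :+ con 1ℚ :+ con 2ℚ :* (R :+ K) := S :+ con 2ℚ :* R :+ (T :+ con 2ℚ :* K :+ con 1ℚ)) refl (S w) (R w) T K)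
    Φ-old : ∀ v → Φ net' (suc v) ≡ Φ net v + (4ℚ * r v w + (2ℚ + 1ℚ))
    Φ-old v = trans (cong₂ (λ a b → a + 2ℚ * b) (S-glue (suc v)) (R-glue (suc v)))
      (solve 3 (λ S R r → S :+ con 1ℚ :* con 1ℚ :+ con 1ℚ :* (con 1ℚ :+ con 1ℚ) :* r :+ con 2ℚ :* (con 1ℚ :* r :+ con 1ℚ :+ R)
        := S :+ con 2ℚ :* R :+ (con 4ℚ :* r :+ (con 2ℚ :+ con 1ℚ))) refl (S v) (R v) (r v w))

    r-bound-leaf : ∀ {b} → 0ℚ ≤ b → (∀ u v → r u v ≤ b) → ∀ u v → Net.r net' u v ≤ 1ℚ + b
    r-bound-leaf {b} 0≤b h = λ
      { zero zero → ℚₚ.≤-trans (ℚₚ.≤-reflexive (trans (ℚₚ.+-identityʳ (r w w)) (r-diag net w))) 0≤1+b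
      ; zero (suc v) → plus-one (h w v)
      ; (suc u) zero → plus-one (h u w)
      ; (suc u) (suc v) → ℚₚ.≤-trans (ℚₚ.≤-reflexive (ℚₚ.+-identityʳ (r u v))) (ℚₚ.≤-trans (h u v) (≤-offset 1ℚ (ℚₚ.nonNegative⁻¹ 1ℚ) (ℚₚ.+-comm 1ℚ b))) }
      where
      0≤1+b : 0ℚ ≤ 1ℚ + b
      0≤1+b = +-nonneg (ℚₚ.nonNegative⁻¹ 1ℚ) 0≤b
      plus-one : ∀ {a} → a ≤ b → a + 1ℚ ≤ 1ℚ + b
      plus-one {a} le = ℚₚ.≤-trans (ℚₚ.≤-reflexive (ℚₚ.+-comm a 1ℚ)) (ℚₚ.+-monoʳ-≤ 1ℚ le)

  0≤¼Q : 0ℚ ≤ ¼ * Q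
  0≤¼Q = *-nonneg (ℚₚ.nonNegative⁻¹ ¼) (+-nonneg (+-nonneg (ℚₚ.nonNegative⁻¹ 2ℚ) 0≤y) (ℚₚ.nonNegative⁻¹ 1ℚ))
  0≤¼P : 0ℚ ≤ ¼ * P
  0≤¼P = *-nonneg (ℚₚ.nonNegative⁻¹ ¼) (+-nonneg (+-nonneg (ℚₚ.nonNegative⁻¹ 2ℚ) 0≤x) (ℚₚ.nonNegative⁻¹ 1ℚ))

  leaf-lollipop : ∀ {n k} {net : Net k} {w} → Lollipop n net w → Lollipop (suc n) (leafNet net w) zero
  leaf-lollipop {n} {k} {net} {w} L = record
    { K-eq = trans (fromℕℚ-suc k) (trans (cong (1ℚ +_) K-eq) (trans (solve 2 (λ Q s → con 1ℚ :+ (Q :+ s) := Q :+ (con 1ℚ :+ s)) refl Q s) (cong (Q +_) s'≡)))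
    ; T-eq = trans T-leaf (trans (cong (_+ 2ℚ) T-eq) (trans (solve 2 (λ Q s → con 2ℚ :* (Q :+ s) :+ con 2ℚ := con 2ℚ :* (Q :+ (con 1ℚ :+ s))) refl Q s)
        (cong (λ z → 2ℚ * (Q + z)) s'≡)))
    ; S-eq = trans S-new (trans (cong₂ (λ a b → a + b + 1ℚ) S-eq T-eq) (trans
        (solve 3 (λ σ Q s → con 2ℚ :* σ :+ con 2ℚ :* Q :* s :+ s :* s :+ con 2ℚ :* (Q :+ s) :+ con 1ℚ
          := con 2ℚ :* σ :+ con 2ℚ :* Q :* (con 1ℚ :+ s) :+ (con 1ℚ :+ s) :* (con 1ℚ :+ s)) refl σq Q s)
        (cong SL s'≡)))
    ; R-eq = trans R-new (trans (cong₂ _+_ R-eq K-eq) (trans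
        (solve 3 (λ σ Q s → σ :+ Q :* s :+ con ½ :* (s :* (s :- con 1ℚ)) :+ (Q :+ s)
          := σ :+ Q :* (con 1ℚ :+ s) :+ con ½ :* ((con 1ℚ :+ s) :* (con 1ℚ :+ s :- con 1ℚ))) refl σq Q s)
        (cong RL s'≡)))
    ; D-eq = trans D-leaf (trans (cong₂ (λ a b → a + b + Net.T net + 1ℚ + fromℕℚ k) D-eq (cong₂ (λ a b → a + 2ℚ * b) S-eq R-eq))
        (trans (cong₂ (λ a b → DL n + (SL s + 2ℚ * RL s) + a + 1ℚ + b) T-eq K-eq)
          (solve 5 (λ a b c d e → a :+ (b :+ c) :+ d :+ con 1ℚ :+ e := a :+ b :+ c :+ d :+ con 1ℚ :+ e) refl (DL n) (SL s) (2ℚ * RL s) (2ℚ * (Q + s)) (Q + s))))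
    ; r-bound = λ u v → ℚₚ.≤-trans (r-bound-leaf (+-nonneg (fromℕℚ-nonneg n) 0≤¼Q) r-bound u v)
        (ℚₚ.≤-reflexive (trans (sym (ℚₚ.+-assoc 1ℚ s (¼ * Q))) (cong (_+ ¼ * Q) s'≡)))
    ; Φ-bound = λ v → ℚₚ.≤-trans (bound v) (ℚₚ.≤-reflexive (cong (λ z → SL z + 2ℚ * RL z + ½ * Q) s'≡))
    }
    where
    open Lollipop L
    open Leaf net w
    open Net net using (S; R; T; D; r)
    s'≡ : 1ℚ + s ≡ fromℕℚ (suc n)
    s'≡ = sym (fromℕℚ-suc n)
    Φw : Φ net w ≡ SL s + 2ℚ * RL s
    Φw = cong₂ (λ a b → a + 2ℚ * b) S-eq R-eq
    Φ-step : SL s + 2ℚ * RL s + (2ℚ * (Q + s) + 2ℚ * (Q + s) + 1ℚ) ≡ SL (1ℚ + s) + 2ℚ * RL (1ℚ + s)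
    Φ-step = solve 3 (λ σ Q s → con 2ℚ :* σ :+ con 2ℚ :* Q :* s :+ s :* s :+ con 2ℚ :* (σ :+ Q :* s :+ con ½ :* (s :* (s :- con 1ℚ))) :+ (con 2ℚ :* (Q :+ s) :+ con 2ℚ :* (Q :+ s) :+ con 1ℚ)
        := con 2ℚ :* σ :+ con 2ℚ :* Q :* (con 1ℚ :+ s) :+ (con 1ℚ :+ s) :* (con 1ℚ :+ s)
           :+ con 2ℚ :* (σ :+ Q :* (con 1ℚ :+ s) :+ con ½ :* ((con 1ℚ :+ s) :* (con 1ℚ :+ s :- con 1ℚ)))) refl σq Q s
    bound : ∀ v → Φ net' v + 2ℚ * Net.r net' v zero ≤ SL (1ℚ + s) + 2ℚ * RL (1ℚ + s) + ½ * Q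
    bound zero = ≤-offset (½ * Q) (*-nonneg (ℚₚ.nonNegative⁻¹ ½) (+-nonneg (+-nonneg (ℚₚ.nonNegative⁻¹ 2ℚ) 0≤y) (ℚₚ.nonNegative⁻¹ 1ℚ))) (begin
      SL (1ℚ + s) + 2ℚ * RL (1ℚ + s) + ½ * Q ≡⟨ cong (_+ ½ * Q) (sym Φ-step) ⟩
      SL s + 2ℚ * RL s + (2ℚ * (Q + s) + 2ℚ * (Q + s) + 1ℚ) + ½ * Q
        ≡⟨ cong (_+ ½ * Q) (sym (trans Φ-new (trans (cong₂ (λ a b → a + (b + 2ℚ * fromℕℚ k + 1ℚ)) Φw T-eq)
             (cong (λ z → SL s + 2ℚ * RL s + (2ℚ * (Q + s) + 2ℚ * z + 1ℚ)) K-eq)))) ⟩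
      Φ net' zero + ½ * Q ≡⟨ cong (_+ ½ * Q) (sym (trans (cong (λ z → Φ net' zero + 2ℚ * z) (trans (ℚₚ.+-identityʳ (r w w)) (r-diag net w))) (ℚₚ.+-identityʳ (Φ net' zero)))) ⟩
      Φ net' zero + 2ℚ * Net.r net' zero zero + ½ * Q ∎)
    bound (suc v) = ℚₚ.≤-trans (ℚₚ.≤-reflexive (trans (cong (_+ 2ℚ * (r v w + 1ℚ)) (Φ-old v))
        (solve 2 (λ Φ r → Φ :+ (con 4ℚ :* r :+ (con 2ℚ :+ con 1ℚ)) :+ con 2ℚ :* (r :+ con 1ℚ) := Φ :+ con 2ℚ :* r :+ con 4ℚ :* r :+ (con 4ℚ :+ con 1ℚ)) refl (Φ net v) (r v w))))
      (ℚₚ.≤-trans (ℚₚ.+-monoˡ-≤ (4ℚ + 1ℚ) (ℚₚ.+-mono-≤ (Φ-bound v) (*-monoˡ-nonneg 4ℚ (ℚₚ.nonNegative⁻¹ 4ℚ) (r-bound v w))))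
        -- The left side grows by 4 r(v, w) + 5, at most 4 s + Q + 5, and the right side by 4 (Q +
        -- s) + 1. The gap is 3 Q - 4 = 5 + 3 y.
        (≤-offset (4ℚ + 1ℚ + (2ℚ + 1ℚ) * y) (+-nonneg (ℚₚ.nonNegative⁻¹ (4ℚ + 1ℚ)) (*-nonneg (ℚₚ.nonNegative⁻¹ (2ℚ + 1ℚ)) 0≤y))
          (trans (cong (_+ ½ * Q) (sym Φ-step))
            (solve 3 (λ Φ y s → let Q = con 2ℚ :+ y :+ con 1ℚ in
               Φ :+ (con 2ℚ :* (Q :+ s) :+ con 2ℚ :* (Q :+ s) :+ con 1ℚ) :+ con ½ :* Q
               := Φ :+ con ½ :* Q :+ con 4ℚ :* (s :+ con ¼ :* Q) :+ (con 4ℚ :+ con 1ℚ) :+ (con 4ℚ :+ con 1ℚ :+ (con 2ℚ :+ con 1ℚ) :* y)) refl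
               (SL s + 2ℚ * RL s) y s))))

module Bicyclic (μ ν : ℕ) where
  open Family μ ν

  -- U s bounds Φ at a vertex w so that attaching a leaf at w gains less than lengthening the path does: by DP-suc,
  -- DP (suc n) - DP n is U s plus the remaining terms of leaf-D.
  U : ℚ → ℚ
  U s = 2ℚ * (s * s) + 4ℚ * (s * (P + Q)) - (2ℚ + 1ℚ) * s + 4ℚ * (P * Q) - 2ℚ * (P + Q) + 4ℚ * (1/6 * (P * P + Q * Q - 2ℚ))

  -- `glue-D` evaluated for C_p glued to the free end of the lollipop: D_R of the P-graph whose
  -- cycles are joined by n edges.
  DP : ℕ → ℚ
  DP n = DL n + M * SL s + 2ℚ * P * RL s + σp * (2ℚ * (Q + s) + 2ℚ * (M + (Q + s)))
    where
    s : ℚ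
    s = fromℕℚ n

  DP-suc : ∀ n → DP (suc n) ≡ DP n + (U (fromℕℚ n) + (2ℚ + 1ℚ) * (P + Q + fromℕℚ n))
  DP-suc n = begin
    DP (suc n) ≡⟨ cong (λ z → DL (suc n) + M * SL z + 2ℚ * P * RL z + σp * (2ℚ * (Q + z) + 2ℚ * (M + (Q + z)))) (fromℕℚ-suc n) ⟩
    DL (suc n) + M * SL (1ℚ + s) + 2ℚ * P * RL (1ℚ + s) + σp * (2ℚ * (Q + (1ℚ + s)) + 2ℚ * (M + (Q + (1ℚ + s))))
      ≡⟨ solve 4 (λ D M N s →
           let P = M :+ con 1ℚ ; Q = N :+ con 1ℚ
               σp = con 1/6 :* (M :* (M :+ con 2ℚ)) ; σq = con 1/6 :* (N :* (N :+ con 2ℚ))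
               SL = λ z → con 2ℚ :* σq :+ con 2ℚ :* Q :* z :+ z :* z
               RL = λ z → σq :+ Q :* z :+ con ½ :* (z :* (z :- con 1ℚ))
               t = con 1ℚ :+ s in
           D :+ SL s :+ con 2ℚ :* RL s :+ con 2ℚ :* (Q :+ s) :+ con 1ℚ :+ (Q :+ s)
             :+ M :* SL t :+ con 2ℚ :* P :* RL t :+ σp :* (con 2ℚ :* (Q :+ t) :+ con 2ℚ :* (M :+ (Q :+ t)))
           := D :+ M :* SL s :+ con 2ℚ :* P :* RL s :+ σp :* (con 2ℚ :* (Q :+ s) :+ con 2ℚ :* (M :+ (Q :+ s)))
             :+ (con 2ℚ :* (s :* s) :+ con 4ℚ :* (s :* (P :+ Q)) :- (con 2ℚ :+ con 1ℚ) :* s :+ con 4ℚ :* (P :* Q) :- con 2ℚ :* (P :+ Q)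
                   :+ con 4ℚ :* (con 1/6 :* (P :* P :+ Q :* Q :- con 2ℚ))
                 :+ (con 2ℚ :+ con 1ℚ) :* (P :+ Q :+ s))) refl (DL n) M N s ⟩
    DP n + (U s + (2ℚ + 1ℚ) * (P + Q + s)) ∎
    where
    s : ℚ
    s = fromℕℚ n

  -- Here `n` counts all bridges, those of the joining path and those of the trees. No field depends
  -- on where the trees sit, so a leaf at any vertex leads to the next stage. In `r-bound` every
  -- bridge counts 1 and each cycle a quarter of its length.
  record Stage (n : ℕ) {k : ℕ} (net : Net k) : Set where
    s : ℚ
    s = fromℕℚ n
    field
      K-eq : fromℕℚ k ≡ P + Q + s - 1ℚ
      T-eq : Net.T net ≡ 2ℚ * (P + Q + s)
      r-bound : ∀ u v → Net.r net u v ≤ s + ¼ * (P + Q)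
      Φ-bound : ∀ v → Φ net v < U s

  -- The critical vertex is the new leaf: there `Φ` exceeds `Φ` at `w` by T + 2K + 1 = 4 (P + Q + s)
  -- - 1, which is exactly the increment of `U`, so strictness is inherited from `w`.
  leaf-stage : ∀ {n k} {net : Net k} → Stage n net → ∀ w → Stage (suc n) (leafNet net w)
  leaf-stage {n} {k} {net} st w = record
    { K-eq = trans (fromℕℚ-suc k) (trans (cong (1ℚ +_) K-eq) (trans
        (solve 2 (λ p s → con 1ℚ :+ (p :+ s :- con 1ℚ) := p :+ (con 1ℚ :+ s) :- con 1ℚ) refl (P + Q) s)
        (cong (λ z → P + Q + z - 1ℚ) s'≡)))
    ; T-eq = trans T-leaf (trans (cong (_+ 2ℚ) T-eq) (trans
        (solve 2 (λ p s → con 2ℚ :* (p :+ s) :+ con 2ℚ := con 2ℚ :* (p :+ (con 1ℚ :+ s))) refl (P + Q) s)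
        (cong (λ z → 2ℚ * (P + Q + z)) s'≡)))
    ; r-bound = λ u v → ℚₚ.≤-trans (r-bound-leaf (+-nonneg (fromℕℚ-nonneg n) 0≤¼PQ) r-bound u v)
        (ℚₚ.≤-reflexive (trans (sym (ℚₚ.+-assoc 1ℚ s (¼ * (P + Q)))) (cong (_+ ¼ * (P + Q)) s'≡)))
    ; Φ-bound = λ v → subst (λ z → Φ net' v < U z) s'≡ (bound v)
    }
    where
    open Stage st
    open Leaf net w
    open Net net using (r; T)
    s'≡ : 1ℚ + s ≡ fromℕℚ (suc n)
    s'≡ = sym (fromℕℚ-suc n)
    0≤¼PQ : 0ℚ ≤ ¼ * (P + Q)
    0≤¼PQ = ℚₚ.≤-trans (+-nonneg 0≤¼P 0≤¼Q) (ℚₚ.≤-reflexive (sym (ℚₚ.*-distribˡ-+ ¼ P Q)))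
    U-step : U (1ℚ + s) ≡ U s + (4ℚ * (P + Q + s) - 1ℚ)
    U-step = solve 3 (λ P Q s → let U = λ s → con 2ℚ :* (s :* s) :+ con 4ℚ :* (s :* (P :+ Q)) :- (con 2ℚ :+ con 1ℚ) :* s :+ con 4ℚ :* (P :* Q) :- con 2ℚ :* (P :+ Q) :+ con 4ℚ :* (con 1/6 :* (P :* P :+ Q :* Q :- con 2ℚ)) in
      U (con 1ℚ :+ s) := U s :+ (con 4ℚ :* (P :+ Q :+ s) :- con 1ℚ)) refl P Q s
    bound : ∀ v → Φ net' v < U (1ℚ + s)
    bound zero = ℚₚ.≤-<-trans (ℚₚ.≤-reflexive (trans Φ-new (cong (Φ net w +_) (trans (cong₂ (λ a b → a + 2ℚ * b + 1ℚ) T-eq K-eq)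
        (solve 1 (λ z → con 2ℚ :* z :+ con 2ℚ :* (z :- con 1ℚ) :+ con 1ℚ := con 4ℚ :* z :- con 1ℚ) refl (P + Q + s))))))
      (ℚₚ.<-≤-trans (ℚₚ.+-monoˡ-< (4ℚ * (P + Q + s) - 1ℚ) (Φ-bound w)) (ℚₚ.≤-reflexive (sym U-step)))
    bound (suc v) = ℚₚ.≤-<-trans (ℚₚ.≤-reflexive (Φ-old v))
      (ℚₚ.<-≤-trans (ℚₚ.+-mono-<-≤ (Φ-bound v) (ℚₚ.+-monoˡ-≤ (2ℚ + 1ℚ) (*-monoˡ-nonneg 4ℚ (ℚₚ.nonNegative⁻¹ 4ℚ) (r-bound v w))))
        -- At an old vertex `Φ` grows by at most 4 s + P + Q + 3, which leaves 3 (P + Q) - 4 = 14 +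
        -- 3 (x + y) of the increment of `U`.
        (≤-offset ((2ℚ + 1ℚ) * (x + y) + c14) (+-nonneg (*-nonneg (ℚₚ.nonNegative⁻¹ (2ℚ + 1ℚ)) (+-nonneg 0≤x 0≤y)) (ℚₚ.nonNegative⁻¹ c14))
          (trans U-step (solve 4 (λ U x y s → let p = con 2ℚ :+ x :+ con 1ℚ :+ (con 2ℚ :+ y :+ con 1ℚ) in
             U :+ (con 4ℚ :* (p :+ s) :- con 1ℚ) := U :+ (con 4ℚ :* (s :+ con ¼ :* p) :+ (con 2ℚ :+ con 1ℚ)) :+ ((con 2ℚ :+ con 1ℚ) :* (x :+ y) :+ con c14)) refl (U s) x y s))))
      where
      c14 : ℚ
      c14 = fromℕℚ 14

  leaf-D : ∀ {n k} {net : Net k} → Stage n net → ∀ w → Net.D net ≤ DP n → Net.D (leafNet net w) < DP (suc n)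
  leaf-D {n} {k} {net} st w D≤ = ℚₚ.≤-<-trans
    (ℚₚ.≤-reflexive (trans D-leaf (trans (cong₂ (λ a b → Net.D net + Φ net w + a + 1ℚ + b) T-eq K-eq)
      (solve 3 (λ D Φ z → D :+ Φ :+ con 2ℚ :* z :+ con 1ℚ :+ (z :- con 1ℚ) := D :+ (Φ :+ (con 2ℚ :+ con 1ℚ) :* z)) refl (Net.D net) (Φ net w) (P + Q + s)))))
    (ℚₚ.<-≤-trans (ℚₚ.+-mono-≤-< D≤ (ℚₚ.+-monoˡ-< ((2ℚ + 1ℚ) * (P + Q + s)) (Φ-bound w))) (ℚₚ.≤-reflexive (sym (DP-suc n))))
    where
    open Stage st
    open Leaf net w

  module Base {n k} {net : Net k} {w : Fin k} (L : Lollipop n net w) where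
    open Lollipop L
    open GlueQuantities Cp.cycleBlock net w using (T-glue; D-glue; RV; SV; R-glue; S-glue)
    open Net net using (S; R; T; D; r)

    baseNet : Net (p' ℕ.+ k)
    baseNet = glueNet Cp.cycleBlock net w

    σp-eq : Cp.σ ≡ σp
    σp-eq = cong (λ z → 1/6 * (z * (z + 2ℚ))) M≡

    base-D : Net.D baseNet ≡ DP n
    base-D = trans D-glue (begin
      D + fromℕℚ p' * S w + 2ℚ * (fromℕℚ p' + 1ℚ) * R w + Cp.σ * (T + 2ℚ * (fromℕℚ p' + fromℕℚ k))
        ≡⟨ cong₂ (λ a b → D + a * S w + 2ℚ * (a + 1ℚ) * R w + b * (T + 2ℚ * (a + fromℕℚ k))) M≡ σp-eq ⟩
      D + M * S w + 2ℚ * P * R w + σp * (T + 2ℚ * (M + fromℕℚ k))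
        ≡⟨ cong₂ (λ a b → a + M * b + 2ℚ * P * R w + σp * (T + 2ℚ * (M + fromℕℚ k))) D-eq S-eq ⟩
      DL n + M * SL s + 2ℚ * P * R w + σp * (T + 2ℚ * (M + fromℕℚ k))
        ≡⟨ cong₂ (λ a b → DL n + M * SL s + 2ℚ * P * a + σp * (b + 2ℚ * (M + fromℕℚ k))) R-eq T-eq ⟩
      DL n + M * SL s + 2ℚ * P * RL s + σp * (2ℚ * (Q + s) + 2ℚ * (M + fromℕℚ k))
        ≡⟨ cong (λ z → DL n + M * SL s + 2ℚ * P * RL s + σp * (2ℚ * (Q + s) + 2ℚ * (M + z))) K-eq ⟩
      DP n ∎)

    Φw : Φ net w ≡ SL s + 2ℚ * RL s
    Φw = cong₂ (λ a b → a + 2ℚ * b) S-eq R-eq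

    0≤s : 0ℚ ≤ s
    0≤s = fromℕℚ-nonneg n

    c≤ : ∀ i → Cp.c i i ≤ ¼ * P
    c≤ i = subst (λ z → Cp.c i i ≤ ¼ * (z + 1ℚ)) M≡ (Cp.c-bound i)

    -- Coefficients, besides 2, of what `U s` leaves over after `Φ` on the core is bounded by means
    -- of the quarter lengths. Expanded in the nonnegative `x`, `y` and `s`, the remainder has
    -- positive coefficients; the constant 33/2 makes the bound strict.
    33/2 15/2 7ℚ 3ℚ : ℚ
    3ℚ = fromℕℚ 3
    15/2 = ½ * fromℕℚ 15
    33/2 = ½ * fromℕℚ 33
    7ℚ = fromℕℚ 7

    Φ-new≤ : ∀ i → SV (inj₁ i) + 2ℚ * RV (inj₁ i) < U s
    Φ-new≤ i = ℚₚ.≤-<-trans (ℚₚ.≤-trans (ℚₚ.≤-reflexive expand) bounded)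
      (<-offset (33/2 + (15/2 * x + 7ℚ * y + 3ℚ * (x * y) + s * (7ℚ + 3ℚ * x)))
        (ℚₚ.+-mono-<-≤ (ℚₚ.positive⁻¹ 33/2) (+-nonneg (+-nonneg (+-nonneg (*-nonneg (ℚₚ.nonNegative⁻¹ 15/2) 0≤x) (*-nonneg (ℚₚ.nonNegative⁻¹ 7ℚ) 0≤y))
           (*-nonneg (ℚₚ.nonNegative⁻¹ 3ℚ) (*-nonneg 0≤x 0≤y))) (*-nonneg 0≤s (+-nonneg (ℚₚ.nonNegative⁻¹ 7ℚ) (*-nonneg (ℚₚ.nonNegative⁻¹ 3ℚ) 0≤x)))))
        (solve 3 (λ x y s →
           let M = con 2ℚ :+ x ; N = con 2ℚ :+ y ; P = M :+ con 1ℚ ; Q = N :+ con 1ℚ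
               σp = con 1/6 :* (M :* (M :+ con 2ℚ)) ; σq = con 1/6 :* (N :* (N :+ con 2ℚ)) in
           con 2ℚ :* (s :* s) :+ con 4ℚ :* (s :* (P :+ Q)) :- (con 2ℚ :+ con 1ℚ) :* s :+ con 4ℚ :* (P :* Q) :- con 2ℚ :* (P :+ Q)
                   :+ con 4ℚ :* (con 1/6 :* (P :* P :+ Q :* Q :- con 2ℚ))
           := con 4ℚ :* σp :+ (con 2ℚ :* σq :+ con 2ℚ :* Q :* s :+ s :* s :+ con 2ℚ :* (σq :+ Q :* s :+ con ½ :* (s :* (s :- con 1ℚ))))
               :+ (con 4ℚ :* (Q :+ s) :- con 2ℚ) :* (con ¼ :* P)
              :+ (con 33/2 :+ (con 15/2 :* x :+ con 7ℚ :* y :+ con 3ℚ :* (x :* y) :+ s :* (con 7ℚ :+ con 3ℚ :* x)))) refl x y s))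
      where
      expand : SV (inj₁ i) + 2ℚ * RV (inj₁ i) ≡ 4ℚ * σp + (SL s + 2ℚ * RL s) + (4ℚ * (Q + s) - 2ℚ) * Cp.c i i
      expand = begin
        2ℚ * Cp.σ + T * Cp.c i i + S w + 2ℚ * (Cp.σ - Cp.c i i + (R w + fromℕℚ k * Cp.c i i))
          ≡⟨ solve 6 (λ σ T c S R K → con 2ℚ :* σ :+ T :* c :+ S :+ con 2ℚ :* (σ :- c :+ (R :+ K :* c))
               := con 4ℚ :* σ :+ (S :+ con 2ℚ :* R) :+ (T :+ con 2ℚ :* K :- con 2ℚ) :* c) refl Cp.σ T (Cp.c i i) (S w) (R w) (fromℕℚ k) ⟩
        4ℚ * Cp.σ + Φ net w + (T + 2ℚ * fromℕℚ k - 2ℚ) * Cp.c i i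
          ≡⟨ cong₂ (λ a b → 4ℚ * a + b + (T + 2ℚ * fromℕℚ k - 2ℚ) * Cp.c i i) σp-eq Φw ⟩
        4ℚ * σp + (SL s + 2ℚ * RL s) + (T + 2ℚ * fromℕℚ k - 2ℚ) * Cp.c i i
          ≡⟨ cong (λ z → 4ℚ * σp + (SL s + 2ℚ * RL s) + z * Cp.c i i) (trans (cong₂ (λ a b → a + 2ℚ * b - 2ℚ) T-eq K-eq)
               (solve 1 (λ z → con 2ℚ :* z :+ con 2ℚ :* z :- con 2ℚ := con 4ℚ :* z :- con 2ℚ) refl (Q + s))) ⟩
        4ℚ * σp + (SL s + 2ℚ * RL s) + (4ℚ * (Q + s) - 2ℚ) * Cp.c i i ∎
      0≤4K-2 : 0ℚ ≤ 4ℚ * (Q + s) - 2ℚ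
      0≤4K-2 = ℚₚ.≤-trans (+-nonneg (ℚₚ.nonNegative⁻¹ (fromℕℚ 10)) (*-nonneg (ℚₚ.nonNegative⁻¹ 4ℚ) (+-nonneg 0≤y 0≤s)))
        (ℚₚ.≤-reflexive (solve 2 (λ y s → con (fromℕℚ 10) :+ con 4ℚ :* (y :+ s) := con 4ℚ :* (con 2ℚ :+ y :+ con 1ℚ :+ s) :- con 2ℚ) refl y s))
      bounded : 4ℚ * σp + (SL s + 2ℚ * RL s) + (4ℚ * (Q + s) - 2ℚ) * Cp.c i i ≤ 4ℚ * σp + (SL s + 2ℚ * RL s) + (4ℚ * (Q + s) - 2ℚ) * (¼ * P)
      bounded = ℚₚ.+-monoʳ-≤ (4ℚ * σp + (SL s + 2ℚ * RL s)) (*-monoˡ-nonneg (4ℚ * (Q + s) - 2ℚ) 0≤4K-2 (c≤ i))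

    Φ-old≤ : ∀ v → SV (inj₂ v) + 2ℚ * RV (inj₂ v) < U s
    Φ-old≤ v = ℚₚ.≤-<-trans (ℚₚ.≤-trans (ℚₚ.≤-reflexive expand) bounded)
      (<-offset (33/2 + (7ℚ * x + 15/2 * y + 3ℚ * (x * y) + 2ℚ * s))
        (ℚₚ.+-mono-<-≤ (ℚₚ.positive⁻¹ 33/2) (+-nonneg (+-nonneg (+-nonneg (*-nonneg (ℚₚ.nonNegative⁻¹ 7ℚ) 0≤x) (*-nonneg (ℚₚ.nonNegative⁻¹ 15/2) 0≤y))
           (*-nonneg (ℚₚ.nonNegative⁻¹ 3ℚ) (*-nonneg 0≤x 0≤y))) (*-nonneg (ℚₚ.nonNegative⁻¹ 2ℚ) 0≤s)))
        (solve 3 (λ x y s →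
           let M = con 2ℚ :+ x ; N = con 2ℚ :+ y ; P = M :+ con 1ℚ ; Q = N :+ con 1ℚ
               σp = con 1/6 :* (M :* (M :+ con 2ℚ)) ; σq = con 1/6 :* (N :* (N :+ con 2ℚ)) in
           con 2ℚ :* (s :* s) :+ con 4ℚ :* (s :* (P :+ Q)) :- (con 2ℚ :+ con 1ℚ) :* s :+ con 4ℚ :* (P :* Q) :- con 2ℚ :* (P :+ Q)
                   :+ con 4ℚ :* (con 1/6 :* (P :* P :+ Q :* Q :- con 2ℚ))
           := con 4ℚ :* σp :+ (con 2ℚ :* σq :+ con 2ℚ :* Q :* s :+ s :* s :+ con 2ℚ :* (σq :+ Q :* s :+ con ½ :* (s :* (s :- con 1ℚ))) :+ con ½ :* Q)
               :+ con 4ℚ :* M :* (s :+ con ¼ :* Q)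
              :+ (con 33/2 :+ (con 7ℚ :* x :+ con 15/2 :* y :+ con 3ℚ :* (x :* y) :+ con 2ℚ :* s))) refl x y s))
      where
      expand : SV (inj₂ v) + 2ℚ * RV (inj₂ v) ≡ 4ℚ * σp + (Φ net v + 2ℚ * r v w) + 4ℚ * M * r v w
      expand = begin
        S v + 2ℚ * Cp.σ + 2ℚ * (fromℕℚ p' + 1ℚ) * r v w + 2ℚ * (fromℕℚ p' * r v w + Cp.σ + R v)
          ≡⟨ cong₂ (λ a b → S v + 2ℚ * b + 2ℚ * (a + 1ℚ) * r v w + 2ℚ * (a * r v w + b + R v)) M≡ σp-eq ⟩
        S v + 2ℚ * σp + 2ℚ * (M + 1ℚ) * r v w + 2ℚ * (M * r v w + σp + R v)
          ≡⟨ solve 5 (λ S σ M r R → S :+ con 2ℚ :* σ :+ con 2ℚ :* (M :+ con 1ℚ) :* r :+ con 2ℚ :* (M :* r :+ σ :+ R)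
               := con 4ℚ :* σ :+ (S :+ con 2ℚ :* R :+ con 2ℚ :* r) :+ con 4ℚ :* M :* r) refl (S v) σp M (r v w) (R v) ⟩
        4ℚ * σp + (Φ net v + 2ℚ * r v w) + 4ℚ * M * r v w ∎
      bounded : 4ℚ * σp + (Φ net v + 2ℚ * r v w) + 4ℚ * M * r v w ≤ 4ℚ * σp + (SL s + 2ℚ * RL s + ½ * Q) + 4ℚ * M * (s + ¼ * Q)
      bounded = ℚₚ.+-mono-≤ (ℚₚ.+-monoʳ-≤ (4ℚ * σp) (Φ-bound v))
        (*-monoˡ-nonneg (4ℚ * M) (*-nonneg (ℚₚ.nonNegative⁻¹ 4ℚ) (+-nonneg (ℚₚ.nonNegative⁻¹ 2ℚ) 0≤x)) (r-bound v w))

    base-stage : Stage n baseNet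
    base-stage = record
      { K-eq = trans (fromℕℚ-+ p' k) (trans (cong₂ _+_ M≡ K-eq)
          (solve 3 (λ M Q s → M :+ (Q :+ s) := M :+ con 1ℚ :+ Q :+ s :- con 1ℚ) refl M Q s))
      ; T-eq = trans T-glue (trans (cong₂ (λ a b → a + 2ℚ * (b + 1ℚ)) T-eq M≡)
          (solve 3 (λ P Q s → con 2ℚ :* (Q :+ s) :+ con 2ℚ :* P := con 2ℚ :* (P :+ Q :+ s)) refl P Q s))
      ; r-bound = on-split₂ p' {P = λ a b → Glue.res Cp.cycleBlock (Net.A net) w r a b ≤ s + ¼ * (P + Q)}
          (λ i j → ℚₚ.≤-trans (ℚₚ.+-mono-≤ (ℚₚ.≤-trans (ℚₚ.≤-reflexive (Net.r-diag net w)) 0≤s+¼Q)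
            (subst (λ z → Cp.c i i + Cp.c j j - (Cp.c i j + Cp.c i j) ≤ ¼ * (z + 1ℚ)) M≡ (Cp.ρ-bound i j))) total)
          (λ i v → ℚₚ.≤-trans (ℚₚ.+-mono-≤ (r-bound w v) (c≤ i)) total)
          (λ u j → ℚₚ.≤-trans (ℚₚ.+-mono-≤ (r-bound u w) (c≤ j)) total)
          (λ u v → ℚₚ.≤-trans (ℚₚ.+-mono-≤ (r-bound u v) 0≤¼P) total)
      ; Φ-bound = λ v → subst (_< U s) (sym (cong₂ (λ a b → a + 2ℚ * b) (S-glue v) (R-glue v)))
          (on-split p' {P = λ a → SV a + 2ℚ * RV a < U s} Φ-new≤ Φ-old≤ v)
      }
      where
      0≤s+¼Q : 0ℚ ≤ s + ¼ * Q
      0≤s+¼Q = +-nonneg 0≤s 0≤¼Q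
      total : s + ¼ * Q + ¼ * P ≤ s + ¼ * (P + Q)
      total = ℚₚ.≤-reflexive (solve 3 (λ s P Q → s :+ con ¼ :* Q :+ con ¼ :* P := s :+ con ¼ :* (P :+ Q)) refl s P Q)

-- Adjacency matrices of graphs

ite : Bool → ℚ
ite b = if b then 1ℚ else 0ℚ

adjQ : ∀ {n} → Graph n → Mat n
adjQ G u v = ite (G u v)

b2ℕ-ite : ∀ b → fromℕℚ (b2ℕ b) ≡ ite b
b2ℕ-ite true = refl
b2ℕ-ite false = refl

fromℕℚ-sum : ∀ {n} (f : Fin n → ℕ) → fromℕℚ (sumℕ f) ≡ ∑ (λ i → fromℕℚ (f i))
fromℕℚ-sum {zero} f = sym (∑-[] _)
fromℕℚ-sum {suc n} f = begin
  fromℕℚ (sumℕ f) ≡⟨ cong fromℕℚ (sumℕ-suc f) ⟩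
  fromℕℚ (f zero ℕ.+ sumℕ (f ∘ suc)) ≡⟨ fromℕℚ-+ (f zero) _ ⟩
  fromℕℚ (f zero) + fromℕℚ (sumℕ (f ∘ suc)) ≡⟨ cong (fromℕℚ (f zero) +_) (fromℕℚ-sum (f ∘ suc)) ⟩
  fromℕℚ (f zero) + ∑ (λ i → fromℕℚ (f (suc i))) ≡⟨ sym (∑-suc _) ⟩
  ∑ (λ i → fromℕℚ (f i)) ∎

deg-degM : ∀ {n} (G : Graph n) u → fromℕℚ (deg G u) ≡ degM (adjQ G) u
deg-degM G u = trans (fromℕℚ-sum _) (∑-cong (λ v → b2ℕ-ite (G u v)))

lap-lapM : ∀ {n} (G : Graph n) x u → lap G x u ≡ lapM (adjQ G) x u
lap-lapM G x u = trans (sumℚ≡∑ _) (∑-cong (λ v → weigh (G u v) (x u - x v)))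
  where
  weigh : ∀ b a → (if b then a else 0ℚ) ≡ ite b * a
  weigh true a = sym (ℚₚ.*-identityˡ a)
  weigh false a = sym (ℚₚ.*-zeroˡ a)

to-ResM : ∀ {n} {G : Graph n} {r} → IsResistance G r → ResM (adjQ G) r
to-ResM {G = G} R u v with R u v
... | x , lx , ex = x , (λ w → trans (sym (lap-lapM G x w)) (lx w)) , ex

from-ResM : ∀ {n} {G : Graph n} {r} → ResM (adjQ G) r → IsResistance G r
from-ResM {G = G} R u v with R u v
... | x , lx , ex = x , (λ w → trans (lap-lapM G x w) (lx w)) , ex

ResM-cong : ∀ {n} {A A' r : Mat n} → (∀ u v → A u v ≡ A' u v) → ResM A r → ResM A' r
ResM-cong eqA R u v with R u v
... | x , lx , ex = x , (λ w → trans (∑-cong (λ z → cong (_* (x w - x z)) (sym (eqA w z)))) (lx w)) , ex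

Dsum-cong : ∀ {n} {A A' r r' : Mat n} → (∀ u v → A u v ≡ A' u v) → (∀ u v → r u v ≡ r' u v) → Dsum A r ≡ Dsum A' r'
Dsum-cong eqA eqr = ∑-cong (λ u → cong₂ _*_ (∑-cong (eqA u)) (∑-cong (eqr u)))

ResM-permute : ∀ {m n} {A r : Mat n} (π : Perm.Permutation m n) → let f = π Perm.⟨$⟩ʳ_ in
  ResM A r → ResM (λ u v → A (f u) (f v)) (λ u v → r (f u) (f v))
ResM-permute {A = A} π R u v with R (π Perm.⟨$⟩ʳ u) (π Perm.⟨$⟩ʳ v)
... | x , lx , ex = x ∘ f , (λ w → trans (sym (∑-permute (λ z → A (f w) z * (x (f w) - x z)) π))
    (trans (lx (f w)) (cong₂ _-_ (indic-injective f inj u w) (indic-injective f inj v w)))) , ex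
  where
  f : Fin _ → Fin _
  f = π Perm.⟨$⟩ʳ_
  inj : ∀ {a b} → f a ≡ f b → a ≡ b
  inj e = trans (sym (Perm.inverseˡ π)) (trans (cong (π Perm.⟨$⟩ˡ_) e) (Perm.inverseˡ π))

Dsum-permute : ∀ {m n} (A r : Mat n) (π : Perm.Permutation m n) → let f = π Perm.⟨$⟩ʳ_ in
  Dsum (λ u v → A (f u) (f v)) (λ u v → r (f u) (f v)) ≡ Dsum A r
Dsum-permute A r π = trans
  (∑-cong (λ u → cong₂ _*_ (sym (∑-permute (A (f u)) π)) (sym (∑-permute (r (f u)) π))))
  (sym (∑-permute (λ u → degM A u * Rsum r u) π))
  where
  f : Fin _ → Fin _
  f = π Perm.⟨$⟩ʳ_

-- The summand of a pair u < v is split into its two degree terms. Exchanging the indices in the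
-- second half supplies the pairs with v < u, and the diagonal contributes nothing since r(u, u) =
-- 0.
DR-Dsum : ∀ {n} (G : Graph n) (r : Mat n) → Symm r → (∀ u → r u u ≡ 0ℚ) → DR G r ≡ Dsum (adjQ G) r
DR-Dsum {n} G r r-sym r-diag = begin
  DR G r ≡⟨ trans (sumℚ≡∑ _) (∑-cong (λ u → trans (sumℚ≡∑ _) (∑-cong (λ v → pair u v)))) ⟩
  ∑ (λ u → ∑ (λ v → below u v * (d u * r u v) + below u v * (d v * r u v)))
    ≡⟨ trans (∑-cong (λ u → ∑-+ _ _)) (∑-+ _ _) ⟩
  ∑ (λ u → ∑ (λ v → below u v * (d u * r u v))) + ∑ (λ u → ∑ (λ v → below u v * (d v * r u v)))
    ≡⟨ cong (∑ (λ u → ∑ (λ v → below u v * (d u * r u v))) +_) (trans (∑-comm (λ u v → below u v * (d v * r u v)))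
         (∑-cong (λ v → ∑-cong (λ u → cong (λ z → below u v * (d v * z)) (r-sym u v))))) ⟩
  ∑ (λ u → ∑ (λ v → below u v * (d u * r u v))) + ∑ (λ u → ∑ (λ v → below v u * (d u * r u v)))
    ≡⟨ trans (sym (∑-+ _ _)) (∑-cong (λ u → trans (sym (∑-+ _ _)) (trans (∑-cong (merge u)) (∑-* (d u) (r u))))) ⟩
  ∑ (λ u → d u * Rsum r u) ∎
  where
  d : Fin n → ℚ
  d = degM (adjQ G)
  below : Fin n → Fin n → ℚ
  below u v = ite ⌊ toℕ u ℕ.<? toℕ v ⌋
  pair : ∀ u v → (if ⌊ toℕ u ℕ.<? toℕ v ⌋ then fromℕℚ (deg G u ℕ.+ deg G v) * r u v else 0ℚ)
    ≡ below u v * (d u * r u v) + below u v * (d v * r u v)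
  pair u v with ⌊ toℕ u ℕ.<? toℕ v ⌋
  ... | true = trans (cong (_* r u v) (trans (fromℕℚ-+ (deg G u) (deg G v)) (cong₂ _+_ (deg-degM G u) (deg-degM G v))))
      (solve 3 (λ a b r → (a :+ b) :* r := con 1ℚ :* (a :* r) :+ con 1ℚ :* (b :* r)) refl (d u) (d v) (r u v))
  ... | false = solve 2 (λ a b → con 0ℚ := con 0ℚ :* a :+ con 0ℚ :* b) refl (d u * r u v) (d v * r u v)
  merge : ∀ u v → below u v * (d u * r u v) + below v u * (d u * r u v) ≡ d u * r u v
  merge u v with toℕ u ℕ.<? toℕ v | toℕ v ℕ.<? toℕ u
  ... | yes u<v | yes v<u = ⊥-elim (ℕₚ.<-asym u<v v<u)
  ... | yes _ | no _ = solve 1 (λ a → con 1ℚ :* a :+ con 0ℚ :* a := a) refl (d u * r u v)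
  ... | no _ | yes _ = solve 1 (λ a → con 0ℚ :* a :+ con 1ℚ :* a := a) refl (d u * r u v)
  ... | no u≮v | no v≮u with Finₚ.toℕ-injective (ℕₚ.≤-antisym (ℕₚ.≮⇒≥ v≮u) (ℕₚ.≮⇒≥ u≮v))
  ... | refl = trans (cong (λ z → 0ℚ * (d u * z) + 0ℚ * (d u * z)) (r-diag u))
      (trans (solve 1 (λ a → con 0ℚ :* (a :* con 0ℚ) :+ con 0ℚ :* (a :* con 0ℚ) := a :* con 0ℚ) refl (d u)) (cong (d u *_) (sym (r-diag u))))

-- Adjacency of the P-graph, and its construction by gluing

ite-∨ : ∀ a b → (a ≡ true → b ≡ true → Data.Empty.⊥) → ite (a ∨ b) ≡ ite a + ite b
ite-∨ true true ex = ⊥-elim (ex refl refl)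
ite-∨ true false ex = refl
ite-∨ false true ex = refl
ite-∨ false false ex = refl

ite-∧ : ∀ a b → ite (a ∧ b) ≡ ite a * ite b
ite-∧ true b = sym (ℚₚ.*-identityˡ (ite b))
ite-∧ false b = sym (ℚₚ.*-zeroˡ (ite b))

∨-true : ∀ {a b} → a ∨ b ≡ true → a ≡ true ⊎ b ≡ true
∨-true {true} _ = inj₁ refl
∨-true {false} e = inj₂ e

∧-true : ∀ {a b} → a ∧ b ≡ true → a ≡ true × b ≡ true
∧-true {true} {true} _ = refl , refl

≡ᵇ-true : ∀ {a b} → (a ℕ.≡ᵇ b) ≡ true → a ≡ b
≡ᵇ-true {a} {b} e = ℕₚ.≡ᵇ⇒≡ a b (subst Data.Bool.T (sym e) _)

≡ᵇ∧-true : ∀ {k l k' l'} → ((k ℕ.≡ᵇ l) ∧ (k' ℕ.≡ᵇ l')) ≡ true → k ≡ l × k' ≡ l'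
≡ᵇ∧-true t = let (s , s') = ∧-true t in ≡ᵇ-true s , ≡ᵇ-true s'

succ-adj : ℕ → ℕ → ℚ
succ-adj i j = eq j (suc i) + eq i (suc j)

-- The disjuncts of Pℕ exclude each other when p, q ≥ 3, so the adjacency of the P-graph is a sum;
-- here a = p ∸ 1, b = n ∸ q and c = n ∸ 1.
Pedge : (a b c i j : ℕ) → ℚ
Pedge a b c i j = succ-adj i j + (eq i 0 * eq j a + eq j 0 * eq i a) + (eq i b * eq j c + eq j b * eq i c)

Pbool : (a b c i j : ℕ) → Bool
Pbool a b c i j = (j ℕ.≡ᵇ suc i) ∨ (i ℕ.≡ᵇ suc j)
             ∨ ((i ℕ.≡ᵇ 0) ∧ (j ℕ.≡ᵇ a)) ∨ ((j ℕ.≡ᵇ 0) ∧ (i ℕ.≡ᵇ a))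
             ∨ ((i ℕ.≡ᵇ b) ∧ (j ℕ.≡ᵇ c)) ∨ ((j ℕ.≡ᵇ b) ∧ (i ℕ.≡ᵇ c))

Pbool-Pedge : ∀ {a b c} → 2 ℕ.≤ a → 0 ℕ.< b → suc b ℕ.< c → ∀ i j → ite (Pbool a b c i j) ≡ Pedge a b c i j
Pbool-Pedge {a} {b} {c} 2≤a 0<b sb<c i j = begin
  ite (d₁ ∨ d₂ ∨ d₃ ∨ d₄ ∨ d₅ ∨ d₆) ≡⟨ ite-∨ d₁ _ (λ t₁ t → x₁ (≡ᵇ-true t₁) (u₂ t)) ⟩
  ite d₁ + ite (d₂ ∨ d₃ ∨ d₄ ∨ d₅ ∨ d₆) ≡⟨ cong (ite d₁ +_) (ite-∨ d₂ _ (λ t₂ t → x₂ (≡ᵇ-true t₂) (u₃ t))) ⟩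
  ite d₁ + (ite d₂ + ite (d₃ ∨ d₄ ∨ d₅ ∨ d₆)) ≡⟨ cong (λ z → ite d₁ + (ite d₂ + z)) (ite-∨ d₃ _ (λ t₃ t → x₃ (≡ᵇ∧-true t₃) (u₄ t))) ⟩
  ite d₁ + (ite d₂ + (ite d₃ + ite (d₄ ∨ d₅ ∨ d₆))) ≡⟨ cong (λ z → ite d₁ + (ite d₂ + (ite d₃ + z))) (ite-∨ d₄ _ (λ t₄ t → x₄ (≡ᵇ∧-true t₄) (u₅ t))) ⟩
  ite d₁ + (ite d₂ + (ite d₃ + (ite d₄ + ite (d₅ ∨ d₆))))
    ≡⟨ cong (λ z → ite d₁ + (ite d₂ + (ite d₃ + (ite d₄ + z)))) (ite-∨ d₅ d₆ (λ t₅ t₆ → x₅ (≡ᵇ∧-true t₅) (≡ᵇ∧-true t₆))) ⟩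
  ite d₁ + (ite d₂ + (ite d₃ + (ite d₄ + (ite d₅ + ite d₆))))
    ≡⟨ solve 6 (λ p q r s t u → p :+ (q :+ (r :+ (s :+ (t :+ u)))) := p :+ q :+ (r :+ s) :+ (t :+ u)) refl (ite d₁) (ite d₂) (ite d₃) (ite d₄) (ite d₅) (ite d₆) ⟩
  ite d₁ + ite d₂ + (ite d₃ + ite d₄) + (ite d₅ + ite d₆)
    ≡⟨ cong₂ (λ p q → succ-adj i j + p + q) (cong₂ _+_ (ite-∧ (i ℕ.≡ᵇ 0) _) (ite-∧ (j ℕ.≡ᵇ 0) _)) (cong₂ _+_ (ite-∧ (i ℕ.≡ᵇ b) _) (ite-∧ (j ℕ.≡ᵇ b) _)) ⟩
  Pedge a b c i j ∎
  where
  open Data.Empty using (⊥)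
  d₁ d₂ d₃ d₄ d₅ d₆ : Bool
  d₁ = j ℕ.≡ᵇ suc i
  d₂ = i ℕ.≡ᵇ suc j
  d₃ = (i ℕ.≡ᵇ 0) ∧ (j ℕ.≡ᵇ a)
  d₄ = (j ℕ.≡ᵇ 0) ∧ (i ℕ.≡ᵇ a)
  d₅ = (i ℕ.≡ᵇ b) ∧ (j ℕ.≡ᵇ c)
  d₆ = (j ℕ.≡ᵇ b) ∧ (i ℕ.≡ᵇ c)
  E₁ E₂ E₃ E₄ E₅ E₆ : Set
  E₁ = j ≡ suc i
  E₂ = i ≡ suc j
  E₃ = i ≡ 0 × j ≡ a
  E₄ = j ≡ 0 × i ≡ a
  E₅ = i ≡ b × j ≡ c
  E₆ = j ≡ b × i ≡ c
  u₅ : (d₅ ∨ d₆) ≡ true → E₅ ⊎ E₆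
  u₅ t = Data.Sum.map ≡ᵇ∧-true ≡ᵇ∧-true (∨-true t)
  u₄ : (d₄ ∨ d₅ ∨ d₆) ≡ true → E₄ ⊎ E₅ ⊎ E₆
  u₄ t = Data.Sum.map ≡ᵇ∧-true u₅ (∨-true t)
  u₃ : (d₃ ∨ d₄ ∨ d₅ ∨ d₆) ≡ true → E₃ ⊎ E₄ ⊎ E₅ ⊎ E₆
  u₃ t = Data.Sum.map ≡ᵇ∧-true u₄ (∨-true t)
  u₂ : (d₂ ∨ d₃ ∨ d₄ ∨ d₅ ∨ d₆) ≡ true → E₂ ⊎ E₃ ⊎ E₄ ⊎ E₅ ⊎ E₆
  u₂ t = Data.Sum.map ≡ᵇ-true u₃ (∨-true t)
  0<a : 0 ℕ.< a
  0<a = ℕₚ.<-trans (ℕ.s≤s ℕ.z≤n) 2≤a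
  b<c : b ℕ.< c
  b<c = ℕₚ.<-trans (ℕₚ.n<1+n b) sb<c
  0<c : 0 ℕ.< c
  0<c = ℕₚ.<-trans 0<b b<c
  -- Each description of an edge is played off against all later ones. The bounds `2 ≤ a` and
  -- `suc b < c` separate the closing edges 0a and bc from the path edges, and `0 < b` separates
  -- them from each other.
  x₁ : E₁ → E₂ ⊎ E₃ ⊎ E₄ ⊎ E₅ ⊎ E₆ → ⊥
  x₁ refl (inj₁ e) = ℕₚ.<-irrefl e (ℕₚ.m<n⇒m<1+n (ℕₚ.n<1+n i))
  x₁ refl (inj₂ (inj₁ (refl , refl))) = ℕₚ.<-irrefl refl 2≤a
  x₁ refl (inj₂ (inj₂ (inj₁ (() , _))))
  x₁ refl (inj₂ (inj₂ (inj₂ (inj₁ (refl , refl))))) = ℕₚ.<-irrefl refl sb<c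
  x₁ refl (inj₂ (inj₂ (inj₂ (inj₂ (refl , refl))))) = ℕₚ.<-asym b<c (ℕₚ.n<1+n i)
  x₂ : E₂ → E₃ ⊎ E₄ ⊎ E₅ ⊎ E₆ → ⊥
  x₂ refl (inj₁ (() , _))
  x₂ refl (inj₂ (inj₁ (refl , refl))) = ℕₚ.<-irrefl refl 2≤a
  x₂ refl (inj₂ (inj₂ (inj₁ (refl , refl)))) = ℕₚ.<-asym b<c (ℕₚ.n<1+n j)
  x₂ refl (inj₂ (inj₂ (inj₂ (refl , refl)))) = ℕₚ.<-irrefl refl sb<c
  x₃ : E₃ → E₄ ⊎ E₅ ⊎ E₆ → ⊥
  x₃ (refl , refl) (inj₁ (e , _)) = ℕₚ.<-irrefl (sym e) 0<a
  x₃ (refl , refl) (inj₂ (inj₁ (e , _))) = ℕₚ.<-irrefl e 0<b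
  x₃ (refl , refl) (inj₂ (inj₂ (_ , e))) = ℕₚ.<-irrefl e 0<c
  x₄ : E₄ → E₅ ⊎ E₆ → ⊥
  x₄ (refl , refl) (inj₁ (_ , e)) = ℕₚ.<-irrefl e 0<c
  x₄ (refl , refl) (inj₂ (e , _)) = ℕₚ.<-irrefl e 0<b
  x₅ : E₅ → E₆ → ⊥
  x₅ (refl , refl) (_ , e) = ℕₚ.<-irrefl e b<c

eq-+ : ∀ a i j → eq (a ℕ.+ i) (a ℕ.+ j) ≡ eq i j
eq-+ zero i j = refl
eq-+ (suc a) i j = eq-+ a i j

-- The new vertices take the numbers 0 to m - 1 and the ground, old vertex `zero`, becomes number m.
-- Hence the consecutive pairs up to m together with the pair 0m form the glued cycle, while `X`
-- carries the edges among old vertices that are not consecutive.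
glue-front : ∀ m {k} (2≤m : 2 ℕ.≤ m) (N : Net (suc k)) (X : ℕ → ℕ → ℚ) →
  (∀ i j → i ℕ.< m ⊎ j ℕ.< m → X i j ≡ 0ℚ) →
  (∀ (u v : Fin (suc k)) → succ-adj (toℕ u) (toℕ v) + X (m ℕ.+ toℕ u) (m ℕ.+ toℕ v) ≡ Net.A N u v) →
  ∀ (a a' : Fin (m ℕ.+ suc k)) → succ-adj (toℕ a) (toℕ a') + (eq (toℕ a) 0 * eq (toℕ a') m + eq (toℕ a') 0 * eq (toℕ a) m) + X (toℕ a) (toℕ a')
    ≡ Net.A (glueNet (Cycle.cycleBlock m 2≤m) N zero) a a'
glue-front m@(suc m₁) {k} 2≤m N X X-front X-back a a' = subst₂ (λ p q → F p q ≡ Net.A (glueNet (Cycle.cycleBlock m 2≤m) N zero) a a')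
    (join-toℕ a) (join-toℕ a')
    (on-split₂ m {P = λ s s' → F (toℕ (Data.Fin.join m _ s)) (toℕ (Data.Fin.join m _ s')) ≡ Glue.adj (Cycle.cycleBlock m 2≤m) (Net.A N) zero s s'}
       new-new new-old (λ u j → trans (F-sym (toℕ (m ↑ʳ u)) (toℕ (j ↑ˡ suc k)) (X-front _ _ (inj₁ (new< j))) (X-front _ _ (inj₂ (new< j)))) (new-old j u)) old-old a a')
  where
  F : ℕ → ℕ → ℚ
  F i j = succ-adj i j + (eq i 0 * eq j m + eq j 0 * eq i m) + X i j
  F-sym : ∀ i j → X j i ≡ 0ℚ → X i j ≡ 0ℚ → F i j ≡ F j i
  F-sym i j e e' = trans (cong (succ-adj i j + (eq i 0 * eq j m + eq j 0 * eq i m) +_) (trans e' (sym e)))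
    (solve 5 (λ p q r s x → p :+ q :+ (r :+ s) :+ x := q :+ p :+ (s :+ r) :+ x) refl (eq j (suc i)) (eq i (suc j)) (eq i 0 * eq j m) (eq j 0 * eq i m) (X j i))
  join-toℕ : ∀ (a : Fin (m ℕ.+ suc k)) → toℕ (Data.Fin.join m (suc k) (splitAt m a)) ≡ toℕ a
  join-toℕ a = cong toℕ (Finₚ.join-splitAt m (suc k) a)
  new< : ∀ (i : Fin m) → toℕ (i ↑ˡ suc k) ℕ.< m
  new< i = subst (ℕ._< m) (sym (Finₚ.toℕ-↑ˡ i (suc k))) (Finₚ.toℕ<n i)
  new-new : ∀ (i j : Fin m) → F (toℕ (i ↑ˡ suc k)) (toℕ (j ↑ˡ suc k)) ≡ Cycle.B m 2≤m i j
  new-new i j = trans (cong₂ (λ p q → succ-adj x y + p + q)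
      (trans (cong₂ (λ p q → eq x 0 * p + eq y 0 * q) (eq-< (new< j)) (eq-< (new< i))) (solve 2 (λ p q → p :* con 0ℚ :+ q :* con 0ℚ := con 0ℚ) refl (eq x 0) (eq y 0)))
      (X-front x y (inj₁ (new< i))))
    (trans (solve 1 (λ p → p :+ con 0ℚ :+ con 0ℚ := p) refl (succ-adj x y)) (cong₂ succ-adj (Finₚ.toℕ-↑ˡ i (suc k)) (Finₚ.toℕ-↑ˡ j (suc k))))
    where
    x y : ℕ
    x = toℕ (i ↑ˡ suc k)
    y = toℕ (j ↑ˡ suc k)
  new-old : ∀ (i : Fin m) (u : Fin (suc k)) → F (toℕ (i ↑ˡ suc k)) (toℕ (m ↑ʳ u)) ≡ Cycle.b m 2≤m i * indic zero u
  new-old i u = trans (cong₂ F (Finₚ.toℕ-↑ˡ i (suc k)) (Finₚ.toℕ-↑ʳ m u)) (trans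
    (cong₂ (λ p q → eq (m ℕ.+ z) (suc x) + p + (eq x 0 * eq (m ℕ.+ z) m + 0ℚ * eq x m) + q)
      (eq-< (ℕₚ.<-trans (Finₚ.toℕ<n i) (ℕ.s≤s (ℕₚ.m≤m+n m z)))) (X-front x (m ℕ.+ z) (inj₁ (Finₚ.toℕ<n i))))
    (trans (cong₂ (λ p q → p + 0ℚ + (eq x 0 * q + 0ℚ * eq x m) + 0ℚ) (last u) (first u))
      (solve 4 (λ a b c d → b :* d :+ con 0ℚ :+ (a :* d :+ con 0ℚ :* c) :+ con 0ℚ := (a :+ b) :* d) refl (eq x 0) (eq (suc x) m) (eq x m) (indic zero u))))
    where
    x z : ℕ
    x = toℕ i
    z = toℕ u
    first : ∀ u → eq (m ℕ.+ toℕ u) m ≡ indic zero u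
    first u = trans (cong (eq (m ℕ.+ toℕ u)) (sym (ℕₚ.+-identityʳ m))) (trans (eq-+ m (toℕ u) 0) (trans (eq-sym (toℕ u) 0) (eq-toℕ zero u)))
    last : ∀ (u : Fin (suc k)) → eq (m ℕ.+ toℕ u) (suc x) ≡ eq (suc x) m * indic zero u
    last zero = trans (cong (λ q → eq q (suc x)) (ℕₚ.+-identityʳ m)) (trans (eq-sym m (suc x)) (sym (ℚₚ.*-identityʳ _)))
    last (suc u) = trans (eq-> (ℕₚ.≤-<-trans (Finₚ.toℕ<n i) (ℕₚ.m<m+n m (ℕ.s≤s ℕ.z≤n)))) (sym (ℚₚ.*-zeroʳ (eq (suc x) m)))
  old-old : ∀ (u v : Fin (suc k)) → F (toℕ (m ↑ʳ u)) (toℕ (m ↑ʳ v)) ≡ Net.A N u v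
  old-old u v = trans (cong₂ F (Finₚ.toℕ-↑ʳ m u) (Finₚ.toℕ-↑ʳ m v)) (trans
    (cong₂ (λ p q → p + q + X (m ℕ.+ toℕ u) (m ℕ.+ toℕ v))
      (cong₂ _+_ (trans (cong (eq (m ℕ.+ toℕ v)) (sym (ℕₚ.+-suc m (toℕ u)))) (eq-+ m (toℕ v) (suc (toℕ u))))
                 (trans (cong (eq (m ℕ.+ toℕ u)) (sym (ℕₚ.+-suc m (toℕ v)))) (eq-+ m (toℕ u) (suc (toℕ v)))))
      (solve 2 (λ p q → con 0ℚ :* p :+ con 0ℚ :* q := con 0ℚ) refl (eq (m ℕ.+ toℕ v) m) (eq (m ℕ.+ toℕ u) m)))
    (trans (cong (_+ X (m ℕ.+ toℕ u) (m ℕ.+ toℕ v)) (ℚₚ.+-identityʳ (succ-adj (toℕ u) (toℕ v)))) (X-back u v)))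

module PathOfCycles (μ ν : ℕ) where
  open Family μ ν
  open Bicyclic μ ν

  -- A lollipop is numbered from its free end: the path is 0, ..., s and C_q occupies s, ..., s +
  -- q'. This is the edge closing C_q; a further leaf shifts all numbers by one.
  closing : ℕ → ℕ → ℕ → ℚ
  closing s i j = eq i s * eq j (s ℕ.+ q') + eq j s * eq i (s ℕ.+ q')

  cycle-adj : ∀ u v → succ-adj (toℕ u) (toℕ v) + closing 0 (toℕ u) (toℕ v) ≡ Net.A cycleNet u v
  cycle-adj u v = begin
    succ-adj (toℕ u) (toℕ v) + closing 0 (toℕ u) (toℕ v) ≡⟨ sym (ℚₚ.+-identityʳ (succ-adj (toℕ u) (toℕ v) + closing 0 (toℕ u) (toℕ v))) ⟩
    succ-adj (toℕ u) (toℕ v) + closing 0 (toℕ u) (toℕ v) + 0ℚ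
      ≡⟨ glue-front q' 2≤q' single (λ _ _ → 0ℚ) (λ _ _ _ → refl) (λ { zero zero → refl }) u v ⟩
    Net.A cycleNet u v ∎

  leaf-adj : ∀ {s k} {net : Net k} {w : Fin k} → toℕ w ≡ 0 →
    (∀ u v → succ-adj (toℕ u) (toℕ v) + closing s (toℕ u) (toℕ v) ≡ Net.A net u v) →
    ∀ u v → succ-adj (toℕ u) (toℕ v) + closing (suc s) (toℕ u) (toℕ v) ≡ Net.A (leafNet net w) u v
  leaf-adj {s} {w = w} w≡0 adj zero zero = refl
  leaf-adj {s} {w = w} w≡0 adj zero (suc v) = begin
    eq (toℕ v) 0 + 0ℚ + (0ℚ * eq (toℕ v) (s ℕ.+ q') + eq (toℕ v) s * 0ℚ)
      ≡⟨ solve 3 (λ a b c → a :+ con 0ℚ :+ (con 0ℚ :* b :+ c :* con 0ℚ) := con 1ℚ :* a) refl (eq (toℕ v) 0) (eq (toℕ v) (s ℕ.+ q')) (eq (toℕ v) s) ⟩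
    1ℚ * eq (toℕ v) 0 ≡⟨ cong (1ℚ *_) (trans (eq-sym (toℕ v) 0) (trans (cong (λ z → eq z (toℕ v)) (sym w≡0)) (eq-toℕ w v))) ⟩
    1ℚ * indic w v ∎
  leaf-adj {s} {w = w} w≡0 adj (suc u) zero = begin
    0ℚ + eq (toℕ u) 0 + (eq (toℕ u) s * 0ℚ + 0ℚ * eq (toℕ u) (s ℕ.+ q'))
      ≡⟨ solve 3 (λ a b c → con 0ℚ :+ a :+ (c :* con 0ℚ :+ con 0ℚ :* b) := con 1ℚ :* a) refl (eq (toℕ u) 0) (eq (toℕ u) (s ℕ.+ q')) (eq (toℕ u) s) ⟩
    1ℚ * eq (toℕ u) 0 ≡⟨ cong (1ℚ *_) (trans (eq-sym (toℕ u) 0) (trans (cong (λ z → eq z (toℕ u)) (sym w≡0)) (eq-toℕ w u))) ⟩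
    1ℚ * indic w u ∎
  leaf-adj w≡0 adj (suc u) (suc v) = adj u v

  record LollipopNet (s k : ℕ) : Set where
    field
      net : Net k
      w : Fin k
      w≡0 : toℕ w ≡ 0
      lollipop : Lollipop s net w
      adj : ∀ u v → succ-adj (toℕ u) (toℕ v) + closing s (toℕ u) (toℕ v) ≡ Net.A net u v

  extend : ∀ {s k} → LollipopNet s k → LollipopNet (suc s) (suc k)
  extend {s} {k} L = record
    { net = leafNet net w ; w = zero ; w≡0 = refl
    ; lollipop = leaf-lollipop {s} {k} {net} {w} lollipop
    ; adj = leaf-adj {s} {k} {net} {w} w≡0 adj }
    where open LollipopNet L

  lollipop-net : ∀ s → LollipopNet s (s ℕ.+ (q' ℕ.+ 1))
  lollipop-net zero = record { net = cycleNet ; w = zero ; w≡0 = refl ; lollipop = cycle-lollipop ; adj = cycle-adj }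
  lollipop-net (suc s) = extend (lollipop-net s)

  closing-shift : ∀ s i j → eq (p' ℕ.+ i) (p' ℕ.+ s) * eq (p' ℕ.+ j) (p' ℕ.+ s ℕ.+ q') + eq (p' ℕ.+ j) (p' ℕ.+ s) * eq (p' ℕ.+ i) (p' ℕ.+ s ℕ.+ q') ≡ closing s i j
  closing-shift s i j = cong₂ _+_
    (cong₂ _*_ (eq-+ p' i s) (trans (cong (eq (p' ℕ.+ j)) (ℕₚ.+-assoc p' s q')) (eq-+ p' j (s ℕ.+ q'))))
    (cong₂ _*_ (eq-+ p' j s) (trans (cong (eq (p' ℕ.+ i)) (ℕₚ.+-assoc p' s q')) (eq-+ p' i (s ℕ.+ q'))))

  Pgraph-Pbool : ∀ n p q s → p ≡ suc p' → q ≡ suc q' → n ≡ p' ℕ.+ (s ℕ.+ (q' ℕ.+ 1)) →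
    ∀ (u v : Fin n) → Pgraph n p q u v ≡ Pbool p' (p' ℕ.+ s) (p' ℕ.+ s ℕ.+ q') (toℕ u) (toℕ v)
  Pgraph-Pbool n p q s refl refl n≡ u v = cong₂ (λ b c → Pbool p' b c (toℕ u) (toℕ v)) n∸q n∸1
    where
    n≡₁ : n ≡ p' ℕ.+ s ℕ.+ suc q'
    n≡₁ = trans n≡ (trans (sym (ℕₚ.+-assoc p' s (q' ℕ.+ 1))) (cong (p' ℕ.+ s ℕ.+_) (ℕₚ.+-comm q' 1)))
    n∸q : n ℕ.∸ suc q' ≡ p' ℕ.+ s
    n∸q = trans (cong (ℕ._∸ suc q') n≡₁) (ℕₚ.m+n∸n≡m (p' ℕ.+ s) (suc q'))
    n∸1 : n ℕ.∸ 1 ≡ p' ℕ.+ s ℕ.+ q'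
    n∸1 = trans (cong (ℕ._∸ 1) n≡₁) (cong (ℕ._∸ 1) (ℕₚ.+-suc (p' ℕ.+ s) q'))

  Pgraph-Pedge : ∀ n p q s → p ≡ suc p' → q ≡ suc q' → n ≡ p' ℕ.+ (s ℕ.+ (q' ℕ.+ 1)) →
    ∀ (u v : Fin n) → adjQ (Pgraph n p q) u v ≡ Pedge p' (p' ℕ.+ s) (p' ℕ.+ s ℕ.+ q') (toℕ u) (toℕ v)
  Pgraph-Pedge n p q s p≡ q≡ n≡ u v = begin
    ite (Pgraph n p q u v) ≡⟨ cong ite (Pgraph-Pbool n p q s p≡ q≡ n≡ u v) ⟩
    ite (Pbool p' (p' ℕ.+ s) (p' ℕ.+ s ℕ.+ q') (toℕ u) (toℕ v))
      ≡⟨ Pbool-Pedge {p'} {p' ℕ.+ s} {p' ℕ.+ s ℕ.+ q'} 2≤p' (ℕ.s≤s ℕ.z≤n) b<c (toℕ u) (toℕ v) ⟩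
    Pedge p' (p' ℕ.+ s) (p' ℕ.+ s ℕ.+ q') (toℕ u) (toℕ v) ∎
    where
    b<c : suc (p' ℕ.+ s) ℕ.< p' ℕ.+ s ℕ.+ q'
    b<c = subst (ℕ._≤ p' ℕ.+ s ℕ.+ q') (trans (ℕₚ.+-suc (p' ℕ.+ s) 1) (cong suc (trans (ℕₚ.+-suc (p' ℕ.+ s) 0) (cong suc (ℕₚ.+-identityʳ (p' ℕ.+ s)))))) (ℕₚ.+-monoʳ-≤ (p' ℕ.+ s) 2≤q')

  record GraphStage (s : ℕ) {n : ℕ} (G : Graph n) : Set where
    field
      net : Net n
      adj : ∀ u v → Net.A net u v ≡ adjQ G u v
      stage : Stage s net

  open GraphStage

  build-base : ∀ {s k} {net : Net k} {w : Fin k} → toℕ w ≡ 0 → Lollipop s net w →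
    (∀ u v → succ-adj (toℕ u) (toℕ v) + closing s (toℕ u) (toℕ v) ≡ Net.A net u v) →
    Σ (Net (p' ℕ.+ k)) λ base → (∀ u v → Net.A base u v ≡ Pedge p' (p' ℕ.+ s) (p' ℕ.+ s ℕ.+ q') (toℕ u) (toℕ v)) ×
      Stage s base × Net.D base ≡ DP s
  build-base {s} {suc k} {net} {zero} _ L adj = baseNet ,
    (λ u v → sym (glue-front p' 2≤p' net
      (λ i j → eq i (p' ℕ.+ s) * eq j (p' ℕ.+ s ℕ.+ q') + eq j (p' ℕ.+ s) * eq i (p' ℕ.+ s ℕ.+ q'))
      vanish (λ u v → trans (cong (succ-adj (toℕ u) (toℕ v) +_) (closing-shift s (toℕ u) (toℕ v))) (adj u v)) u v)) ,
    base-stage , base-D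
    where
    open Base L
    b≥ : ∀ i → i ℕ.< p' → eq i (p' ℕ.+ s) ≡ 0ℚ
    b≥ i i<p' = eq-< (ℕₚ.<-≤-trans i<p' (ℕₚ.m≤m+n p' s))
    c≥ : ∀ i → i ℕ.< p' → eq i (p' ℕ.+ s ℕ.+ q') ≡ 0ℚ
    c≥ i i<p' = eq-< (ℕₚ.<-≤-trans i<p' (ℕₚ.≤-trans (ℕₚ.m≤m+n p' s) (ℕₚ.m≤m+n (p' ℕ.+ s) q')))
    vanish : ∀ i j → i ℕ.< p' ⊎ j ℕ.< p' → eq i (p' ℕ.+ s) * eq j (p' ℕ.+ s ℕ.+ q') + eq j (p' ℕ.+ s) * eq i (p' ℕ.+ s ℕ.+ q') ≡ 0ℚ
    vanish i j (inj₁ i<p') = trans (cong₂ (λ a b → a * eq j (p' ℕ.+ s ℕ.+ q') + eq j (p' ℕ.+ s) * b) (b≥ i i<p') (c≥ i i<p'))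
      (solve 2 (λ a b → con 0ℚ :* a :+ b :* con 0ℚ := con 0ℚ) refl (eq j (p' ℕ.+ s ℕ.+ q')) (eq j (p' ℕ.+ s)))
    vanish i j (inj₂ j<p') = trans (cong₂ (λ a b → eq i (p' ℕ.+ s) * a + b * eq i (p' ℕ.+ s ℕ.+ q')) (c≥ j j<p') (b≥ j j<p'))
      (solve 2 (λ a b → a :* con 0ℚ :+ con 0ℚ :* b := con 0ℚ) refl (eq i (p' ℕ.+ s)) (eq i (p' ℕ.+ s ℕ.+ q')))

  Pgraph-stage : ∀ n p q s → p ≡ suc p' → q ≡ suc q' → n ≡ p' ℕ.+ (s ℕ.+ (q' ℕ.+ 1)) →
    Σ (GraphStage s (Pgraph n p q)) λ gs → Net.D (net gs) ≡ DP s
  Pgraph-stage n p q s p≡ q≡ refl =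
    let (base , base-adj , st , D≡) = build-base {s} {net = L.net} {L.w} L.w≡0 L.lollipop L.adj in record
    { net = base ; adj = λ u v → trans (base-adj u v) (sym (Pgraph-Pedge n p q s p≡ q≡ refl u v)) ; stage = st } , D≡
    where module L = LollipopNet (lollipop-net s)

-- Growing a graph by leaves

record IsLeafExt {k : ℕ} (H : Graph k) (w : Fin k) (G : Graph (suc k)) : Set where
  field
    old-old : ∀ u v → G (suc u) (suc v) ≡ H u v
    new-new : G zero zero ≡ false
    new-old : ∀ u → G zero (suc u) ≡ ⌊ w ≟ u ⌋
    old-new : ∀ u → G (suc u) zero ≡ ⌊ w ≟ u ⌋

data Grown {k} (H : Graph k) : ∀ {n} → Graph n → Set where
  done : Grown H H
  leaf : ∀ {n} {G : Graph n} {G' : Graph (suc n)} {w} → Grown H G → IsLeafExt G w G' → Grown H G'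

module _ (μ ν : ℕ) where
  open Family μ ν
  open Bicyclic μ ν
  open PathOfCycles μ ν
  open GraphStage

  leaf-graph-stage : ∀ {s n} {H : Graph n} {w} {G : Graph (suc n)} → (gs : GraphStage s H) → IsLeafExt H w G → GraphStage (suc s) G
  leaf-graph-stage {w = w} gs ext = record
    { net = leafNet (net gs) w
    ; adj = λ { zero zero → sym (cong ite new-new)
              ; zero (suc u) → trans (ℚₚ.*-identityˡ (indic w u)) (sym (cong ite (new-old u)))
              ; (suc u) zero → trans (ℚₚ.*-identityˡ (indic w u)) (sym (cong ite (old-new u)))
              ; (suc u) (suc v) → trans (adj gs u v) (sym (cong ite (old-old u v))) }
    ; stage = leaf-stage (stage gs) w }
    where open IsLeafExt ext

  leaf-graph-D : ∀ {s n} {H : Graph n} {w} {G : Graph (suc n)} (gs : GraphStage s H) (ext : IsLeafExt H w G) →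
    Net.D (net gs) ≤ DP s → Net.D (net (leaf-graph-stage {s} {n} {H} {w} {G} gs ext)) < DP (suc s)
  leaf-graph-D {s} {n} {w = w} gs ext = leaf-D {s} {n} {net gs} (stage gs) w

  -- The weak bound `D-≤` is what the next leaf consumes; `D-<` holds from the first leaf on. In
  -- `size`, the leaves are counted once by the order and once by the index, additively so that
  -- nothing is subtracted.
  record GrownStage (s k : ℕ) {n : ℕ} (G : Graph n) : Set where
    field
      {index} : ℕ
      graph-stage : GraphStage index G
      size : n ℕ.+ s ≡ k ℕ.+ index
      D-≤ : Net.D (net graph-stage) ≤ DP index
      D-< : k ≢ n → Net.D (net graph-stage) < DP index

  grown-leaf : ∀ {s k n w} {G : Graph n} {G' : Graph (suc n)} → GrownStage s k G → IsLeafExt G w G' → GrownStage s k G'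
  grown-leaf {s} {k} {n} {w} {G} {G'} g ext = record
    { index = suc index
    ; graph-stage = leaf-graph-stage {index} {n} {G} {w} {G'} graph-stage ext
    ; size = trans (cong suc size) (sym (ℕₚ.+-suc k index))
    ; D-≤ = ℚₚ.<⇒≤ (leaf-graph-D {index} {n} {G} {w} {G'} graph-stage ext D-≤)
    ; D-< = λ _ → leaf-graph-D {index} {n} {G} {w} {G'} graph-stage ext D-≤ }
    where open GrownStage g

  grown-stage : ∀ {s k n} {H : Graph k} {G : Graph n} (gs : GraphStage s H) → Net.D (net gs) ≡ DP s → Grown H G → GrownStage s k G
  grown-stage gs D≡ done = record
    { graph-stage = gs ; size = refl ; D-≤ = ℚₚ.≤-reflexive D≡ ; D-< = λ k≢k → ⊥-elim (k≢k refl) }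
  grown-stage gs D≡ (leaf g ext) = grown-leaf (grown-stage gs D≡ g) ext

-- Cycles and walks

SameEdge : ∀ {n} → Fin n → Fin n → Fin n → Fin n → Set
SameEdge u v a b = (u ≡ a × v ≡ b) ⊎ (u ≡ b × v ≡ a)

sameEdge? : ∀ {n} (u v a b : Fin n) → Dec (SameEdge u v a b)
sameEdge? u v a b = ((u ≟ a) ×-dec (v ≟ b)) ⊎-dec ((u ≟ b) ×-dec (v ≟ a))

SameEdge-swap : ∀ {n} {u v a b : Fin n} → SameEdge u v a b → SameEdge v u a b
SameEdge-swap (inj₁ (p , q)) = inj₂ (q , p)
SameEdge-swap (inj₂ (p , q)) = inj₁ (q , p)

toℕ-next : ∀ {m} (i : Fin (suc m)) →
  (toℕ i ℕ.< m × toℕ (next i) ≡ suc (toℕ i)) ⊎ (toℕ i ≡ m × toℕ (next i) ≡ 0)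
toℕ-next {m} i with ℕₚ.m≤n⇒m<n∨m≡n (ℕₚ.≤-pred (Finₚ.toℕ<n i))
... | inj₁ i<m = inj₁ (i<m , trans (Finₚ.toℕ-fromℕ< _) (m<n⇒m%n≡m (ℕ.s≤s i<m)))
... | inj₂ i≡m = inj₂ (i≡m , trans (Finₚ.toℕ-fromℕ< _) (trans (cong (λ z → suc z % suc m) i≡m) (n%n≡0 (suc m))))

next-inject₁ : ∀ {m} (i : Fin m) → next (inject₁ i) ≡ suc i
next-inject₁ {m} i with toℕ-next (inject₁ i)
... | inj₁ (_ , e) = Finₚ.toℕ-injective (trans e (cong suc (Finₚ.toℕ-inject₁ i)))
... | inj₂ (e , _) = ⊥-elim (ℕₚ.<-irrefl (trans (sym (Finₚ.toℕ-inject₁ i)) e) (Finₚ.toℕ<n i))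

next-fromℕ : ∀ m → next (fromℕ m) ≡ zero
next-fromℕ m with toℕ-next (fromℕ m)
... | inj₁ (lt , _) = ⊥-elim (ℕₚ.<-irrefl (Finₚ.toℕ-fromℕ m) lt)
... | inj₂ (_ , e) = Finₚ.toℕ-injective e

next-injective : ∀ {m} {i j : Fin (suc m)} → next i ≡ next j → i ≡ j
next-injective {m} {i} {j} e with toℕ-next i | toℕ-next j
... | inj₁ (_ , p) | inj₁ (_ , q) = Finₚ.toℕ-injective (ℕₚ.suc-injective (trans (sym p) (trans (cong toℕ e) q)))
... | inj₁ (_ , p) | inj₂ (_ , q) = ⊥-elim (ℕₚ.1+n≢0 (trans (sym p) (trans (cong toℕ e) q)))
... | inj₂ (_ , p) | inj₁ (_ , q) = ⊥-elim (ℕₚ.1+n≢0 (trans (sym q) (trans (cong toℕ (sym e)) p)))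
... | inj₂ (p , _) | inj₂ (q , _) = Finₚ.toℕ-injective (trans p (sym q))

next²≢ : ∀ {m} → 2 ℕ.≤ m → (i : Fin (suc m)) → next (next i) ≢ i
next²≢ {m} 2≤m i e with toℕ-next i | toℕ-next (next i)
... | inj₁ (_ , p) | inj₁ (_ , q) = ℕₚ.<-irrefl (trans (cong toℕ (sym e)) (trans q (cong suc p))) (ℕₚ.m<n⇒m<1+n (ℕₚ.n<1+n (toℕ i)))
... | inj₁ (_ , p) | inj₂ (p' , q) = ℕₚ.<-irrefl (trans (cong suc (trans (sym q) (cong toℕ e))) (trans (sym p) p')) 2≤m
... | inj₂ (p' , p) | inj₁ (_ , q) = ℕₚ.<-irrefl (trans (cong suc (sym p)) (trans (sym q) (trans (cong toℕ e) p'))) 2≤m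
... | inj₂ (_ , p) | inj₂ (p' , _) = ℕₚ.<-irrefl (trans (sym p) p') (ℕₚ.<-trans (ℕ.s≤s ℕ.z≤n) 2≤m)

-- Lets a cycle be traversed from any of its vertices as a sequence that begins at `zero`.
record Rotation {m} (a : Fin (suc m)) : Set where
  field
    π : Fin (suc m) → Fin (suc m)
    π-injective : ∀ {i j} → π i ≡ π j → i ≡ j
    π-next : ∀ i → π (next i) ≡ next (π i)
    π-zero : π zero ≡ a

rotation : ∀ {m} (a : Fin (suc m)) → Rotation a
rotation {m} a = <-weakInduction Rotation
  (record { π = id ; π-injective = id ; π-next = λ _ → refl ; π-zero = refl })
  (λ i R → let open Rotation R in record
    { π = next ∘ π ; π-injective = π-injective ∘ next-injective
    ; π-next = λ j → cong next (π-next j) ; π-zero = trans (cong next π-zero) (next-inject₁ i) }) a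

module _ {n} {E : Fin n → Fin n → Set} where
  walk : ∀ {m} (d : Fin (suc m) → Fin n) (t : Fin (suc m)) →
    (∀ (i : Fin m) → toℕ i ℕ.< toℕ t → E (d (inject₁ i)) (d (suc i))) → Star E (d zero) (d t)
  walk d zero h = ε
  walk {suc m} d (suc t) h = h zero (ℕ.s≤s ℕ.z≤n) ◅ walk (d ∘ suc) t (λ i lt → h (suc i) (ℕ.s≤s lt))

  cycle-connected : ∀ {m} → (∀ {u v} → E u v → E v u) → (c : Fin (suc m) → Fin n) → (∀ i → E (c i) (c (next i))) →
    ∀ i j → Star E (c i) (c j)
  cycle-connected sy c h i j = reverse sy (from-zero i) ◅◅ from-zero j
    where
    from-zero : ∀ t → Star E (c zero) (c t)
    from-zero t = walk c t (λ i _ → subst (λ z → E (c (inject₁ i)) (c z)) (next-inject₁ i) (h (inject₁ i)))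

  -- Rotated to begin just after `i₀`, the cycle ends at `i₀`, and the edge that leaves `i₀` is the
  -- only one not traversed.
  cycle-bypass : ∀ {m} (c : Fin (suc m) → Fin n) i₀ → (∀ i → i ≢ i₀ → E (c i) (c (next i))) → Star E (c (next i₀)) (c i₀)
  cycle-bypass {m} c i₀ h = subst₂ (λ a b → Star E (c a) (c b)) π-zero π-last
    (walk (c ∘ π) (fromℕ m) (λ i _ → subst (λ z → E (c (π (inject₁ i))) (c z)) (trans (sym (π-next (inject₁ i))) (cong π (next-inject₁ i)))
      (h (π (inject₁ i)) (λ e → Finₚ.fromℕ≢inject₁ (sym (π-injective (trans e (sym π-last))))))))
    where
    open Rotation (rotation (next i₀))
    π-last : π (fromℕ m) ≡ i₀
    π-last = next-injective (trans (sym (π-next (fromℕ m))) (trans (cong π (next-fromℕ m)) π-zero))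

-- `P` may be met only at the start and `Q` only at the end. With `P` empty and `Q` a single vertex
-- this is an ordinary simple path; with the vertex sets of two cycles it is the path that links
-- them.
record SimplePath {n} (E : Fin n → Fin n → Set) (P Q : Fin n → Set) (x : Fin n) : Set where
  field
    len : ℕ
    z : Fin (suc len) → Fin n
    z-injective : ∀ {i j} → z i ≡ z j → i ≡ j
    z-adj : ∀ (i : Fin len) → E (z (inject₁ i)) (z (suc i))
    z-start : z zero ≡ x
    z-¬P : ∀ (i : Fin len) → ¬ P (z (suc i))
    z-¬Q : ∀ (i : Fin len) → ¬ Q (z (inject₁ i))
    z-end : Q (z (fromℕ len))

module _ {n} {E : Fin n → Fin n → Set} {P Q : Fin n → Set} where
  open SimplePath

  trivial-path : ∀ {x} → Q x → SimplePath E P Q x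
  trivial-path {x} qx = record
    { len = 0 ; z = λ _ → x ; z-injective = λ { {zero} {zero} _ → refl } ; z-adj = λ () ; z-start = refl
    ; z-¬P = λ () ; z-¬Q = λ () ; z-end = qx }

  suffix : ∀ {x} (s : SimplePath E P Q x) i → SimplePath E P Q (z s i)
  suffix s zero = record { SimplePath s ; z-start = refl }
  suffix record { len = suc l ; z = z ; z-injective = inj ; z-adj = adj ; z-¬P = ¬p ; z-¬Q = ¬q ; z-end = end } (suc i) =
    suffix (record { len = l ; z = z ∘ suc ; z-injective = Finₚ.suc-injective ∘ inj ; z-adj = adj ∘ suc ; z-start = refl
                   ; z-¬P = ¬p ∘ suc ; z-¬Q = ¬q ∘ suc ; z-end = end }) i

  prepend : ∀ {x w} → E x w → ¬ P w → ¬ Q x → (s : SimplePath E P Q w) → (∀ i → z s i ≢ x) → SimplePath E P Q x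
  prepend {x} exw ¬pw ¬qx s new = record
    { len = suc (len s)
    ; z = λ { zero → x ; (suc i) → z s i }
    ; z-injective = λ { {zero} {zero} _ → refl
                      ; {zero} {suc j} e → ⊥-elim (new j (sym e))
                      ; {suc i} {zero} e → ⊥-elim (new i e)
                      ; {suc i} {suc j} e → cong suc (z-injective s e) }
    ; z-adj = λ { zero → subst (E x) (sym (z-start s)) exw ; (suc i) → z-adj s i }
    ; z-start = refl
    ; z-¬P = λ { zero → subst (¬_ ∘ P) (sym (z-start s)) ¬pw ; (suc i) → z-¬P s i }
    ; z-¬Q = λ { zero → ¬qx ; (suc i) → z-¬Q s i }
    ; z-end = z-end s }

  -- The walk is shortened from its end. A repeated vertex cuts off a loop by `suffix`, and a return
  -- to `P` discards everything before it, which is why the start may move to another vertex of `P`.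
  simple-path : (∀ x → Dec (P x)) → (∀ x → Dec (Q x)) → ∀ {x y} → Star E x y → Q y →
    Σ _ λ x' → SimplePath E P Q x' × (x' ≡ x ⊎ P x')
  simple-path P? Q? {x} ε qy = x , trivial-path qy , inj₁ refl
  simple-path P? Q? {x} (_◅_ {j = w} e es) qy with Q? x
  ... | yes qx = x , trivial-path qx , inj₁ refl
  ... | no ¬qx with simple-path P? Q? es qy
  ... | x' , s , inj₂ px' = x' , s , inj₂ px'
  ... | .w , s , inj₁ refl with P? w
  ... | yes pw = w , s , inj₂ pw
  ... | no ¬pw with Finₚ.any? (λ i → z s i ≟ x)
  ... | yes (i , zi≡x) = x , subst (SimplePath E P Q) zi≡x (suffix s i) , inj₁ refl
  ... | no new = x , prepend e ¬pw ¬qx s (λ i e → new (i , e)) , inj₁ refl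

-- `E` is the relation of admissible edges. A simple `E`-path from `x` to `y` is closed by the edge
-- yx; since xy is not admissible, the path has at least two edges and the result is a genuine
-- cycle.
CycEdge-closing : ∀ {n} {G : Graph n} {E : Fin n → Fin n → Set} {x y} →
  (∀ {u v} → E u v → G u v ≡ true) → ¬ E x y → x ≢ y → G y x ≡ true → Star E x y →
  Σ ℕ λ k → Σ (Fin k → Fin n) λ e → IsCycle G k e × CycEdge e x y ×
    (∀ u v → CycEdge e u v → E u v ⊎ E v u ⊎ SameEdge u v x y)
CycEdge-closing {n} {G} {E} {x} {y} E⊆G ¬Exy x≢y Gyx w with simple-path {P = λ _ → Data.Empty.⊥} {Q = _≡ y} (λ _ → no (λ ())) (_≟ y) w refl
... | x' , record { len = len ; z = z ; z-injective = inj ; z-adj = adj ; z-start = start ; z-end = end } , inj₁ refl =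
  suc len , z , (3≤ len z adj start end , (λ {i} {j} → inj) , edge) , (fromℕ len , inj₂ (end , trans (cong z (next-fromℕ len)) start)) , edges
  where
  3≤ : ∀ l (z : Fin (suc l) → Fin n) → (∀ (i : Fin l) → E (z (inject₁ i)) (z (suc i))) → z zero ≡ x → z (fromℕ l) ≡ y → 3 ℕ.≤ suc l
  3≤ zero z _ s e = ⊥-elim (x≢y (trans (sym s) e))
  3≤ (suc zero) z a s e = ⊥-elim (¬Exy (subst₂ E s e (a zero)))
  3≤ (suc (suc l)) _ _ _ _ = ℕ.s≤s (ℕ.s≤s (ℕ.s≤s ℕ.z≤n))
  edge : ∀ i → G (z i) (z (next i)) ≡ true
  edge i with view i
  ... | ‵fromℕ = subst₂ (λ a b → G a b ≡ true) (sym end) (sym (trans (cong z (next-fromℕ len)) start)) Gyx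
  ... | ‵inject₁ j = subst (λ a → G (z (inject₁ j)) (z a) ≡ true) (sym (next-inject₁ j)) (E⊆G (adj j))
  edges : ∀ u v → CycEdge z u v → E u v ⊎ E v u ⊎ SameEdge u v x y
  edges u v (i , se) with view i
  edges u v (i , inj₁ (p , q)) | ‵fromℕ = inj₂ (inj₂ (inj₂ (trans (sym p) end , trans (sym q) (trans (cong z (next-fromℕ len)) start))))
  edges u v (i , inj₂ (p , q)) | ‵fromℕ = inj₂ (inj₂ (inj₁ (trans (sym q) (trans (cong z (next-fromℕ len)) start) , trans (sym p) end)))
  edges u v (i , inj₁ (p , q)) | ‵inject₁ j = inj₁ (subst₂ E p (trans (cong z (sym (next-inject₁ j))) q) (adj j))
  edges u v (i , inj₂ (p , q)) | ‵inject₁ j = inj₂ (inj₁ (subst₂ E p (trans (cong z (sym (next-inject₁ j))) q) (adj j)))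

injective⇒hits : ∀ {n} (f : Fin n → Fin n) → (∀ {i j} → f i ≡ f j → i ≡ j) → ∀ y → Σ (Fin n) λ i → f i ≡ y
injective⇒hits {suc n} f inj y with Finₚ.any? (λ i → f i ≟ y)
... | yes hit = hit
... | no miss = ⊥-elim (ℕₚ.<-irrefl refl (Finₚ.injective⇒≤ {f = g} g-injective))
  where
  y≢ : ∀ i → y ≢ f i
  y≢ i e = miss (i , sym e)
  g : Fin (suc n) → Fin n
  g i = punchOut (y≢ i)
  g-injective : Injective _≡_ _≡_ g
  g-injective {i} {j} e = inj (Finₚ.punchOut-injective (y≢ i) (y≢ j) e)

module _ {n} (G : Graph n) where
  edge-unique : ∀ {m} {c : Fin (suc m) → Fin n} → IsCycle G (suc m) c → ∀ {i j} → SameEdge (c i) (c (next i)) (c j) (c (next j)) → i ≡ j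
  edge-unique (_ , inj , _) (inj₁ (p , _)) = inj p
  edge-unique (ℕ.s≤s 2≤m , inj , _) {i} {j} (inj₂ (p , q)) = ⊥-elim (next²≢ 2≤m j (trans (cong next (sym (inj p))) (inj q)))

  next≢ : ∀ {m} {c : Fin (suc m) → Fin n} → IsCycle G (suc m) c → ∀ {i} → c i ≢ c (next i)
  next≢ (ℕ.s≤s 2≤m , inj , _) {i} e = next²≢ 2≤m i (trans (cong next (sym (inj e))) (sym (inj e)))

SameEdge-trans : ∀ {n} {u v a b x y : Fin n} → SameEdge u v a b → SameEdge a b x y → SameEdge u v x y
SameEdge-trans (inj₁ (refl , refl)) s = s
SameEdge-trans (inj₂ (refl , refl)) s = SameEdge-swap s

SameEdge-sym : ∀ {n} {u v a b : Fin n} → SameEdge u v a b → SameEdge a b u v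
SameEdge-sym (inj₁ (refl , refl)) = inj₁ (refl , refl)
SameEdge-sym (inj₂ (refl , refl)) = inj₂ (refl , refl)

CycEdge-resp : ∀ {n k} {c : Fin k → Fin n} {a b x y} → SameEdge a b x y → CycEdge c a b → CycEdge c x y
CycEdge-resp s (i , t) = i , SameEdge-trans t s

cycEdge? : ∀ {n k} (c : Fin k → Fin n) a b → Dec (CycEdge c a b)
cycEdge? c a b = Finₚ.any? (λ i → sameEdge? (c i) (c (next i)) a b)

module _ {n} {G : Graph n} (G-sym : ∀ u v → G u v ≡ G v u) where

  Avoiding : (a b x y u v : Fin n) → Set
  Avoiding a b x y u v = G u v ≡ true × ¬ SameEdge u v a b × ¬ SameEdge u v x y

  avoiding-sym : ∀ {a b x y u v} → Avoiding a b x y u v → Avoiding a b x y v u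
  avoiding-sym {u = u} {v} (g , p , q) = trans (G-sym v u) g , p ∘ SameEdge-swap , q ∘ SameEdge-swap

  -- If c and d share the edge ab, then d bypasses ab along c, so c minus an edge outside d closes up without ab.
  third-cycle-sharing-edge : ∀ {m l} {c : Fin (suc m) → Fin n} {d : Fin (suc l) → Fin n} → IsCycle G (suc m) c → IsCycle G (suc l) d →
    ∀ {a b} i → ¬ CycEdge d (c i) (c (next i)) → CycEdge c a b → CycEdge d a b →
    Σ ℕ λ k → Σ (Fin k → Fin n) λ e → IsCycle G k e × ¬ CycEdge e a b
  third-cycle-sharing-edge {c = c} {d} Cc Cd {a} {b} i ∉d _ (j₀ , s₀) =
    let (k , e , Ce , _ , edges) = CycEdge-closing {G = G} {E = E} proj₁ (λ (_ , _ , ne) → ne (inj₁ (refl , refl))) (next≢ G Cc ∘ sym)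
                                     (proj₂ (proj₂ Cc) i) (fold (Star E) _◅◅_ ε around-c)
    in k , e , Ce , λ ab → avoid (edges a b ab)
    where
    x y : Fin n
    x = c (next i)
    y = c i
    E : Fin n → Fin n → Set
    E = Avoiding a b x y
    ∉d' : ∀ {u v} → CycEdge d u v → ¬ SameEdge u v x y
    ∉d' uv s = ∉d (CycEdge-resp (SameEdge-trans s (inj₂ (refl , refl))) uv)
    around-d : Star E (d (next j₀)) (d j₀)
    around-d = cycle-bypass d j₀ (λ j j≢ → proj₂ (proj₂ Cd) j ,
      (λ s → j≢ (edge-unique G Cd (SameEdge-trans s (SameEdge-sym s₀)))) , ∉d' (j , inj₁ (refl , refl)))
    bypass : ∀ {u v} → SameEdge u v a b → Star E u v
    bypass s with SameEdge-trans s (SameEdge-sym s₀)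
    ... | inj₁ (refl , refl) = reverse avoiding-sym around-d
    ... | inj₂ (refl , refl) = around-d
    around-c : Star (Star E) x y
    around-c = cycle-bypass c i (λ i' i'≢ → step-c i' i'≢)
      where
      step-c : ∀ i' → i' ≢ i → Star E (c i') (c (next i'))
      step-c i' i'≢ with sameEdge? (c i') (c (next i')) a b
      ... | yes s = bypass s
      ... | no ¬s = (proj₂ (proj₂ Cc) i' , ¬s , (λ s → i'≢ (edge-unique G Cc (SameEdge-trans s (inj₂ (refl , refl)))))) ◅ ε
    avoid : E a b ⊎ E b a ⊎ SameEdge a b x y → Data.Empty.⊥
    avoid (inj₁ (_ , ne , _)) = ne (inj₁ (refl , refl))
    avoid (inj₂ (inj₁ (_ , ne , _))) = ne (inj₂ (refl , refl))
    avoid (inj₂ (inj₂ s)) = ∉d' (j₀ , s₀) s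

  -- An arc of d between two common vertices is completed by a walk along c.
  third-cycle-sharing-vertices : ∀ {m l} {c : Fin (suc m) → Fin n} {d : Fin (suc l) → Fin n} → IsCycle G (suc m) c → IsCycle G (suc l) d →
    (∀ {a b} → CycEdge c a b → ¬ CycEdge d a b) → ∀ {i₀ i₁ j₀ j₁} → c i₀ ≡ d j₀ → c i₁ ≡ d j₁ → j₀ ≢ j₁ →
    Σ ℕ λ k → Σ (Fin k → Fin n) λ e → IsCycle G k e × CycEdge e (d j₀) (d (next j₀)) × ¬ CycEdge e (d j₁) (d (next j₁))
  third-cycle-sharing-vertices {m} {zero} Cc (ℕ.s≤s () , _)
  third-cycle-sharing-vertices {m} {suc l} {c} {d} Cc Cd disj {i₀} {i₁} {j₀} {j₁} e₀ e₁ j₀≢j₁ =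
    let (k , e , Ce , xy , edges) = CycEdge-closing {G = G} {E = E} proj₁ (λ (_ , _ , ne) → ne (inj₁ (refl , refl))) (next≢ G Cd)
                                     (trans (G-sym y x) (proj₂ (proj₂ Cd) j₀)) x⇝y
    in k , e , Ce , xy , λ f → avoid (edges _ _ f)
    where
    open Rotation (rotation j₀)
    x y : Fin n
    x = d j₀
    y = d (next j₀)
    E : Fin n → Fin n → Set
    E = Avoiding (d j₁) (d (next j₁)) x y
    d-edge : ∀ j → j ≢ j₁ → j ≢ j₀ → E (d j) (d (next j))
    d-edge j ≢₁ ≢₀ = proj₂ (proj₂ Cd) j , ≢₁ ∘ edge-unique G Cd , ≢₀ ∘ edge-unique G Cd
    c-walk : Star E (c i₀) (c i₁)
    c-walk = cycle-connected avoiding-sym c (λ i → proj₂ (proj₂ Cc) i , (λ s → disj (i , s) (j₁ , inj₁ (refl , refl))) ,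
      (λ s → disj (i , s) (j₀ , inj₁ (refl , refl)))) i₀ i₁
    d-walk : ∀ t → π t ≡ j₁ → Star E y (d j₁)
    d-walk zero e = ⊥-elim (j₀≢j₁ (trans (sym π-zero) e))
    d-walk (suc t) e = subst₂ (λ a b → Star E (d a) (d b)) (trans (cong π (sym (next-inject₁ {suc l} zero))) (trans (π-next zero) (cong next π-zero))) e
      (walk (d ∘ π ∘ suc) t (λ i lt → subst (λ z → E (d (π (suc (inject₁ i)))) (d z))
        (trans (sym (π-next (suc (inject₁ i)))) (cong π (next-inject₁ (suc i))))
        (d-edge (π (suc (inject₁ i)))
          (λ e' → ℕₚ.<-irrefl (trans (sym (Finₚ.toℕ-inject₁ i)) (cong toℕ (Finₚ.suc-injective (π-injective (trans e' (sym e)))))) lt)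
          (λ e' → Finₚ.0≢1+n (sym (π-injective (trans e' (sym π-zero))))))))
    -- Along `c` from `x` to the other common vertex `d j₁`, then backwards along the arc of `d` to
    -- `y`. The walk on `c` is admissible because the cycles share no edge, and the arc stops short
    -- of the edge leaving `j₁`.
    x⇝y : Star E x y
    x⇝y = subst₂ (Star E) e₀ e₁ c-walk ◅◅ reverse avoiding-sym (let (t , e) = injective⇒hits π π-injective j₁ in d-walk t e)
    avoid : E (d j₁) (d (next j₁)) ⊎ E (d (next j₁)) (d j₁) ⊎ SameEdge (d j₁) (d (next j₁)) x y → Data.Empty.⊥
    avoid (inj₁ (_ , ne , _)) = ne (inj₁ (refl , refl))
    avoid (inj₂ (inj₁ (_ , ne , _))) = ne (inj₂ (refl , refl))
    avoid (inj₂ (inj₂ s)) = j₀≢j₁ (sym (edge-unique G Cd s))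

  module TwoCycles {m l} {c : Fin (suc m) → Fin n} {d : Fin (suc l) → Fin n} (Cc : IsCycle G (suc m) c) (Cd : IsCycle G (suc l) d)
    (c≢d : ¬ SameCycle c d) (only : ∀ k (e : Fin k → Fin n) → IsCycle G k e → SameCycle e c ⊎ SameCycle e d) where

    private
      outside : ∀ {m l} (c : Fin (suc m) → Fin n) (d : Fin (suc l) → Fin n) →
        (∀ {a b} → CycEdge c a b → CycEdge d a b) ⊎ Σ _ λ i → ¬ CycEdge d (c i) (c (next i))
      outside c d with Finₚ.all? (λ i → cycEdge? d (c i) (c (next i)))
      ... | yes all = inj₁ (λ (i , s) → CycEdge-resp s (all i))
      ... | no ¬all = inj₂ (Finₚ.¬∀⟶∃¬ _ _ (λ i → cycEdge? d (c i) (c (next i))) ¬all)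

      contains : ∀ {k} {e : Fin k → Fin n} {a b} → SameCycle e c ⊎ SameCycle e d → CycEdge c a b → CycEdge d a b → CycEdge e a b
      contains (inj₁ s) ab _ = proj₂ (s _ _) ab
      contains (inj₂ s) _ ab = proj₂ (s _ _) ab

    -- Of two distinct cycles one has an edge outside the other, and this yields a cycle avoiding
    -- ab. Both of the permitted cycles contain ab, so it would be a third one.
    edge-disjoint : ∀ {a b} → CycEdge c a b → ¬ CycEdge d a b
    edge-disjoint ab∈c ab∈d with outside c d | outside d c
    ... | inj₁ c⊆d | inj₁ d⊆c = c≢d (λ _ _ → c⊆d , d⊆c)
    ... | inj₂ (i , ∉d) | _ = let (k , e , Ce , ∉e) = third-cycle-sharing-edge Cc Cd i ∉d ab∈c ab∈d in
      ∉e (contains (only k e Ce) ab∈c ab∈d)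
    ... | inj₁ _ | inj₂ (i , ∉c) = let (k , e , Ce , ∉e) = third-cycle-sharing-edge Cd Cc i ∉c ab∈d ab∈c in
      ∉e (contains (only k e Ce) ab∈c ab∈d)

    -- The cycle built from two common vertices has an edge of `d`, so it is not `c`, and misses
    -- another edge of `d`, so it is not `d`.
    one-common-vertex : ∀ {i₀ i₁ j₀ j₁} → c i₀ ≡ d j₀ → c i₁ ≡ d j₁ → j₀ ≡ j₁
    one-common-vertex {j₀ = j₀} {j₁} e₀ e₁ with j₀ ≟ j₁
    ... | yes e = e
    ... | no ne with third-cycle-sharing-vertices Cc Cd edge-disjoint e₀ e₁ ne
    ... | k , e , Ce , ∈e , ∉e with only k e Ce
    ... | inj₁ e≡c = ⊥-elim (edge-disjoint (proj₁ (e≡c _ _) ∈e) (j₀ , inj₁ (refl , refl)))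
    ... | inj₂ e≡d = ⊥-elim (∉e (proj₂ (e≡d _ _) (j₁ , inj₁ (refl , refl))))

-- Embedding the P-graph along two cycles and a path

append : ∀ {A : Set} {m k} → (Fin m → A) → (Fin k → A) → Fin (m ℕ.+ k) → A
append {m = zero} u v = v
append {m = suc m} u v zero = u zero
append {m = suc m} u v (suc i) = append (u ∘ suc) v i

module _ {A : Set} where
  append-right : ∀ {m k} (u : Fin m → A) (v : Fin k → A) i j → toℕ i ≡ m ℕ.+ toℕ j → append u v i ≡ v j
  append-right {zero} u v i j e = cong v (Finₚ.toℕ-injective e)
  append-right {suc m} u v (suc i) j e = append-right (u ∘ suc) v i j (ℕₚ.suc-injective e)

  append-all : ∀ {m k} {R : A → Set} {u : Fin m → A} {v : Fin k → A} → (∀ i → R (u i)) → (∀ j → R (v j)) → ∀ i → R (append u v i)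
  append-all {zero} ru rv i = rv i
  append-all {suc m} ru rv zero = ru zero
  append-all {suc m} {R = R} ru rv (suc i) = append-all {m} {R = R} (ru ∘ suc) rv i

  append-injective : ∀ {m k} {u : Fin m → A} {v : Fin k → A} → (∀ {i j} → u i ≡ u j → i ≡ j) → (∀ {i j} → v i ≡ v j → i ≡ j) →
    (∀ i j → u i ≢ v j) → ∀ {i j} → append u v i ≡ append u v j → i ≡ j
  append-injective {zero} iu iv ne e = iv e
  append-injective {suc m} iu iv ne {zero} {zero} e = refl
  append-injective {suc m} {u = u} iu iv ne {zero} {suc j} e =
    ⊥-elim (append-all {m} {R = u zero ≢_} (λ i e' → Finₚ.0≢1+n (iu e')) (ne zero) j e)
  append-injective {suc m} {u = u} iu iv ne {suc i} {zero} e =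
    ⊥-elim (append-all {m} {R = u zero ≢_} (λ i e' → Finₚ.0≢1+n (iu e')) (ne zero) i (sym e))
  append-injective {suc m} iu iv ne {suc i} {suc j} e = cong suc (append-injective {m} (Finₚ.suc-injective ∘ iu) iv (ne ∘ suc) e)

  -- Phrased through `toℕ`, because the type of a position changes under `append`.
  Consecutive : ∀ {k} → (A → A → Set) → (Fin k → A) → Set
  Consecutive E f = ∀ i j → toℕ j ≡ suc (toℕ i) → E (f i) (f j)

  append-consecutive : ∀ {E m k} {u : Fin m → A} {v : Fin k → A} → Consecutive E u → Consecutive E v →
    (∀ i j → suc (toℕ i) ≡ m → toℕ j ≡ 0 → E (u i) (v j)) → Consecutive E (append u v)
  append-consecutive {m = zero} cu cv br = cv
  append-consecutive {m = suc zero} cu cv br zero (suc j) e = br zero j refl (ℕₚ.suc-injective e)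
  append-consecutive {m = suc (suc m)} cu cv br zero (suc zero) e = cu zero (suc zero) refl
  append-consecutive {E} {m = suc m} cu cv br (suc i) (suc j) e =
    append-consecutive {E} {m} (λ i j e → cu (suc i) (suc j) (cong suc e)) cv (λ i j e → br (suc i) j (cong suc e)) i j (ℕₚ.suc-injective e)

  append-first : ∀ {s l} (z : Fin (suc s) → A) (v : Fin (suc l) → A) → v zero ≡ z (fromℕ s) →
    ∀ j → toℕ j ≡ 0 → append (z ∘ inject₁) v j ≡ z zero
  append-first {zero} z v e zero _ = e
  append-first {suc s} z v e zero _ = refl

module _ {n} (G : Graph n) where
  Adj : Fin n → Fin n → Set
  Adj u v = G u v ≡ true

On : ∀ {n k} → (Fin k → Fin n) → Fin n → Set
On c u = Σ _ λ i → c i ≡ u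

-- The path meets the cycles only in its ends; it is a single vertex when the cycles meet.
record Link {n} (G : Graph n) {k l} (c : Fin k → Fin n) (d : Fin l → Fin n) : Set where
  field
    {start} : Fin n
    path : SimplePath (Adj G) (On c) (On d) start
    start-on : On c start
    common : ∀ {i j} → c i ≡ d j → c i ≡ start

module _ {n} {G : Graph n} (connected : Connected G) where

  Reach⇒Star : ∀ {u v} → Reach G u v → Star (Adj G) u v
  Reach⇒Star here = ε
  Reach⇒Star (step e r) = e ◅ Reach⇒Star r

  link : ∀ {m l} {c : Fin (suc m) → Fin n} {d : Fin (suc l) → Fin n} →
    (∀ {i₀ i₁ j₀ j₁} → c i₀ ≡ d j₀ → c i₁ ≡ d j₁ → j₀ ≡ j₁) → Link G c d
  link {c = c} {d} one-common with Finₚ.any? (λ i → Finₚ.any? (λ j → c i ≟ d j))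
  ... | yes (i , j , e) = record { path = trivial-path (j , sym e) ; start-on = i , refl
                                 ; common = λ e' → trans e' (trans (cong d (one-common e' e)) (sym e)) }
  ... | no disjoint with simple-path {P = On c} {Q = On d} (λ x → Finₚ.any? (λ i → c i ≟ x)) (λ x → Finₚ.any? (λ j → d j ≟ x))
                           (Reach⇒Star (connected (c zero) (d zero))) (zero , refl)
  ... | x' , s , o = record { path = s ; start-on = on o ; common = λ e → ⊥-elim (disjoint (_ , _ , e)) }
    where
    on : x' ≡ c zero ⊎ On c x' → On c x'
    on (inj₁ e) = zero , sym e
    on (inj₂ p) = p

module Embedding {n} {G : Graph n} (G-sym : ∀ u v → G u v ≡ G v u)
  {m l} {c : Fin (suc m) → Fin n} {d : Fin (suc l) → Fin n} (Cc : IsCycle G (suc m) c) (Cd : IsCycle G (suc l) d)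
  (L : Link G c d) where

  open Link L
  open SimplePath path renaming (len to s)

  private
    module Rc = Rotation (rotation (next (proj₁ start-on)))
    module Rd = Rotation (rotation (proj₁ z-end))

  A : Fin n → Fin n → Set
  A = Adj G

  c' : Fin (suc m) → Fin n
  c' = c ∘ Rc.π
  d' : Fin (suc l) → Fin n
  d' = d ∘ Rd.π

  c'-injective : ∀ {i j} → c' i ≡ c' j → i ≡ j
  c'-injective e = Rc.π-injective (proj₁ (proj₂ Cc) e)
  d'-injective : ∀ {i j} → d' i ≡ d' j → i ≡ j
  d'-injective e = Rd.π-injective (proj₁ (proj₂ Cd) e)

  c'-adj : ∀ i → A (c' i) (c' (next i))
  c'-adj i = subst (λ a → A (c' i) (c a)) (sym (Rc.π-next i)) (proj₂ (proj₂ Cc) (Rc.π i))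
  d'-adj : ∀ i → A (d' i) (d' (next i))
  d'-adj i = subst (λ a → A (d' i) (d a)) (sym (Rd.π-next i)) (proj₂ (proj₂ Cd) (Rd.π i))

  c'-last : c' (fromℕ m) ≡ z zero
  c'-last = trans (cong c (next-injective (trans (sym (Rc.π-next (fromℕ m))) (trans (cong Rc.π (next-fromℕ m)) Rc.π-zero))))
    (trans (proj₂ start-on) (sym z-start))

  d'-zero : d' zero ≡ z (fromℕ s)
  d'-zero = trans (cong d Rd.π-zero) (proj₂ z-end)

  tail : Fin (s ℕ.+ suc l) → Fin n
  tail = append (z ∘ inject₁) d'

  -- The first cycle is rotated to end where the path starts, the second to begin where it ends.
  -- Dropping the last vertex of `c'` and of the path keeps the junctions from being listed twice.
  -- So the cycles occupy 0, ..., m and m + s, ..., m + s + l, as in the P-graph.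
  φ : Fin (m ℕ.+ (s ℕ.+ suc l)) → Fin n
  φ = append (c' ∘ inject₁) tail

  c'≢z0 : ∀ i → c' (inject₁ i) ≢ z zero
  c'≢z0 i e = Finₚ.fromℕ≢inject₁ (c'-injective (trans c'-last (sym e)))

  tail-injective : ∀ {i j} → tail i ≡ tail j → i ≡ j
  tail-injective = append-injective (Finₚ.inject₁-injective ∘ z-injective) d'-injective
    (λ i j e → z-¬Q i (Rd.π j , sym e))

  -- The start of the path is the only vertex that `c` can share with the path or with `d`, and
  -- `inject₁` has removed it from `c'`.
  φ-injective : ∀ {i j} → φ i ≡ φ j → i ≡ j
  φ-injective = append-injective (Finₚ.inject₁-injective ∘ c'-injective) tail-injective
    (λ i → append-all {R = c' (inject₁ i) ≢_} (c≢z i) (λ j e → c'≢z0 i (trans (common e) (sym z-start))))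
    where
    c≢z : ∀ i t → c' (inject₁ i) ≢ z (inject₁ t)
    c≢z i t = go z z-¬P t (c'≢z0 i)
      where
      go : ∀ {k} (z : Fin (suc k) → Fin n) → (∀ (i : Fin k) → ¬ On c (z (suc i))) → ∀ (t : Fin k) →
        c' (inject₁ i) ≢ z zero → c' (inject₁ i) ≢ z (inject₁ t)
      go z ¬on zero ≢z0 = ≢z0
      go z ¬on (suc t) _ e = ¬on (inject₁ t) (_ , e)

  cycle-consecutive : ∀ {k} (e : Fin (suc k) → Fin n) → (∀ i → A (e i) (e (next i))) → Consecutive A e
  cycle-consecutive e adj i j eq with toℕ-next i
  ... | inj₁ (_ , q) = subst (λ a → A (e i) (e a)) (Finₚ.toℕ-injective (trans q (sym eq))) (adj i)
  ... | inj₂ (i≡k , _) = ⊥-elim (ℕₚ.<-irrefl (trans eq (cong suc i≡k)) (Finₚ.toℕ<n j))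

  path-consecutive : ∀ {k} (f : Fin (suc k) → Fin n) → (∀ (i : Fin k) → A (f (inject₁ i)) (f (suc i))) → Consecutive A (f ∘ inject₁)
  path-consecutive f adj i j e = subst (λ a → A (f (inject₁ i)) (f a)) (Finₚ.toℕ-injective (trans (sym e) (sym (Finₚ.toℕ-inject₁ j)))) (adj i)

  last-adj : ∀ {k} (f : Fin (suc k) → Fin n) → (∀ (i : Fin k) → A (f (inject₁ i)) (f (suc i))) → ∀ i {v} → suc (toℕ i) ≡ k → v ≡ f (fromℕ k) → A (f (inject₁ i)) v
  last-adj {k} f adj i e refl = subst (λ a → A (f (inject₁ i)) (f a)) (Finₚ.toℕ-injective (trans e (sym (Finₚ.toℕ-fromℕ k)))) (adj i)

  c'-path : ∀ (i : Fin m) → A (c' (inject₁ i)) (c' (suc i))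
  c'-path i = subst (λ a → A (c' (inject₁ i)) (c' a)) (next-inject₁ i) (c'-adj (inject₁ i))

  tail-first : ∀ j → toℕ j ≡ 0 → tail j ≡ z zero
  tail-first = append-first z d' d'-zero

  φ-consecutive : Consecutive A φ
  φ-consecutive = append-consecutive {E = A} (path-consecutive c' c'-path)
    (append-consecutive {E = A} (path-consecutive z z-adj) (cycle-consecutive d' d'-adj)
      (λ { i zero e _ → last-adj z z-adj i e d'-zero }))
    (λ i j e j≡0 → last-adj c' c'-path i e (trans (tail-first j j≡0) (sym c'-last)))

  φ-zero : 0 ℕ.< m → ∀ i → toℕ i ≡ 0 → φ i ≡ c' zero
  φ-zero = go c' tail
    where
    go : ∀ {m k} (f : Fin (suc m) → Fin n) (v : Fin k → Fin n) → 0 ℕ.< m → ∀ i → toℕ i ≡ 0 → append (f ∘ inject₁) v i ≡ f zero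
    go {suc m} f v _ zero _ = refl

  φ-m : ∀ i → toℕ i ≡ m → φ i ≡ z zero
  φ-m i e = trans (append-right (c' ∘ inject₁) tail i j₀ (trans e (trans (sym (ℕₚ.+-identityʳ m)) (cong (m ℕ.+_) (sym j₀≡0))))) (tail-first j₀ j₀≡0)
    where
    0<tail : 0 ℕ.< s ℕ.+ suc l
    0<tail = ℕₚ.≤-trans (ℕ.s≤s ℕ.z≤n) (ℕₚ.m≤n+m (suc l) s)
    j₀ : Fin (s ℕ.+ suc l)
    j₀ = Data.Fin.fromℕ< 0<tail
    j₀≡0 : toℕ j₀ ≡ 0
    j₀≡0 = Finₚ.toℕ-fromℕ< 0<tail

  φ-d' : ∀ i j → toℕ i ≡ m ℕ.+ s ℕ.+ toℕ j → φ i ≡ d' j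
  φ-d' i j e = trans (append-right (c' ∘ inject₁) tail i (s ↑ʳ j) (trans e (trans (ℕₚ.+-assoc m s (toℕ j)) (cong (m ℕ.+_) (sym (Finₚ.toℕ-↑ʳ s j))))))
    (append-right (z ∘ inject₁) d' (s ↑ʳ j) j (Finₚ.toℕ-↑ʳ s j))

  close-c : 0 ℕ.< m → ∀ i j → toℕ i ≡ 0 × toℕ j ≡ m → A (φ j) (φ i)
  close-c 0<m i j (e , e') = subst₂ A (trans c'-last (sym (φ-m j e'))) (trans (cong c' (next-fromℕ m)) (sym (φ-zero 0<m i e))) (c'-adj (fromℕ m))
  close-d : ∀ i j → toℕ i ≡ m ℕ.+ s × toℕ j ≡ m ℕ.+ s ℕ.+ l → A (φ j) (φ i)
  close-d i j (e , e') = subst₂ A (sym (φ-d' j (fromℕ l) (trans e' (cong (m ℕ.+ s ℕ.+_) (sym (Finₚ.toℕ-fromℕ l))))))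
    (trans (cong d' (next-fromℕ l)) (sym (φ-d' i zero (trans e (sym (ℕₚ.+-identityʳ (m ℕ.+ s))))))) (d'-adj (fromℕ l))

  -- Only this direction is read off from the cycles and the path. That the image has no further
  -- edges follows later from the edge count, in `core-≡`.
  φ-Pbool : 0 ℕ.< m → ∀ i j → Pbool m (m ℕ.+ s) (m ℕ.+ s ℕ.+ l) (toℕ i) (toℕ j) ≡ true → G (φ i) (φ j) ≡ true
  φ-Pbool 0<m i j t with ∨-true t
  ... | inj₁ t₁ = φ-consecutive i j (≡ᵇ-true t₁)
  ... | inj₂ t with ∨-true t
  ... | inj₁ t₂ = trans (G-sym _ _) (φ-consecutive j i (≡ᵇ-true t₂))
  ... | inj₂ t with ∨-true t
  ... | inj₁ t₃ = trans (G-sym _ _) (close-c 0<m i j (≡ᵇ∧-true t₃))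
  ... | inj₂ t with ∨-true t
  ... | inj₁ t₄ = close-c 0<m j i (≡ᵇ∧-true t₄)
  ... | inj₂ t with ∨-true t
  ... | inj₁ t₅ = trans (G-sym _ _) (close-d i j (≡ᵇ∧-true t₅))
  ... | inj₂ t₆ = close-d j i (≡ᵇ∧-true t₆)

-- Growing the core by counting edges

∑-nonneg : ∀ {n} {f : Fin n → ℚ} → (∀ i → 0ℚ ≤ f i) → 0ℚ ≤ ∑ f
∑-nonneg {zero} h = ℚₚ.≤-reflexive (sym (∑-[] _))
∑-nonneg {suc n} h = ℚₚ.≤-trans (+-nonneg (h zero) (∑-nonneg (h ∘ suc))) (ℚₚ.≤-reflexive (sym (∑-suc _)))

∑-term : ∀ {n} {f : Fin n → ℚ} → (∀ i → 0ℚ ≤ f i) → ∀ i → f i ≤ ∑ f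
∑-term {suc n} {f} h zero = ≤-offset (∑ (f ∘ suc)) (∑-nonneg (h ∘ suc)) (∑-suc f)
∑-term {suc n} {f} h (suc i) = ℚₚ.≤-trans (∑-term (h ∘ suc) i) (≤-offset (f zero) (h zero) (trans (∑-suc f) (ℚₚ.+-comm (f zero) _)))

diff-nonneg : ∀ {a b} → a ≤ b → 0ℚ ≤ b - a
diff-nonneg {a} {b} le = ℚₚ.≤-trans (ℚₚ.≤-reflexive (sym (ℚₚ.+-inverseʳ a))) (ℚₚ.+-monoˡ-≤ (- a) le)

∑-mono : ∀ {n} {f g : Fin n → ℚ} → (∀ i → f i ≤ g i) → ∑ f ≤ ∑ g
∑-mono {f = f} {g} h = ≤-offset (∑ (λ i → g i - f i)) (∑-nonneg (λ i → diff-nonneg (h i)))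
  (trans (solve 2 (λ f g → g := f :+ (g :- f)) refl (∑ f) (∑ g)) (cong (∑ f +_) (sym (∑-- g f))))

-- The differences are nonnegative and their sum is at most 0, so each of them vanishes. This is
-- what turns a count into structure: it yields both the absence of chords and the uniqueness of a
-- leaf's neighbour.
∑-tight : ∀ {n} {f g : Fin n → ℚ} → (∀ i → f i ≤ g i) → ∑ g ≤ ∑ f → ∀ i → f i ≡ g i
∑-tight {f = f} {g} h le i = ℚₚ.≤-antisym (h i) (ℚₚ.≤-trans (ℚₚ.≤-reflexive (solve 2 (λ f g → g := f :+ (g :- f)) refl (f i) (g i)))
  (ℚₚ.≤-trans (ℚₚ.+-monoʳ-≤ (f i) (ℚₚ.≤-trans (∑-term (λ j → diff-nonneg (h j)) i)
      (ℚₚ.≤-trans (ℚₚ.≤-reflexive (∑-- g f)) (ℚₚ.≤-trans (ℚₚ.+-monoˡ-≤ (- ∑ f) le) (ℚₚ.≤-reflexive (ℚₚ.+-inverseʳ (∑ f)))))))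
    (ℚₚ.≤-reflexive (ℚₚ.+-identityʳ (f i)))))

ite-nonneg : ∀ b → 0ℚ ≤ ite b
ite-nonneg true = ℚₚ.nonNegative⁻¹ 1ℚ
ite-nonneg false = ℚₚ.≤-refl

ite-injective : ∀ {a b} → ite a ≡ ite b → a ≡ b
ite-injective {true} {true} _ = refl
ite-injective {false} {false} _ = refl

ite-mono : ∀ {a b} → (a ≡ true → b ≡ true) → ite a ≤ ite b
ite-mono {true} {true} _ = ℚₚ.≤-refl
ite-mono {true} {false} h with h refl
... | ()
ite-mono {false} {b} _ = ite-nonneg b

pull : ∀ {n k} → Graph n → (Fin k → Fin n) → Graph k
pull G e u v = G (e u) (e v)

handshake : ∀ {n} {G : Graph n} → IsSimple G → Tsum (adjQ G) ≡ 2ℚ * fromℕℚ (edgeCount G)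
handshake {n} {G} (G-sym , G-irrefl) = begin
  Tsum (adjQ G) ≡⟨ ∑-cong (λ u → trans (∑-cong (λ v → split u v)) (∑-+ _ _)) ⟩
  ∑ (λ u → ∑ (λ v → up u v) + ∑ (λ v → up v u)) ≡⟨ ∑-+ _ _ ⟩
  ∑ (λ u → ∑ (up u)) + ∑ (λ u → ∑ (λ v → up v u)) ≡⟨ cong (∑ (λ u → ∑ (up u)) +_) (∑-comm (λ u v → up v u)) ⟩
  ∑ (λ u → ∑ (up u)) + ∑ (λ u → ∑ (up u)) ≡⟨ solve 1 (λ x → x :+ x := con 2ℚ :* x) refl (∑ (λ u → ∑ (up u))) ⟩
  2ℚ * ∑ (λ u → ∑ (up u)) ≡⟨ cong (2ℚ *_) (sym (trans (fromℕℚ-sum _) (∑-cong (λ u → trans (fromℕℚ-sum _) (∑-cong (λ v → b2ℕ-ite _)))))) ⟩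
  2ℚ * fromℕℚ (edgeCount G) ∎
  where
  up : Fin n → Fin n → ℚ
  up u v = ite (⌊ toℕ u ℕ.<? toℕ v ⌋ ∧ G u v)
  split : ∀ u v → ite (G u v) ≡ up u v + up v u
  split u v with toℕ u ℕ.<? toℕ v | toℕ v ℕ.<? toℕ u
  ... | yes u<v | yes v<u = ⊥-elim (ℕₚ.<-asym u<v v<u)
  ... | yes _ | no _ = sym (ℚₚ.+-identityʳ (ite (G u v)))
  ... | no _ | yes _ = trans (cong ite (G-sym u v)) (sym (ℚₚ.+-identityˡ (ite (G v u))))
  ... | no u≮v | no v≮u with Finₚ.toℕ-injective (ℕₚ.≤-antisym (ℕₚ.≮⇒≥ v≮u) (ℕₚ.≮⇒≥ u≮v))
  ... | refl = cong ite (G-irrefl u)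

Grown-trans : ∀ {a b c} {F : Graph a} {G : Graph b} {H : Graph c} → Grown F G → Grown G H → Grown F H
Grown-trans g done = g
Grown-trans g (leaf h ext) = leaf (Grown-trans g h) ext

to-permutation : ∀ {k n} (e : Fin k → Fin n) → (∀ {i j} → e i ≡ e j → i ≡ j) → (∀ y → Σ _ λ i → e i ≡ y) → Perm.Permutation k n
to-permutation e inj hit = Perm.permutation e (proj₁ ∘ hit) (λ y → proj₂ (hit y)) (λ i → inj (proj₂ (hit (e i))))

T-permute : ∀ {k n} (G : Graph n) (π : Perm.Permutation k n) → Tsum (adjQ (pull G (π Perm.⟨$⟩ʳ_))) ≡ Tsum (adjQ G)
T-permute G π = trans (∑-cong (λ u → sym (∑-permute (adjQ G (π Perm.⟨$⟩ʳ u)) π))) (sym (∑-permute (degM (adjQ G)) π))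

module Growth {n} {G : Graph n} (simple : IsSimple G) (connected : Connected G) (T≡ : Tsum (adjQ G) ≡ 2ℚ * (fromℕℚ n + 1ℚ)) where

  cons : ∀ {k} → Fin n → (Fin k → Fin n) → Fin (suc k) → Fin n
  cons x e zero = x
  cons x e (suc i) = e i

  neighbours : ∀ {k} → Fin n → (Fin k → Fin n) → ℚ
  neighbours x e = ∑ (λ i → ite (G x (e i)))

  T-cons : ∀ {k} x (e : Fin k → Fin n) → Tsum (adjQ (pull G (cons x e))) ≡ Tsum (adjQ (pull G e)) + 2ℚ * neighbours x e
  T-cons x e = begin
    Tsum (adjQ (pull G (cons x e))) ≡⟨ ∑-suc _ ⟩
    degM (adjQ (pull G (cons x e))) zero + ∑ (λ u → degM (adjQ (pull G (cons x e))) (suc u))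
      ≡⟨ cong₂ _+_ (∑-suc _) (trans (∑-cong (λ u → ∑-suc _)) (∑-+ _ _)) ⟩
    ite (G x x) + N + (∑ (λ u → ite (G (e u) x)) + T)
      ≡⟨ cong₂ (λ a b → ite a + N + (b + T)) (proj₂ simple x) (∑-cong (λ u → cong ite (proj₁ simple (e u) x))) ⟩
    0ℚ + N + (N + T) ≡⟨ solve 2 (λ N T → con 0ℚ :+ N :+ (N :+ T) := T :+ con 2ℚ :* N) refl N T ⟩
    T + 2ℚ * N ∎
    where
    N T : ℚ
    N = neighbours x e
    T = Tsum (adjQ (pull G e))

  Exit : ∀ {k} → (Fin k → Fin n) → Set
  Exit {k} e = Σ (Fin k) λ i → Σ (Fin n) λ x → G x (e i) ≡ true × ¬ On e x

  exit : ∀ {k} (e : Fin k → Fin n) {u v} → Reach G u v → On e u → ¬ On e v → Exit e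
  exit e here on ¬on = ⊥-elim (¬on on)
  exit e (step {u} {w} g r) (i , refl) ¬on with Finₚ.any? (λ j → e j ≟ w)
  ... | yes on-w = exit e r on-w ¬on
  ... | no ¬on-w = i , w , trans (proj₁ simple w u) g , ¬on-w

  cons-injective : ∀ {k x} {e : Fin k → Fin n} → (∀ {i j} → e i ≡ e j → i ≡ j) → ¬ On e x → ∀ {i j} → cons x e i ≡ cons x e j → i ≡ j
  cons-injective inj ¬on {zero} {zero} _ = refl
  cons-injective inj ¬on {zero} {suc j} p = ⊥-elim (¬on (j , sym p))
  cons-injective inj ¬on {suc i} {zero} p = ⊥-elim (¬on (i , p))
  cons-injective inj ¬on {suc i} {suc j} p = cong suc (inj p)

  -- The indicator of `i` lies below the adjacency row of `x` and has sum 1, while the row has sum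
  -- at most 1; hence they coincide.
  attached : ∀ {k x} {e : Fin k → Fin n} i → G x (e i) ≡ true → neighbours x e ≤ 1ℚ → IsLeafExt (pull G e) i (pull G (cons x e))
  attached {x = x} {e} i g N≤1 = record
    { old-old = λ _ _ → refl ; new-new = proj₂ simple x
    ; new-old = λ u → sym (ite-injective (only u))
    ; old-new = λ u → trans (proj₁ simple (e u) x) (sym (ite-injective (only u))) }
    where
    indic-≤ : ∀ u → indic i u ≤ ite (G x (e u))
    indic-≤ u with i ≟ u
    ... | yes refl = ℚₚ.≤-reflexive (cong ite (sym g))
    ... | no _ = ite-nonneg (G x (e u))
    ∑-indic-1 : ∑ (indic i) ≡ 1ℚ
    ∑-indic-1 = trans (∑-cong (λ u → sym (ℚₚ.*-identityˡ (indic i u)))) (∑-indic (λ _ → 1ℚ) i)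
    only : ∀ u → indic i u ≡ ite (G x (e u))
    only = ∑-tight indic-≤ (ℚₚ.≤-trans N≤1 (ℚₚ.≤-reflexive (sym ∑-indic-1)))

  record Exhausted {k} (e : Fin k → Fin n) : Set where
    field
      T-eq : Tsum (adjQ (pull G e)) ≡ 2ℚ * (fromℕℚ k + 1ℚ)
      π : Perm.Permutation n n
      grown : Grown (pull G e) (pull G (π Perm.⟨$⟩ʳ_))

  -- Every added vertex brings at least one edge, so the edge count forces all additions to be pendant.
  exhaust : ∀ fuel {k} (e : Fin (suc k) → Fin n) → (∀ {i j} → e i ≡ e j → i ≡ j) → n ℕ.≤ suc k ℕ.+ fuel →
    2ℚ * (fromℕℚ (suc k) + 1ℚ) ≤ Tsum (adjQ (pull G e)) → Exhausted e
  exhaust fuel {k} e inj n≤ T≥ with Finₚ.all? (λ y → Finₚ.any? (λ i → e i ≟ y))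
  ... | yes hit = full (Perm.↔⇒≡ π) π refl
    where
    π : Perm.Permutation (suc k) n
    π = to-permutation e inj hit
    full : suc k ≡ n → (π : Perm.Permutation (suc k) n) → (π Perm.⟨$⟩ʳ_) ≡ e → Exhausted e
    full refl π refl = record { T-eq = trans (T-permute G π) T≡ ; π = π ; grown = done }
  ... | no ¬hit with Finₚ.¬∀⟶∃¬ n _ (λ y → Finₚ.any? (λ i → e i ≟ y)) ¬hit
  ... | y , ¬on-y with exit e (connected (e zero) y) (zero , refl) ¬on-y
  -- Without fuel `e` already has at least `n` distinct values, so a further one contradicts
  -- injectivity.
  exhaust zero {k} e inj n≤ T≥ | no _ | y , _ | i , x , g , ¬on =
    ⊥-elim (ℕₚ.<-irrefl refl (ℕₚ.≤-trans (Finₚ.injective⇒≤ (λ {a} {b} → cons-injective inj ¬on {a} {b})) (subst (n ℕ.≤_) (ℕₚ.+-identityʳ (suc k)) n≤)))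
  exhaust (suc fuel) {k} e inj n≤ T≥ | no _ | y , _ | i , x , g , ¬on = record
    { T-eq = ℚₚ.≤-antisym T≤ T≥ ; π = E.π ; grown = Grown-trans (leaf done (attached i g N≤1)) E.grown }
    where
    N T K : ℚ
    N = neighbours x e
    T = Tsum (adjQ (pull G e))
    K = fromℕℚ (suc k)
    1≤N : 1ℚ ≤ N
    1≤N = ℚₚ.≤-trans (ℚₚ.≤-reflexive (cong ite (sym g))) (∑-term (λ j → ite-nonneg (G x (e j))) i)
    2·mono : ∀ {a b} → a ≤ b → 2ℚ * a ≤ 2ℚ * b
    2·mono = *-monoˡ-nonneg 2ℚ (ℚₚ.nonNegative⁻¹ 2ℚ)
    shift : 2ℚ * (fromℕℚ (suc (suc k)) + 1ℚ) ≡ 2ℚ * (K + 1ℚ) + 2ℚ * 1ℚ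
    shift = trans (cong (λ z → 2ℚ * (z + 1ℚ)) (fromℕℚ-suc (suc k))) (solve 1 (λ K → con 2ℚ :* (con 1ℚ :+ K :+ con 1ℚ) := con 2ℚ :* (K :+ con 1ℚ) :+ con 2ℚ :* con 1ℚ) refl K)
    module E = Exhausted (exhaust fuel (cons x e) (cons-injective inj ¬on) (subst (n ℕ.≤_) (ℕₚ.+-suc (suc k) fuel) n≤)
      (ℚₚ.≤-trans (ℚₚ.≤-reflexive shift) (ℚₚ.≤-trans (ℚₚ.+-mono-≤ T≥ (2·mono 1≤N)) (ℚₚ.≤-reflexive (sym (T-cons x e))))))
    -- The recursion carries the lower bound upwards and brings back the exact count for the larger
    -- set. Since `T` and `N` satisfy lower bounds that add up to this count, both bounds are
    -- attained.
    total : T + 2ℚ * N ≡ 2ℚ * (K + 1ℚ) + 2ℚ * 1ℚ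
    total = trans (sym (T-cons x e)) (trans E.T-eq shift)
    T≤ : T ≤ 2ℚ * (K + 1ℚ)
    T≤ = ≤-offset (2ℚ * N - 2ℚ * 1ℚ) (diff-nonneg (2·mono 1≤N))
      (trans (solve 2 (λ s t → s := s :+ t :- t) refl (2ℚ * (K + 1ℚ)) (2ℚ * 1ℚ)) (trans (cong (_- 2ℚ * 1ℚ) (sym total))
        (ℚₚ.+-assoc T (2ℚ * N) (- (2ℚ * 1ℚ)))))
    N≤1 : N ≤ 1ℚ
    N≤1 = ≤-offset (½ * (T - 2ℚ * (K + 1ℚ))) (*-nonneg (ℚₚ.nonNegative⁻¹ ½) (diff-nonneg T≥))
      (trans (solve 2 (λ s N → con 1ℚ := con ½ :* (s :+ con 2ℚ :* con 1ℚ) :- con ½ :* s) refl (2ℚ * (K + 1ℚ)) N)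
        (trans (cong (λ z → ½ * z - ½ * (2ℚ * (K + 1ℚ))) (sym total))
          (solve 3 (λ T N s → con ½ :* (T :+ con 2ℚ :* N) :- con ½ :* s := N :+ con ½ :* (T :- s)) refl T N (2ℚ * (K + 1ℚ)))))

-- Transfer to the given graph and the final comparison

module ℕS = Data.Nat.Solver.+-*-Solver
-- Resistances are unique and the sum ignores the numbering, so any resistance function of `G` gives
-- the value computed for the assembled network.
permuted-D : ∀ {n} {G : Graph n} → (∀ u v → G u v ≡ G v u) → (π : Perm.Permutation n n) (net : Net n) →
  (∀ u v → Net.A net u v ≡ adjQ (pull G (π Perm.⟨$⟩ʳ_)) u v) → ∀ {r} → IsResistance G r → DR G r ≡ Net.D net
permuted-D {G = G} G-sym π net adj {r} R = begin
  DR G r ≡⟨ DR-Dsum G r (res-sym {A = adjQ G} A-sym RM) (res-diag {A = adjQ G} RM) ⟩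
  Dsum (adjQ G) r ≡⟨ sym (Dsum-permute (adjQ G) r π) ⟩
  Dsum (adjQ (pull G f)) (λ u v → r (f u) (f v))
    ≡⟨ Dsum-cong (λ u v → sym (adj u v)) (res-unique {A = adjQ (pull G f)} (λ u v → A-sym (f u) (f v)) (ResM-permute {A = adjQ G} π RM)
           (ResM-cong {A = Net.A net} {adjQ (pull G f)} adj (Net.is-res net))) ⟩
  Net.D net ∎
  where
  f : Fin _ → Fin _
  f = π Perm.⟨$⟩ʳ_
  RM : ResM (adjQ G) r
  RM = to-ResM R
  A-sym : Symm (adjQ G)
  A-sym u v = cong ite (G-sym u v)

permuted-resistance : ∀ {n} {G : Graph n} (π : Perm.Permutation n n) (net : Net n) →
  (∀ u v → Net.A net u v ≡ adjQ (pull G (π Perm.⟨$⟩ʳ_)) u v) → Σ _ (IsResistance G)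
permuted-resistance {G = G} π net adj = _ , from-ResM (ResM-cong {A = λ u v → ite (G (f (g u)) (f (g v)))} {adjQ G}
  (λ u v → cong₂ (λ a b → ite (G a b)) (Perm.inverseʳ π) (Perm.inverseʳ π))
  (ResM-permute {A = adjQ (pull G f)} (Perm.flip π) (ResM-cong {A = Net.A net} {adjQ (pull G f)} adj (Net.is-res net))))
  where
  f g : Fin _ → Fin _
  f = π Perm.⟨$⟩ʳ_
  g = π Perm.⟨$⟩ˡ_

-- `H` is a family over all orders so that the equation of the two orders can be eliminated.
iso-of-embedding : ∀ {k n} → k ≡ n → (G : Graph n) (H : ∀ k → Graph k) (e : Fin k → Fin n) → (∀ {i j} → e i ≡ e j → i ≡ j) →
  (∀ u v → H k u v ≡ G (e u) (e v)) → Iso G (H n)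
iso-of-embedding refl G H e inj adj = f ,
  ((λ {x} {y} p → trans (sym (e∘f x)) (trans (cong e p) (e∘f y))) , (λ y → e y , λ { refl → inj (e∘f (e y)) })) ,
  (λ u v → trans (sym (cong₂ G (e∘f u) (e∘f v))) (sym (adj (f u) (f v))))
  where
  f : Fin _ → Fin _
  f y = proj₁ (injective⇒hits e inj y)
  e∘f : ∀ y → e (f y) ≡ y
  e∘f y = proj₂ (injective⇒hits e inj y)

module Main (μ ν : ℕ) {n : ℕ} {G : Graph n} (simple : IsSimple G) (connected : Connected G) (edges : edgeCount G ≡ suc n)
  (cycles : ExactlyTwoCycles G (suc (suc (suc μ))) (suc (suc (suc ν)))) where

  open Family μ ν using (p'; q'; P; Q; 2≤p')
  open Bicyclic μ ν using (DP; Stage)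
  open PathOfCycles μ ν

  p q : ℕ
  p = suc p'
  q = suc q'

  c : Fin p → Fin n
  c = proj₁ cycles
  d : Fin q → Fin n
  d = proj₁ (proj₂ cycles)
  c-cycle : IsCycle G p c
  c-cycle = proj₁ (proj₂ (proj₂ cycles))
  d-cycle : IsCycle G q d
  d-cycle = proj₁ (proj₂ (proj₂ (proj₂ cycles)))

  open TwoCycles (proj₁ simple) c-cycle d-cycle (proj₁ (proj₂ (proj₂ (proj₂ (proj₂ cycles))))) (proj₂ (proj₂ (proj₂ (proj₂ (proj₂ cycles)))))

  L : Link G c d
  L = link connected one-common-vertex

  open Embedding (proj₁ simple) c-cycle d-cycle L using (φ; φ-injective; φ-Pbool)

  s₀ n₀ : ℕ
  s₀ = SimplePath.len (Link.path L)
  n₀ = p' ℕ.+ (s₀ ℕ.+ suc q')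

  n₀≡ : n₀ ≡ p' ℕ.+ (s₀ ℕ.+ (q' ℕ.+ 1))
  n₀≡ = cong (λ z → p' ℕ.+ (s₀ ℕ.+ z)) (ℕₚ.+-comm 1 q')

  core : Σ (GraphStage s₀ (Pgraph n₀ p q)) λ gs → Net.D (GraphStage.net gs) ≡ DP s₀
  core = Pgraph-stage n₀ p q s₀ refl refl n₀≡

  module C = GraphStage (proj₁ core)

  core-T : Tsum (adjQ (Pgraph n₀ p q)) ≡ 2ℚ * (fromℕℚ n₀ + 1ℚ)
  core-T = begin
    Tsum (adjQ (Pgraph n₀ p q)) ≡⟨ ∑-cong (λ u → ∑-cong (λ v → sym (C.adj u v))) ⟩
    Net.T C.net ≡⟨ Stage.T-eq C.stage ⟩
    2ℚ * (P + Q + fromℕℚ s₀) ≡⟨ cong (2ℚ *_) (solve 1 (λ x → x := x :- con 1ℚ :+ con 1ℚ) refl (P + Q + fromℕℚ s₀)) ⟩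
    2ℚ * (P + Q + fromℕℚ s₀ - 1ℚ + 1ℚ) ≡⟨ cong (λ z → 2ℚ * (z + 1ℚ)) (sym (Stage.K-eq C.stage)) ⟩
    2ℚ * (fromℕℚ n₀ + 1ℚ) ∎

  core-⊆ : ∀ u v → adjQ (Pgraph n₀ p q) u v ≤ adjQ (pull G φ) u v
  core-⊆ u v = ite-mono (λ t → φ-Pbool (ℕ.s≤s ℕ.z≤n) u v (trans (sym (Pgraph-Pbool n₀ p q s₀ refl refl n₀≡ u v)) t))

  T≡ : Tsum (adjQ G) ≡ 2ℚ * (fromℕℚ n + 1ℚ)
  T≡ = trans (handshake simple) (cong (2ℚ *_) (trans (cong fromℕℚ edges) (trans (fromℕℚ-suc n) (ℚₚ.+-comm 1ℚ (fromℕℚ n)))))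

  open Growth simple connected T≡ using (Exhausted; exhaust)

  module Ex = Exhausted (exhaust n φ φ-injective (ℕₚ.m≤n+m n n₀)
    (ℚₚ.≤-trans (ℚₚ.≤-reflexive (sym core-T)) (∑-mono (λ u → ∑-mono (core-⊆ u)))))

  -- The image of the core has no chord: entries are compared by `core-⊆`, the totals agree by the
  -- exhausted edge count, and `∑-tight` is applied first to the rows and then inside each row.
  core-≡ : ∀ u v → adjQ (Pgraph n₀ p q) u v ≡ adjQ (pull G φ) u v
  core-≡ u = ∑-tight (core-⊆ u) (ℚₚ.≤-reflexive (sym (∑-tight (λ u → ∑-mono (core-⊆ u))
    (ℚₚ.≤-reflexive (trans Ex.T-eq (sym core-T))) u)))

  final : GrownStage μ ν s₀ n₀ (pull G (Ex.π Perm.⟨$⟩ʳ_))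
  final = grown-stage μ ν {s₀} (record { net = C.net ; adj = λ u v → trans (C.adj u v) (core-≡ u v) ; stage = C.stage }) (proj₂ core) Ex.grown

  open GrownStage final renaming (index to s)
  module F = GraphStage graph-stage

  -- The leaves raise the order and the index equally, so `s` is also the length of the joining path
  -- in the P-graph of order `n`; both graphs are compared with the same `DP s`.
  n≡ : n ≡ p' ℕ.+ (s ℕ.+ (q' ℕ.+ 1))
  n≡ = ℕₚ.+-cancelʳ-≡ s₀ n _ (trans size
    (ℕS.solve 4 (λ a b c d → a ℕS.:+ (b ℕS.:+ (ℕS.con 1 ℕS.:+ c)) ℕS.:+ d ℕS.:= a ℕS.:+ (d ℕS.:+ (c ℕS.:+ ℕS.con 1)) ℕS.:+ b) refl p' s₀ q' s))

  path : Σ (GraphStage s (Pgraph n p q)) λ gs → Net.D (GraphStage.net gs) ≡ DP s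
  path = Pgraph-stage n p q s refl refl n≡

  module Pa = GraphStage (proj₁ path)

  P-sym : ∀ u v → Pgraph n p q u v ≡ Pgraph n p q v u
  P-sym u v = ite-injective (trans (sym (Pa.adj u v)) (trans (Net.A-sym Pa.net u v) (Pa.adj v u)))

  -- Were there no leaf, `φ` would be a bijection and, by `core-≡`, an isomorphism with the P-graph.
  n₀≢n : ¬ Iso G (Pgraph n p q) → n₀ ≢ n
  n₀≢n ¬iso e = ¬iso (iso-of-embedding e G (λ k → Pgraph k p q) φ φ-injective (λ u v → ite-injective (core-≡ u v)))

  G-resistance : Σ _ (IsResistance G)
  G-resistance = permuted-resistance Ex.π F.net F.adj

  P-resistance : Σ _ (IsResistance (Pgraph n p q))
  P-resistance = permuted-resistance Perm.id Pa.net Pa.adj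

  DR-< : ¬ Iso G (Pgraph n p q) → ∀ {rG rP} → IsResistance G rG → IsResistance (Pgraph n p q) rP → DR G rG < DR (Pgraph n p q) rP
  DR-< ¬iso RG RP = subst₂ _<_ (sym (permuted-D (proj₁ simple) Ex.π F.net F.adj RG))
    (trans (sym (proj₂ path)) (sym (permuted-D P-sym Perm.id Pa.net Pa.adj RP)))
    (D-< (n₀≢n ¬iso))

theorem3p2 : (n p q : ℕ) → 3 ℕ.≤ p → 3 ℕ.≤ q → p ℕ.+ q ℕ.≤ suc n →
    (G : Graph n) → InB n p q G → ¬ Iso G (Pgraph n p q) →
    (Σ _ (IsResistance G)) × (Σ _ (IsResistance (Pgraph n p q))) ×
    (∀ rG rP → IsResistance G rG → IsResistance (Pgraph n p q) rP →
       DR G rG < DR (Pgraph n p q) rP)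
theorem3p2 n p q (ℕ.s≤s (ℕ.s≤s (ℕ.s≤s {n = μ} ℕ.z≤n))) (ℕ.s≤s (ℕ.s≤s (ℕ.s≤s {n = ν} ℕ.z≤n))) _ G (simple , connected , edges , cycles) ¬iso =
  M.G-resistance , M.P-resistance , λ _ _ → M.DR-< ¬iso
  where module M = Main μ ν simple connected edges cycles
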